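{- Let $n\ge 5$ and let $(v_i)_{i\in\mathbb{Z}}$ be a twisted $n$-gon in $\mathbb{RP}^2$ all of whose vertices lie on a non-degenerate conic section, and whose corner invariants $x_i,y_i$ are all defined. Then $O_k(P)=E_k(P)$ for every $k\in\{1,2,\dots,[n/2]\}\cup\{n\}$, where $P$ denotes this polygon.
   Context: A twisted $n$-gon is a sequence of points $v_i\in\mathbb{RP}^2$, $i\in\mathbb{Z}$, together with a projective transformation $M$ (the monodromy) such that $v_{i+n}=M(v_i)$ for all $i$. The cross ratio of four numbers (or four collinear points, via an affine coordinate) is $[t_1,t_2,t_3,t_4]=\frac{(t_1-t_2)(t_3-t_4)}{(t_1-t_3)(t_2-t_4)}$. Write $(a,b)$ for the line through points $a,b$. The corner invariants are $x_i=[v_{i-2},v_{i-1},(v_{i-2},v_{i-1})\cap(v_i,v_{i+1}),(v_{i-2},v_{i-1})\cap(v_{i+1},v_{i+2})]$ and $y_i=[v_{i+2},v_{i+1},(v_{i+2},v_{i+1})\cap(v_i,v_{i-1}),(v_{i+2},v_{i+1})\cap(v_{i-1},v_{i-2})]$ (cross ratios of four collinear points); they satisfy $x_{i+n}=x_i$, $y_{i+n}=y_i$, and all indices below are taken mod $n$. Monodromy invariants: $O_n=\prod_{i=1}^n x_i$, $E_n=\prod_{i=1}^n y_i$. For $1\le k\le [n/2]$, set $X_i=x_iy_ix_{i+1}$. Two of the monomials $x_i$, $X_j$ are called consecutive if they involve consecutive or coinciding variables $x$: $X_i,X_j$ are consecutive iff $j\in\{i-2,i-1,i,i+1,i+2\}$;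 $X_i,x_j$ are consecutive iff $j\in\{i-1,i,i+1,i+2\}$; $x_i,x_j$ are consecutive iff $j\in\{i-1,i,i+1\}$. A product $O=X_{i_1}\cdots X_{i_s}x_{j_1}\cdots x_{j_t}$ is admissible if no two of its factors are consecutive; its weight is $|O|=s+t$ and its sign is $(-1)^s$. Then $O_k=\sum_{|O|=k}(-1)^s O$, the sum over admissible products of weight $k$. The polynomials $E_k$ are defined in the same way with the roles of $x$ and $y$ interchanged: one uses the monomials $y_i$ and $Y_j=y_{j-1}x_jy_j$, with two of them consecutive iff they involve consecutive or coinciding variables $y$ (i.e. $Y_i,Y_j$ iff $j\in\{i-2,\dots,i+2\}$; $Y_i,y_j$ iff $j\in\{i-2,i-1,i,i+1\}$; $y_i,y_j$ iff $j\in\{i-1,i,i+1\}$), with the same weight and sign (sign $(-1)^{\#Y\text{ -factors}}$). $O_k(P),E_k(P)$ denote these polynomials evaluated on the corner invariants of $P$. -}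

module Defs where

open import Level using (0ℓ)
open import Data.Nat as ℕ using (ℕ; zero; suc; _≡ᵇ_)
open import Data.Bool using (Bool; true; false; _∧_; _∨_; not; if_then_else_)
open import Data.List using (List; []; _∷_; map; _++_; foldr; upTo; length; filterᵇ)
open import Data.Integer as ℤ using (ℤ; +_)
open import Data.Product using (Σ; ∃; _×_; _,_)
open import Relation.Binary.PropositionalEquality using (_≡_)
open import Relation.Nullary using (¬_)
open import Algebra.Structures using (IsCommutativeRing)
open import Relation.Binary.Structures using (IsTotalOrder)

-- The real numbers, axiomatised as a complete ordered field
-- (any model is isomorphic to ℝ).  Equality is propositional.

record RealField : Set₁ where
  infixl 6 _+_
  infixl 7 _*_
  infix 4 _≤_
  field
    Carrier : Set
    _+_ _*_ : Carrier → Carrier → Carrier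
    -_ : Carrier → Carrier
    0# 1# : Carrier
    isCommutativeRing : IsCommutativeRing _≡_ _+_ _*_ -_ 0# 1#
    0≢1 : ¬ (0# ≡ 1#)
    inverse : ∀ a → ¬ (a ≡ 0#) → ∃ λ b → a * b ≡ 1#
    _≤_ : Carrier → Carrier → Set
    isTotalOrder : IsTotalOrder _≡_ _≤_
    +-mono-≤ : ∀ {a b} c → a ≤ b → a + c ≤ b + c
    *-nonneg : ∀ {a b} → 0# ≤ a → 0# ≤ b → 0# ≤ a * b
    lub : (S : Carrier → Set) → (∃ λ s → S s) →
          (∃ λ b → ∀ s → S s → s ≤ b) →
          ∃ λ u → (∀ s → S s → s ≤ u) × (∀ b → (∀ s → S s → s ≤ b) → u ≤ b)

-- Projective plane geometry over the reals, in homogeneous coordinates.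

module Geometry (R : RealField) where
  open RealField R

  _−_ : Carrier → Carrier → Carrier
  a − b = a + (- b)
  infixl 6 _−_

  V3 : Set
  V3 = Carrier × Carrier × Carrier

  zero3 : V3
  zero3 = 0# , 0# , 0#

  _⊕_ : V3 → V3 → V3
  (a₁ , a₂ , a₃) ⊕ (b₁ , b₂ , b₃) = a₁ + b₁ , a₂ + b₂ , a₃ + b₃

  _•_ : Carrier → V3 → V3
  t • (a₁ , a₂ , a₃) = t * a₁ , t * a₂ , t * a₃

  dot : V3 → V3 → Carrier
  dot (a₁ , a₂ , a₃) (b₁ , b₂ , b₃) = a₁ * b₁ + a₂ * b₂ + a₃ * b₃

  cross : V3 → V3 → V3
  cross (a₁ , a₂ , a₃) (b₁ , b₂ , b₃) =
    a₂ * b₃ − a₃ * b₂ , a₃ * b₁ − a₁ * b₃ , a₁ * b₂ − a₂ * b₁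

  det3 : V3 → V3 → V3 → Carrier
  det3 a b c = dot a (cross b c)

  Mat3 : Set
  Mat3 = V3 × V3 × V3

  apply : Mat3 → V3 → V3
  apply (r₁ , r₂ , r₃) v = dot r₁ v , dot r₂ v , dot r₃ v

  detM : Mat3 → Carrier
  detM (r₁ , r₂ , r₃) = det3 r₁ r₂ r₃

  -- nonzero vector (a lift of a point of RP²)
  NonZero3 : V3 → Set
  NonZero3 v = ¬ (v ≡ zero3)

  -- a and b represent the same point of RP²
  _∼_ : V3 → V3 → Set
  a ∼ b = NonZero3 a × NonZero3 b × ∃ λ t → b ≡ t • a

  -- a and b represent distinct points of RP²
  Indep : V3 → V3 → Set
  Indep a b = ¬ (cross a b ≡ zero3)

  OnLine : V3 → V3 → V3 → Set
  OnLine a b z = det3 a b z ≡ 0#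

  record Meet (a b c d z : V3) : Set where
    field
      ab-line   : Indep a b
      cd-line   : Indep c d
      distinct  : ¬ (OnLine a b c × OnLine a b d)
      z-nonzero : NonZero3 z
      z-on-ab   : OnLine a b z
      z-on-cd   : OnLine c d z

  -- r is the cross ratio [a,b,c,d] of four collinear points, computed in
  -- an affine coordinate t on their common line (point t ↦ [p + t q]).
  record CrossRatio (a b c d : V3) (r : Carrier) : Set where
    field
      p q : V3
      pq-indep : Indep p q
      t₁ t₂ t₃ t₄ : Carrier
      a-coord : a ∼ (p ⊕ (t₁ • q))
      b-coord : b ∼ (p ⊕ (t₂ • q))
      c-coord : c ∼ (p ⊕ (t₃ • q))
      d-coord : d ∼ (p ⊕ (t₄ • q))
      den₁ : ¬ (t₁ − t₃ ≡ 0#)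
      den₂ : ¬ (t₂ − t₄ ≡ 0#)
      value : r * ((t₁ − t₃) * (t₂ − t₄)) ≡ (t₁ − t₂) * (t₃ − t₄)

  -- twisted n-gon: lifts v i of the vertices and a monodromy M
  record TwistedPolygon (n : ℕ) (v : ℤ → V3) : Set where
    field
      vertex-nonzero : ∀ i → NonZero3 (v i)
      M : Mat3
      M-invertible : ¬ (detM M ≡ 0#)
      monodromy : ∀ i → apply M (v i) ∼ v (i ℤ.+ + n)

  record NondegConic : Set where
    field
      Q : Mat3
      symmetric : let (r₁ , r₂ , r₃) = Q
                      (q₁₁ , q₁₂ , q₁₃) = r₁
                      (q₂₁ , q₂₂ , q₂₃) = r₂
                      (q₃₁ , q₃₂ , q₃₃) = r₃
                  in q₁₂ ≡ q₂₁ × q₁₃ ≡ q₃₁ × q₂₃ ≡ q₃₂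
      nondegenerate : ¬ (detM Q ≡ 0#)

  OnConic : NondegConic → V3 → Set
  OnConic C w = dot w (apply (NondegConic.Q C) w) ≡ 0#

  record IsCornerX (v : ℤ → V3) (i : ℤ) (r : Carrier) : Set where
    field
      z₃ z₄ : V3
      meet₃ : Meet (v (i ℤ.- + 2)) (v (i ℤ.- + 1)) (v i) (v (i ℤ.+ + 1)) z₃
      meet₄ : Meet (v (i ℤ.- + 2)) (v (i ℤ.- + 1)) (v (i ℤ.+ + 1)) (v (i ℤ.+ + 2)) z₄
      cr : CrossRatio (v (i ℤ.- + 2)) (v (i ℤ.- + 1)) z₃ z₄ r

  record IsCornerY (v : ℤ → V3) (i : ℤ) (r : Carrier) : Set where
    field
      z₃ z₄ : V3
      meet₃ : Meet (v (i ℤ.+ + 2)) (v (i ℤ.+ + 1)) (v i) (v (i ℤ.- + 1)) z₃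
      meet₄ : Meet (v (i ℤ.+ + 2)) (v (i ℤ.+ + 1)) (v (i ℤ.- + 1)) (v (i ℤ.- + 2)) z₄
      cr : CrossRatio (v (i ℤ.+ + 2)) (v (i ℤ.+ + 1)) z₃ z₄ r

  -- Monodromy invariants O_k, E_k as polynomials in the x_i, y_i.
  -- Indices are residues 0,…,n-1 mod n (same index set as 1,…,n mod n).

  sucₙ : ℕ → ℕ → ℕ
  sucₙ n i = if suc i ≡ᵇ n then 0 else suc i

  predₙ : ℕ → ℕ → ℕ
  predₙ n zero = n ℕ.∸ 1
  predₙ n (suc i) = i

  -- factors: big i stands for X_i (resp. Y_i), small i for x_i (resp. y_i)
  data Factor : Set where
    big small : ℕ → Factor

  factors : ℕ → List Factor
  factors n = map big (upTo n) ++ map small (upTo n)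

  sublists : {A : Set} → List A → List (List A)
  sublists [] = [] ∷ []
  sublists (a ∷ l) = map (a ∷_) (sublists l) ++ sublists l

  _eq_ : ℕ → ℕ → Bool
  _eq_ = _≡ᵇ_

  consO : ℕ → Factor → Factor → Bool
  consO n (big i) (big j) =
    (j eq i) ∨ (j eq sucₙ n i) ∨ (j eq sucₙ n (sucₙ n i)) ∨
    (i eq sucₙ n j) ∨ (i eq sucₙ n (sucₙ n j))
  consO n (big i) (small j) =
    (i eq sucₙ n j) ∨ (j eq i) ∨ (j eq sucₙ n i) ∨ (j eq sucₙ n (sucₙ n i))
  consO n (small j) (big i) =
    (i eq sucₙ n j) ∨ (j eq i) ∨ (j eq sucₙ n i) ∨ (j eq sucₙ n (sucₙ n i))
  consO n (small i) (small j) = (j eq i) ∨ (j eq sucₙ n i) ∨ (i eq sucₙ n j)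

  consE : ℕ → Factor → Factor → Bool
  consE n (big i) (big j) =
    (j eq i) ∨ (j eq sucₙ n i) ∨ (j eq sucₙ n (sucₙ n i)) ∨
    (i eq sucₙ n j) ∨ (i eq sucₙ n (sucₙ n j))
  consE n (big i) (small j) =
    (i eq sucₙ n (sucₙ n j)) ∨ (i eq sucₙ n j) ∨ (j eq i) ∨ (j eq sucₙ n i)
  consE n (small j) (big i) =
    (i eq sucₙ n (sucₙ n j)) ∨ (i eq sucₙ n j) ∨ (j eq i) ∨ (j eq sucₙ n i)
  consE n (small i) (small j) = (j eq i) ∨ (j eq sucₙ n i) ∨ (i eq sucₙ n j)

  admissible : (Factor → Factor → Bool) → List Factor → Bool
  admissible c [] = true
  admissible c (f ∷ fs) = noneCons fs ∧ admissible c fs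
    where
    noneCons : List Factor → Bool
    noneCons [] = true
    noneCons (g ∷ gs) = not (c f g) ∧ noneCons gs

  bigCount : List Factor → ℕ
  bigCount [] = 0
  bigCount (big _ ∷ fs) = suc (bigCount fs)
  bigCount (small _ ∷ fs) = bigCount fs

  sign : ℕ → Carrier
  sign zero = 1#
  sign (suc s) = - sign s

  sumR : List Carrier → Carrier
  sumR = foldr _+_ 0#

  prodR : List Carrier → Carrier
  prodR = foldr _*_ 1#

  at : (ℤ → Carrier) → ℕ → Carrier
  at x i = x (+ i)

  valO : ℕ → (ℤ → Carrier) → (ℤ → Carrier) → Factor → Carrier
  valO n x y (big i) = at x i * at y i * at x (sucₙ n i)
  valO n x y (small i) = at x i

  valE : ℕ → (ℤ → Carrier) → (ℤ → Carrier) → Factor → Carrier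
  valE n x y (big j) = at y (predₙ n j) * at x j * at y j
  valE n x y (small j) = at y j

  poly : (ℕ → Factor → Factor → Bool) →
         (ℕ → (ℤ → Carrier) → (ℤ → Carrier) → Factor → Carrier) →
         ℕ → ℕ → (ℤ → Carrier) → (ℤ → Carrier) → Carrier
  poly c val n k x y =
    sumR (map (λ S → sign (bigCount S) * prodR (map (val n x y) S))
              (filterᵇ (λ S → (length S ≡ᵇ k) ∧ admissible (c n) S)
                       (sublists (factors n))))

  -- O_k and E_k for 1 ≤ k ≤ [n/2]
  Opoly Epoly : ℕ → ℕ → (ℤ → Carrier) → (ℤ → Carrier) → Carrier
  Opoly = poly consO valO
  Epoly = poly consE valE

  Oprod Eprod : ℕ → (ℤ → Carrier) → (ℤ → Carrier) → Carrier
  Oprod n x y = prodR (map (at x) (upTo n))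
  Eprod n x y = prodR (map (at y) (upTo n))

{-# OPTIONS --safe #-}
module Submission where

-- For a polygon inscribed in a conic, let c_i be the cross ratio of the four
-- points v_{i-1}, v_i, v_{i+1}, v_{i+2} on the conic. Then x_i = c_{i-1} / (1 − c_i)
-- and y_i = c_i / (1 − c_{i-1}), and the equality of the products O_n and E_n is
-- immediate. The polynomials Σ O_k z^k and Σ E_k z^k are generating functions of
-- tilings of a cycle of n cells by tiles of lengths 1, 2 and 3, hence traces of
-- monodromies of the recursions
--   f_{i+1} = f_i + z x_{i-1} f_{i-1} − z x_{i-2} y_{i-2} x_{i-1} f_{i-2},
--   g_{i+1} = g_i + z y_{i-1} g_{i-1} − z y_{i-2} x_{i-1} y_{i-1} g_{i-2}.
-- The relations between x, y and c mean that g_i = c_{i-1} f_i + (1 − c_{i-1}) f_{i+1}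
-- carries solutions of the first to solutions of the second, so for all but at
-- most one value of z the monodromies are conjugate.

open import Defs
open import Level using (0ℓ)
open import Algebra.Bundles using (CommutativeRing)
import Algebra.Solver.Ring as RingSolver
open import Algebra.Solver.Ring.AlmostCommutativeRing
  using (fromCommutativeRing; _-Raw-AlmostCommutative⟶_)
open import Data.Bool using (Bool; true; false; _∧_; _∨_; not; if_then_else_)
open import Data.Bool.ListAction using (all)
import Data.Bool.Properties as Boolₚ
open import Data.Empty using (⊥-elim)
open import Data.Integer using (ℤ)
import Data.Integer as ℤ
import Data.Integer.Properties as ℤₚ
open import Data.List using (List; []; _∷_; map; _++_; _∷ʳ_; upTo; downFrom; applyUpTo; length; filterᵇ)
import Data.List.Properties as Listₚ
open import Data.List.Relation.Binary.Permutation.Propositional as Perm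
  using (_↭_; prep; swap; ↭-refl; ↭-sym; ↭-trans)
import Data.List.Relation.Binary.Permutation.Propositional.Properties as Permₚ
open import Data.List.Relation.Unary.All as All using (All; []; _∷_)
import Data.List.Relation.Unary.All.Properties as Allₚ
open import Data.Maybe using (Maybe; just; nothing)
open import Data.Nat using (ℕ; _≤_; ⌊_/2⌋)
open import Data.Nat as ℕ using (zero; suc; _<_; _≡ᵇ_; _≤ᵇ_; z≤n; s≤s; s≤s⁻¹)
import Data.Nat.Properties as ℕₚ
open import Data.Product using (∃; _×_; _,_; proj₁; proj₂)
open import Data.Sum using (inj₁; inj₂; [_,_]′)
open import Data.Unit using (⊤; tt)
open import Function using (_∘_)
open import Relation.Binary.PropositionalEquality
open import Relation.Binary.Structures using (IsTotalOrder)
open import Relation.Nullary using (¬_; yes; no)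

-- Equality in the field is not decidable, so a case such as X j * Y j = 1 is reached only under a
-- double negation; completeness of the field makes equality stable, and the final equations shed
-- the negations. The conic is never parametrised. For suitable lifts its bilinear form is a
-- multiple of (t_a - t_b)². Put p = (t_a - t_b)(t_c - t_d), q = (t_a - t_c)(t_b - t_d), r = (t_a -
-- t_d)(t_b - t_c). Then p + r = q, so p² + q² - r² = 2pq, and the cross ratio p / q equals (p² + q²
-- - r²) / (2q²), which is written in values of the form alone. The monodromy need not preserve the
-- conic, so the c_i do not inherit their period from it. The period comes from x and y, which are
-- projective invariants, through the two relations. The map between the recursions has a
-- determinant of degree at most 1 in z with nonzero constant term. It is cancelled on the level of
-- coefficients, which avoids the exceptional z.

-- Ordered field arithmetic and stability of equality.

module RealFieldProperties (R : RealField) where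
  open RealField R using (isCommutativeRing; 0≢1; inverse; isTotalOrder; +-mono-≤; *-nonneg; lub) renaming (_≤_ to _⩽_)

  commutativeRing : CommutativeRing 0ℓ 0ℓ
  commutativeRing = record { isCommutativeRing = isCommutativeRing }

  open CommutativeRing commutativeRing public
    using ( Carrier; _+_; _*_; -_; 0#; 1#; semiring; ring; +-abelianGroup
          ; +-assoc; +-comm; +-identityˡ; +-identityʳ; -‿inverseʳ
          ; *-assoc; *-comm; *-identityˡ; *-identityʳ; distribˡ; zeroˡ; zeroʳ)
  open import Algebra.Properties.Ring ring using (-‿distribˡ-*; -‿distribʳ-*; -0#≈0#; x∙y⁻¹≈ε⇒x≈y; -‿involutive)
  open import Algebra.Properties.AbelianGroup +-abelianGroup using (⁻¹-∙-comm)
  private module Mult where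
    open import Algebra.Properties.Semiring.Mult.TCOptimised semiring public
  open Mult using (×-homo-+; ×1-homo-*; 1+×)

  private
    fromℤ : ℤ → Carrier
    fromℤ (ℤ.+ n)      = n Mult.× 1#
    fromℤ (ℤ.-[1+ n ]) = - (suc n Mult.× 1#)

    fromℤ-⊖ : ∀ m n → fromℤ (m ℤ.⊖ n) ≡ m Mult.× 1# + - (n Mult.× 1#)
    fromℤ-⊖ zero zero = sym (-‿inverseʳ 0#)
    fromℤ-⊖ zero (suc n) = sym (+-identityˡ _)
    fromℤ-⊖ (suc m) zero = sym (trans (cong (λ t → suc m Mult.× 1# + t) -0#≈0#) (+-identityʳ _))
    fromℤ-⊖ (suc m) (suc n) = begin
      fromℤ (suc m ℤ.⊖ suc n)   ≡⟨ cong fromℤ (ℤₚ.[1+m]⊖[1+n]≡m⊖n m n) ⟩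
      fromℤ (m ℤ.⊖ n)           ≡⟨ fromℤ-⊖ m n ⟩
      a + - b                   ≡⟨ +-identityˡ _ ⟨
      0# + (a + - b)            ≡⟨ cong (_+ (a + - b)) (-‿inverseʳ 1#) ⟨
      (1# + - 1#) + (a + - b)   ≡⟨ +-assoc 1# (- 1#) _ ⟩
      1# + (- 1# + (a + - b))   ≡⟨ cong (1# +_) (trans (sym (+-assoc (- 1#) a _)) (trans (cong (_+ - b) (+-comm (- 1#) a)) (+-assoc a (- 1#) _))) ⟩
      1# + (a + (- 1# + - b))   ≡⟨ +-assoc 1# a _ ⟨
      (1# + a) + (- 1# + - b)   ≡⟨ cong ((1# + a) +_) (⁻¹-∙-comm 1# b) ⟩
      (1# + a) + - (1# + b)     ≡⟨ cong₂ (λ p q → p + - q) (1+× m 1#) (1+× n 1#) ⟨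
      suc m Mult.× 1# + - (suc n Mult.× 1#) ∎
      where
      open ≡-Reasoning
      a = m Mult.× 1#
      b = n Mult.× 1#

    fromℤ-neg : ∀ i → fromℤ (ℤ.- i) ≡ - fromℤ i
    fromℤ-neg (ℤ.+ zero) = sym -0#≈0#
    fromℤ-neg (ℤ.+ suc n) = refl
    fromℤ-neg ℤ.-[1+ n ] = sym (-‿involutive _)

    fromℤ-+ : ∀ i j → fromℤ (i ℤ.+ j) ≡ fromℤ i + fromℤ j
    fromℤ-+ (ℤ.+ m) (ℤ.+ n) = ×-homo-+ 1# m n
    fromℤ-+ (ℤ.+ m) ℤ.-[1+ n ] = fromℤ-⊖ m (suc n)
    fromℤ-+ ℤ.-[1+ m ] (ℤ.+ n) = trans (fromℤ-⊖ n (suc m)) (+-comm _ _)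
    fromℤ-+ ℤ.-[1+ m ] ℤ.-[1+ n ] = trans
      (cong -_ (trans (cong (Mult._× 1#) (cong suc (sym (ℕₚ.+-suc m n)))) (×-homo-+ 1# (suc m) (suc n))))
      (sym (⁻¹-∙-comm _ _))

    fromℤ-pos-* : ∀ m j → fromℤ (ℤ.+ m ℤ.* j) ≡ (m Mult.× 1#) * fromℤ j
    fromℤ-pos-* m (ℤ.+ n) = trans (cong fromℤ (sym (ℤₚ.pos-* m n))) (×1-homo-* m n)
    fromℤ-pos-* m ℤ.-[1+ n ] = begin
      fromℤ (ℤ.+ m ℤ.* ℤ.- (ℤ.+ suc n))        ≡⟨ cong fromℤ (ℤₚ.neg-distribʳ-* (ℤ.+ m) (ℤ.+ suc n)) ⟨
      fromℤ (ℤ.- (ℤ.+ m ℤ.* ℤ.+ suc n))        ≡⟨ fromℤ-neg (ℤ.+ m ℤ.* ℤ.+ suc n) ⟩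
      - fromℤ (ℤ.+ m ℤ.* ℤ.+ suc n)            ≡⟨ cong -_ (fromℤ-pos-* m (ℤ.+ suc n)) ⟩
      - ((m Mult.× 1#) * (suc n Mult.× 1#)) ≡⟨ -‿distribʳ-* _ _ ⟩
      (m Mult.× 1#) * - (suc n Mult.× 1#)  ∎
      where open ≡-Reasoning

    fromℤ-* : ∀ i j → fromℤ (i ℤ.* j) ≡ fromℤ i * fromℤ j
    fromℤ-* (ℤ.+ m) j = fromℤ-pos-* m j
    fromℤ-* ℤ.-[1+ m ] j = begin
      fromℤ (ℤ.- (ℤ.+ suc m) ℤ.* j)   ≡⟨ cong fromℤ (ℤₚ.neg-distribˡ-* (ℤ.+ suc m) j) ⟨
      fromℤ (ℤ.- (ℤ.+ suc m ℤ.* j))   ≡⟨ fromℤ-neg (ℤ.+ suc m ℤ.* j) ⟩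
      - fromℤ (ℤ.+ suc m ℤ.* j)       ≡⟨ cong -_ (fromℤ-pos-* (suc m) j) ⟩
      - ((suc m Mult.× 1#) * fromℤ j) ≡⟨ -‿distribˡ-* _ _ ⟩
      - (suc m Mult.× 1#) * fromℤ j ∎
      where open ≡-Reasoning

    fromℤ-homomorphism : CommutativeRing.rawRing ℤₚ.+-*-commutativeRing
                           -Raw-AlmostCommutative⟶ fromCommutativeRing commutativeRing
    fromℤ-homomorphism = record
      { ⟦_⟧ = fromℤ ; +-homo = fromℤ-+ ; *-homo = fromℤ-* ; -‿homo = fromℤ-neg
      ; 0-homo = refl ; 1-homo = refl }

    fromℤ-≟ : ∀ i j → Maybe (fromℤ i ≡ fromℤ j)
    fromℤ-≟ i j with i ℤ.≟ j
    ... | yes i≡j = just (cong fromℤ i≡j)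
    ... | no _    = nothing

  -- With coefficients in ℤ the solver cancels terms although equality in R is not decidable.
  module ℤ-Solver = RingSolver (CommutativeRing.rawRing ℤₚ.+-*-commutativeRing)
    (fromCommutativeRing commutativeRing) fromℤ-homomorphism fromℤ-≟
  open ℤ-Solver using (solve; _:=_; _:+_; _:*_; :-_; _:-_)

  :0 :1 :2 : ∀ {n} → ℤ-Solver.Polynomial n
  :0 = ℤ-Solver.con (ℤ.+ 0)
  :1 = ℤ-Solver.con (ℤ.+ 1)
  :2 = ℤ-Solver.con (ℤ.+ 2)

  open IsTotalOrder isTotalOrder using (total; antisym) renaming (refl to ≤-refl; trans to ≤-trans; reflexive to ≤-reflexive)

  +-cancel-≡ : ∀ {a b} → a + - b ≡ 0# → a ≡ b
  +-cancel-≡ {a} {b} = x∙y⁻¹≈ε⇒x≈y a b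

  *-cancelˡ-0 : ∀ {a b} → ¬ a ≡ 0# → a * b ≡ 0# → b ≡ 0#
  *-cancelˡ-0 {a} {b} a≢0 ab≡0 with inverse a a≢0
  ... | a⁻¹ , aa⁻¹≡1 = begin
    b               ≡⟨ *-identityʳ b ⟨
    b * 1#          ≡⟨ cong (b *_) aa⁻¹≡1 ⟨
    b * (a * a⁻¹)   ≡⟨ solve 3 (λ a b i → b :* (a :* i) := i :* (a :* b)) refl a b a⁻¹ ⟩
    a⁻¹ * (a * b)   ≡⟨ cong (a⁻¹ *_) ab≡0 ⟩
    a⁻¹ * 0#        ≡⟨ zeroʳ a⁻¹ ⟩
    0#              ∎
    where open ≡-Reasoning

  *-cancelˡ : ∀ {a b c} → ¬ a ≡ 0# → a * b ≡ a * c → b ≡ c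
  *-cancelˡ {a} {b} {c} a≢0 ab≡ac = +-cancel-≡ (*-cancelˡ-0 a≢0 (begin
    a * (b + - c)       ≡⟨ solve 3 (λ a b c → a :* (b :- c) := a :* b :- a :* c) refl a b c ⟩
    a * b + - (a * c)   ≡⟨ cong (λ t → t + - (a * c)) ab≡ac ⟩
    a * c + - (a * c)   ≡⟨ -‿inverseʳ _ ⟩
    0#                  ∎))
    where open ≡-Reasoning

  *-≢0 : ∀ {a b} → ¬ a ≡ 0# → ¬ b ≡ 0# → ¬ a * b ≡ 0#
  *-≢0 a≢0 b≢0 ab≡0 = b≢0 (*-cancelˡ-0 a≢0 ab≡0)

  *-≢0ˡ : ∀ {a b} → ¬ a * b ≡ 0# → ¬ a ≡ 0#
  *-≢0ˡ {b = b} ab≢0 a≡0 = ab≢0 (trans (cong (_* b) a≡0) (zeroˡ b))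

  *-≢0ʳ : ∀ {a b} → ¬ a * b ≡ 0# → ¬ b ≡ 0#
  *-≢0ʳ {a} ab≢0 b≡0 = ab≢0 (trans (cong (a *_) b≡0) (zeroʳ a))

  a≤0⇒0≤-a : ∀ {a} → a ⩽ 0# → 0# ⩽ - a
  a≤0⇒0≤-a {a} a≤0 = subst₂ _⩽_ (-‿inverseʳ a) (+-identityˡ (- a)) (+-mono-≤ (- a) a≤0)

  0≤1 : 0# ⩽ 1#
  0≤1 with total 0# 1#
  ... | inj₁ p = p
  ... | inj₂ q = subst (0# ⩽_) (solve 0 ((:- :1) :* (:- :1) := :1) refl)
                   (*-nonneg (a≤0⇒0≤-a q) (a≤0⇒0≤-a q))

  1≰0 : ¬ 1# ⩽ 0#
  1≰0 1≤0 = 0≢1 (antisym 0≤1 1≤0)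

  -- If 0 ≤ e is not nonzero, all multiples of e are at most 1, and their
  -- supremum u satisfies u ≤ u − e.
  private
    stable-nonneg : ∀ {e} → 0# ⩽ e → ¬ ¬ e ≡ 0# → e ≡ 0#
    stable-nonneg {e} 0≤e ¬¬e≡0 = antisym e≤0 0≤e
      where
      Multiple : Carrier → Set
      Multiple r = ∃ λ k → r ≡ (k Mult.× 1#) * e

      bounded : ∀ s → Multiple s → s ⩽ 1#
      bounded s (k , s≡ke) with total s 1#
      ... | inj₁ p = p
      -- A multiple of e that is at least 1 shows that e is nonzero.
      ... | inj₂ q = ⊥-elim (¬¬e≡0 λ e≡0 → 1≰0
              (subst (1# ⩽_) (trans s≡ke (trans (cong (_ *_) e≡0) (zeroʳ _))) q))

      supremum = lub Multiple (0# , 0 , sym (zeroˡ e)) (1# , bounded)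
      u = proj₁ supremum

      u-e-bound : ∀ s → Multiple s → s ⩽ u + - e
      u-e-bound s (k , s≡ke) = subst (_⩽ u + - e)
        (trans (cong (λ t → t * e + - e) (1+× k 1#))
          (trans (solve 2 (λ k e → (:1 :+ k) :* e :- e := k :* e) refl (k Mult.× 1#) e) (sym s≡ke)))
        (+-mono-≤ (- e) (proj₁ (proj₂ supremum) _ (suc k , refl)))

      e≤0 : e ⩽ 0#
      e≤0 = subst₂ _⩽_
        (solve 2 (λ u e → u :+ (e :- u) := e) refl u e)
        (solve 2 (λ u e → u :- e :+ (e :- u) := :0) refl u e)
        (+-mono-≤ (e + - u) (proj₂ (proj₂ supremum) (u + - e) u-e-bound))

  -- Lets an equation be proved with the help of objects and case distinctions that are available
  -- only up to double negation. The order is total, so `stable-nonneg` applies to the difference or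
  -- to its negative.
  ≡-stable : ∀ {a b} → ¬ ¬ a ≡ b → a ≡ b
  ≡-stable {a} {b} ¬¬a≡b = +-cancel-≡ ([ (λ p → stable-nonneg p ¬¬d≡0) , nonpos ]′ (total 0# d))
    where
    d = a + - b
    ¬¬d≡0 : ¬ ¬ d ≡ 0#
    ¬¬d≡0 d≢0 = ¬¬a≡b λ a≡b → d≢0 (trans (cong (λ t → t + - b) a≡b) (-‿inverseʳ b))
    nonpos : d ⩽ 0# → d ≡ 0#
    nonpos d≤0 = trans (sym (-‿involutive d)) (trans (cong -_
      (stable-nonneg (a≤0⇒0≤-a d≤0) λ -d≢0 → ¬¬d≡0 λ d≡0 → -d≢0 (trans (cong -_ d≡0) -0#≈0#))) -0#≈0#)

  2# : Carrier
  2# = 1# + 1#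

  ≤-double : ∀ {r} → 2# ⩽ r → 2# ⩽ r + r
  ≤-double {r} 2≤r = ≤-trans 2≤r (subst (_⩽ r + r) (+-identityˡ r) (+-mono-≤ r 0≤r))
    where
    0≤2 : 0# ⩽ 2#
    0≤2 = ≤-trans 0≤1 (subst (_⩽ 2#) (+-identityˡ 1#) (+-mono-≤ 1# 0≤1))
    0≤r : 0# ⩽ r
    0≤r = ≤-trans 0≤2 2≤r

  2≤⇒-1≢0 : ∀ {r} → 2# ⩽ r → ¬ r + - 1# ≡ 0#
  2≤⇒-1≢0 {r} 2≤r r-1≡0 = 1≰0 (subst₂ _⩽_
    (solve 0 (:2 :- :1 := :1) refl) r-1≡0 (+-mono-≤ (- 1#) 2≤r))

  2≢0 : ¬ 2# ≡ 0#
  2≢0 2≡0 = 1≰0 (subst₂ _⩽_ (+-identityˡ 1#) 2≡0 (+-mono-≤ 1# 0≤1))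

  -- Polynomials that vanish at all nonzero arguments.

  evalPoly : ℕ → (ℕ → Carrier) → Carrier → Carrier
  evalPoly zero    f z = 0#
  evalPoly (suc m) f z = f 0 + z * evalPoly m (f ∘ suc) z

  private
    -- Coefficients of r p(2z) - p(z): the one of degree k is multiplied by 2^k r - 1.
    doubling : ℕ → (ℕ → Carrier) → Carrier → ℕ → Carrier
    doubling zero    f r _ = 0#
    doubling (suc m) f r zero = (r + - 1#) * f 0
    doubling (suc m) f r (suc k) = doubling m (f ∘ suc) (r + r) k

    evalPoly-doubling : ∀ m f r z →
      evalPoly m (doubling m f r) z ≡ r * evalPoly m f (z + z) + - evalPoly m f z
    evalPoly-doubling zero f r z = sym (trans (cong₂ _+_ (zeroʳ r) -0#≈0#) (+-identityˡ 0#))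
    evalPoly-doubling (suc m) f r z =
      trans (cong (λ t → (r + - 1#) * f 0 + z * t) (evalPoly-doubling m (f ∘ suc) (r + r) z))
        (solve 5 (λ r a z p q → (r :- :1) :* a :+ z :* ((r :+ r) :* p :- q)
                             := r :* (a :+ (z :+ z) :* p) :- (a :+ z :* q)) refl
          r (f 0) z (evalPoly m (f ∘ suc) (z + z)) (evalPoly m (f ∘ suc) z))

    -- The bound 2 ≤ r survives doubling, so every factor 2^k r - 1 is nonzero and can be cancelled.
    doubling-injective : ∀ m f r → 2# ⩽ r → (∀ k → k < m → doubling m f r k ≡ 0#) →
                         ∀ k → k < m → f k ≡ 0#
    doubling-injective (suc m) f r 2≤r vanish zero _ =
      *-cancelˡ-0 (2≤⇒-1≢0 2≤r) (vanish 0 (s≤s z≤n))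
    doubling-injective (suc m) f r 2≤r vanish (suc k) (s≤s k<m) =
      doubling-injective m (f ∘ suc) (r + r) (≤-double 2≤r) (λ j j<m → vanish (suc j) (s≤s j<m)) k k<m

  evalPoly-zero : ∀ m f z → (∀ k → k < m → f k ≡ 0#) → evalPoly m f z ≡ 0#
  evalPoly-zero zero f z _ = refl
  evalPoly-zero (suc m) f z f≡0 = trans
    (cong₂ (λ s t → s + z * t) (f≡0 0 (s≤s z≤n)) (evalPoly-zero m (f ∘ suc) z (λ k k<m → f≡0 (suc k) (s≤s k<m))))
    (trans (+-identityˡ _) (zeroʳ z))

  -- p(2z) − p(z) is z times a polynomial with one coefficient fewer, in which
  -- the coefficient of z^k in p appears multiplied by 2^k − 1.
  evalPoly-injective : ∀ m f → (∀ z → ¬ z ≡ 0# → evalPoly m f z ≡ 0#) → ∀ k → k < m → f k ≡ 0#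
  evalPoly-injective (suc m) f vanish = λ where
      zero _ → f0≡0
      (suc k) (s≤s k<m) → rest≡0 k k<m
    where
    open ≡-Reasoning
    g = f ∘ suc
    -- The difference can be divided by z only where z is nonzero, which is why the induction ranges
    -- over nonzero arguments.
    difference≡0 : ∀ z → ¬ z ≡ 0# → evalPoly m (doubling m g 2#) z ≡ 0#
    difference≡0 z z≢0 = trans (evalPoly-doubling m g 2# z) (*-cancelˡ-0 z≢0 (begin
      z * (2# * evalPoly m g (z + z) + - evalPoly m g z)
        ≡⟨ solve 4 (λ z a p q → z :* (:2 :* p :- q)
                             := (a :+ (z :+ z) :* p) :- (a :+ z :* q)) refl
             z (f 0) (evalPoly m g (z + z)) (evalPoly m g z) ⟩
      evalPoly (suc m) f (z + z) + - evalPoly (suc m) f z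
        ≡⟨ cong₂ (λ s t → s + - t) (vanish (z + z) z+z≢0) (vanish z z≢0) ⟩
      0# + - 0#
        ≡⟨ -‿inverseʳ 0# ⟩
      0# ∎))
      where
      z+z≢0 : ¬ z + z ≡ 0#
      z+z≢0 z+z≡0 = *-≢0 2≢0 z≢0
        (trans (solve 1 (λ z → :2 :* z := z :+ z) refl z) z+z≡0)
    rest≡0 : ∀ k → k < m → g k ≡ 0#
    rest≡0 = doubling-injective m g 2# ≤-refl (evalPoly-injective m (doubling m g 2#) difference≡0)
    -- With the higher coefficients gone, the value at 1 is the constant term.
    f0≡0 : f 0 ≡ 0#
    f0≡0 = begin
      f 0                       ≡⟨ solve 1 (λ a → a := a :+ :1 :* :0) refl (f 0) ⟩
      f 0 + 1# * 0#             ≡⟨ cong (λ t → f 0 + 1# * t) (evalPoly-zero m g 1# rest≡0) ⟨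
      evalPoly (suc m) f 1#     ≡⟨ vanish 1# (0≢1 ∘ sym) ⟩
      0#                        ∎

-- Determinant identities and intersections of lines.

module ProjectivePlane (R : RealField) where
  open RealFieldProperties R
  open ℤ-Solver using (solve; _:=_; _:+_; _:*_; :-_; _:-_; Polynomial)
  open Geometry R

  private
    Polynomial3 : ℕ → Set
    Polynomial3 n = Polynomial n × Polynomial n × Polynomial n

    :dot : ∀ {n} → Polynomial3 n → Polynomial3 n → Polynomial n
    :dot (a₁ , a₂ , a₃) (b₁ , b₂ , b₃) = a₁ :* b₁ :+ a₂ :* b₂ :+ a₃ :* b₃

    :cross : ∀ {n} → Polynomial3 n → Polynomial3 n → Polynomial3 n
    :cross (a₁ , a₂ , a₃) (b₁ , b₂ , b₃) =
      a₂ :* b₃ :- a₃ :* b₂ , a₃ :* b₁ :- a₁ :* b₃ , a₁ :* b₂ :- a₂ :* b₁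

    :det3 : ∀ {n} → Polynomial3 n → Polynomial3 n → Polynomial3 n → Polynomial n
    :det3 a b c = :dot a (:cross b c)

    :apply : ∀ {n} → Polynomial3 n × Polynomial3 n × Polynomial3 n → Polynomial3 n → Polynomial3 n
    :apply (r₁ , r₂ , r₃) v = :dot r₁ v , :dot r₂ v , :dot r₃ v

    infixr 8 _:•_
    _:•_ : ∀ {n} → Polynomial n → Polynomial3 n → Polynomial3 n
    t :• (a₁ , a₂ , a₃) = t :* a₁ , t :* a₂ , t :* a₃

  ≡3 : ∀ {a₁ a₂ a₃ b₁ b₂ b₃ : Carrier} → a₁ ≡ b₁ → a₂ ≡ b₂ → a₃ ≡ b₃ →
       _≡_ {A = V3} (a₁ , a₂ , a₃) (b₁ , b₂ , b₃)
  ≡3 refl refl refl = refl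

  det3-rotate : ∀ a b c → det3 a b c ≡ det3 b c a
  det3-rotate (a₁ , a₂ , a₃) (b₁ , b₂ , b₃) (c₁ , c₂ , c₃) =
    solve 9 (λ a₁ a₂ a₃ b₁ b₂ b₃ c₁ c₂ c₃ →
      let a = a₁ , a₂ , a₃ ; b = b₁ , b₂ , b₃ ; c = c₁ , c₂ , c₃ in
      :det3 a b c := :det3 b c a) refl a₁ a₂ a₃ b₁ b₂ b₃ c₁ c₂ c₃

  det3-swap : ∀ a b c → det3 a b c ≡ - det3 a c b
  det3-swap (a₁ , a₂ , a₃) (b₁ , b₂ , b₃) (c₁ , c₂ , c₃) =
    solve 9 (λ a₁ a₂ a₃ b₁ b₂ b₃ c₁ c₂ c₃ →
      let a = a₁ , a₂ , a₃ ; b = b₁ , b₂ , b₃ ; c = c₁ , c₂ , c₃ in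
      :det3 a b c := :- :det3 a c b) refl a₁ a₂ a₃ b₁ b₂ b₃ c₁ c₂ c₃

  det3-repeat : ∀ a b → det3 a b a ≡ 0#
  det3-repeat (a₁ , a₂ , a₃) (b₁ , b₂ , b₃) =
    solve 6 (λ a₁ a₂ a₃ b₁ b₂ b₃ → let a = a₁ , a₂ , a₃ ; b = b₁ , b₂ , b₃ in
      :det3 a b a := :0) refl a₁ a₂ a₃ b₁ b₂ b₃

  det3-scale : ∀ r s t a b c → det3 (r • a) (s • b) (t • c) ≡ r * s * t * det3 a b c
  det3-scale r s t (a₁ , a₂ , a₃) (b₁ , b₂ , b₃) (c₁ , c₂ , c₃) =
    solve 12 (λ r s t a₁ a₂ a₃ b₁ b₂ b₃ c₁ c₂ c₃ →
      let a = a₁ , a₂ , a₃ ; b = b₁ , b₂ , b₃ ; c = c₁ , c₂ , c₃ in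
      :det3 (r :• a) (s :• b) (t :• c) := r :* s :* t :* :det3 a b c)
      refl r s t a₁ a₂ a₃ b₁ b₂ b₃ c₁ c₂ c₃

  det3-apply : ∀ A b c d → det3 (apply A b) (apply A c) (apply A d) ≡ detM A * det3 b c d
  det3-apply ((a₁ , a₂ , a₃) , (b₁ , b₂ , b₃) , (c₁ , c₂ , c₃)) (d₁ , d₂ , d₃) (e₁ , e₂ , e₃) (f₁ , f₂ , f₃) =
    solve 18 (λ a₁ a₂ a₃ b₁ b₂ b₃ c₁ c₂ c₃ d₁ d₂ d₃ e₁ e₂ e₃ f₁ f₂ f₃ →
      let a = a₁ , a₂ , a₃ ; b = b₁ , b₂ , b₃ ; c = c₁ , c₂ , c₃
          d = d₁ , d₂ , d₃ ; e = e₁ , e₂ , e₃ ; f = f₁ , f₂ , f₃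
          A = a , b , c in
      :det3 (:apply A d) (:apply A e) (:apply A f) := :det3 a b c :* :det3 d e f)
      refl a₁ a₂ a₃ b₁ b₂ b₃ c₁ c₂ c₃ d₁ d₂ d₃ e₁ e₂ e₃ f₁ f₂ f₃

  -- Modulo o the brackets become 2 by 2 minors of four plane vectors, and this is their three-term
  -- relation. When one bracket is zero it moves a point along a line through o.
  plücker : ∀ o a b c d →
    det3 o a b * det3 o c d + det3 o a d * det3 o b c ≡ det3 o a c * det3 o b d
  plücker (o₁ , o₂ , o₃) (a₁ , a₂ , a₃) (b₁ , b₂ , b₃) (c₁ , c₂ , c₃) (d₁ , d₂ , d₃) =
    solve 15 (λ o₁ o₂ o₃ a₁ a₂ a₃ b₁ b₂ b₃ c₁ c₂ c₃ d₁ d₂ d₃ →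
      let o = o₁ , o₂ , o₃ ; a = a₁ , a₂ , a₃ ; b = b₁ , b₂ , b₃
          c = c₁ , c₂ , c₃ ; d = d₁ , d₂ , d₃ in
      :det3 o a b :* :det3 o c d :+ :det3 o a d :* :det3 o b c := :det3 o a c :* :det3 o b d)
      refl o₁ o₂ o₃ a₁ a₂ a₃ b₁ b₂ b₃ c₁ c₂ c₃ d₁ d₂ d₃

  cross-scale : ∀ s t a b → cross (s • a) (t • b) ≡ (s * t) • cross a b
  cross-scale s t (a₁ , a₂ , a₃) (b₁ , b₂ , b₃) = ≡3 (minor a₂ a₃ b₂ b₃) (minor a₃ a₁ b₃ b₁) (minor a₁ a₂ b₁ b₂)
    where
    minor : ∀ a a′ b b′ → (s * a) * (t * b′) − (s * a′) * (t * b) ≡ s * t * (a * b′ − a′ * b)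
    minor = solve 6 (λ s t a a′ b b′ →
      (s :* a) :* (t :* b′) :- (s :* a′) :* (t :* b) := s :* t :* (a :* b′ :- a′ :* b)) refl s t

  cross-affine : ∀ p q s t → cross (p ⊕ (s • q)) (p ⊕ (t • q)) ≡ (t − s) • cross p q
  cross-affine (p₁ , p₂ , p₃) (q₁ , q₂ , q₃) s t = ≡3 (minor p₂ p₃ q₂ q₃) (minor p₃ p₁ q₃ q₁) (minor p₁ p₂ q₁ q₂)
    where
    minor : ∀ p p′ q q′ →
      (p + s * q) * (p′ + t * q′) − (p′ + s * q′) * (p + t * q) ≡ (t − s) * (p * q′ − p′ * q)
    minor = solve 6 (λ s t p p′ q q′ →
      (p :+ s :* q) :* (p′ :+ t :* q′) :- (p′ :+ s :* q′) :* (p :+ t :* q) := (t :- s) :* (p :* q′ :- p′ :* q)) refl s t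

  dot-scale : ∀ t a b → dot a (t • b) ≡ t * dot a b
  dot-scale t (a₁ , a₂ , a₃) (b₁ , b₂ , b₃) = solve 7 (λ t a₁ a₂ a₃ b₁ b₂ b₃ →
    let a = a₁ , a₂ , a₃ ; b = b₁ , b₂ , b₃ in :dot a (t :• b) := t :* :dot a b)
    refl t a₁ a₂ a₃ b₁ b₂ b₃

  det3-affine : ∀ o p q s t → det3 o (p ⊕ (s • q)) (p ⊕ (t • q)) ≡ (t − s) * det3 o p q
  det3-affine o p q s t = trans (cong (dot o) (cross-affine p q s t)) (dot-scale (t − s) o (cross p q))

  -- Lagrange's formula for v × (n × m), arranged without subtraction of vectors.
  triple-product : ∀ n m v → ((dot m v) • n) ≡ ((dot n v) • m) ⊕ cross v (cross n m)
  triple-product (n₁ , n₂ , n₃) (m₁ , m₂ , m₃) (v₁ , v₂ , v₃) = ≡3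
    (solve 9 (λ n₁ n₂ n₃ m₁ m₂ m₃ v₁ v₂ v₃ →
      (m₁ :* v₁ :+ m₂ :* v₂ :+ m₃ :* v₃) :* n₁ :=
      (n₁ :* v₁ :+ n₂ :* v₂ :+ n₃ :* v₃) :* m₁ :+ (v₂ :* (n₁ :* m₂ :- n₂ :* m₁) :- v₃ :* (n₃ :* m₁ :- n₁ :* m₃)))
      refl n₁ n₂ n₃ m₁ m₂ m₃ v₁ v₂ v₃)
    (solve 9 (λ n₁ n₂ n₃ m₁ m₂ m₃ v₁ v₂ v₃ →
      (m₁ :* v₁ :+ m₂ :* v₂ :+ m₃ :* v₃) :* n₂ :=
      (n₁ :* v₁ :+ n₂ :* v₂ :+ n₃ :* v₃) :* m₂ :+ (v₃ :* (n₂ :* m₃ :- n₃ :* m₂) :- v₁ :* (n₁ :* m₂ :- n₂ :* m₁)))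
      refl n₁ n₂ n₃ m₁ m₂ m₃ v₁ v₂ v₃)
    (solve 9 (λ n₁ n₂ n₃ m₁ m₂ m₃ v₁ v₂ v₃ →
      (m₁ :* v₁ :+ m₂ :* v₂ :+ m₃ :* v₃) :* n₃ :=
      (n₁ :* v₁ :+ n₂ :* v₂ :+ n₃ :* v₃) :* m₃ :+ (v₁ :* (n₃ :* m₁ :- n₁ :* m₃) :- v₂ :* (n₂ :* m₃ :- n₃ :* m₂)))
      refl n₁ n₂ n₃ m₁ m₂ m₃ v₁ v₂ v₃)

  zero3-⊕ : ∀ a → zero3 ⊕ a ≡ a
  zero3-⊕ _ = ≡3 (+-identityˡ _) (+-identityˡ _) (+-identityˡ _)

  0•≡zero3 : ∀ a → 0# • a ≡ zero3
  0•≡zero3 _ = ≡3 (zeroˡ _) (zeroˡ _) (zeroˡ _)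

  •-zero3 : ∀ t → t • zero3 ≡ zero3
  •-zero3 t = ≡3 (zeroʳ t) (zeroʳ t) (zeroʳ t)

  cross-zero3 : ∀ v → cross v zero3 ≡ zero3
  cross-zero3 (v₁ , v₂ , v₃) = ≡3 (minor v₂ v₃) (minor v₃ v₁) (minor v₁ v₂)
    where
    minor : ∀ a b → a * 0# − b * 0# ≡ 0#
    minor = solve 2 (λ a b → a :* :0 :- b :* :0 := :0) refl

  cross-neg : ∀ {a b} → cross a b ≡ zero3 → cross b a ≡ zero3
  cross-neg {a₁ , a₂ , a₃} {b₁ , b₂ , b₃} eq = ≡3
    (minor a₂ a₃ b₂ b₃ (cong proj₁ eq)) (minor a₃ a₁ b₃ b₁ (cong (proj₁ ∘ proj₂) eq)) (minor a₁ a₂ b₁ b₂ (cong (proj₂ ∘ proj₂) eq))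
    where
    minor : ∀ a a′ b b′ → a * b′ − a′ * b ≡ 0# → b * a′ − b′ * a ≡ 0#
    minor a a′ b b′ p = trans (solve 4 (λ a a′ b b′ → b :* a′ :- b′ :* a := :- (a :* b′ :- a′ :* b)) refl a a′ b b′)
      (trans (cong -_ p) (solve 0 (:- :0 := :0) refl))

  -- It is known only that the coordinates of n do not all vanish, not which one is nonzero. So t ≠
  -- 0 is refuted, and stability gives t = 0.
  •-cancel-zero3 : ∀ {t n} → NonZero3 n → t • n ≡ zero3 → t ≡ 0#
  •-cancel-zero3 n≢0 tn≡0 = ≡-stable λ t≢0 → n≢0
    (≡3 (*-cancelˡ-0 t≢0 (cong proj₁ tn≡0)) (*-cancelˡ-0 t≢0 (cong (proj₁ ∘ proj₂) tn≡0))
        (*-cancelˡ-0 t≢0 (cong (proj₂ ∘ proj₂) tn≡0)))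

  parallel-orthogonal : ∀ {n m v} → NonZero3 n → cross n m ≡ zero3 → dot n v ≡ 0# → dot m v ≡ 0#
  parallel-orthogonal {n} {m} {v} n≢0 n∥m n⊥v = •-cancel-zero3 n≢0 (begin
    (dot m v) • n                        ≡⟨ triple-product n m v ⟩
    ((dot n v) • m) ⊕ cross v (cross n m) ≡⟨ cong₂ (λ s w → (s • m) ⊕ cross v w) n⊥v n∥m ⟩
    (0# • m) ⊕ cross v zero3             ≡⟨ cong₂ _⊕_ (0•≡zero3 m) (cross-zero3 v) ⟩
    zero3 ⊕ zero3                        ≡⟨ zero3-⊕ zero3 ⟩
    zero3                                ∎)
    where open ≡-Reasoning

  dot-comm : ∀ a b → dot a b ≡ dot b a
  dot-comm (a₁ , a₂ , a₃) (b₁ , b₂ , b₃) = cong₂ _+_ (cong₂ _+_ (*-comm a₁ b₁) (*-comm a₂ b₂)) (*-comm a₃ b₃)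

  det3-cross : ∀ a b v → det3 a b v ≡ dot (cross a b) v
  det3-cross a b v = trans (sym (det3-rotate v a b)) (dot-comm v (cross a b))

  orthogonal-parallel : ∀ {n a b} → dot n a ≡ 0# → dot n b ≡ 0# → cross n (cross a b) ≡ zero3
  orthogonal-parallel {n} {a} {b} n⊥a n⊥b = begin
    cross n (cross a b)                          ≡⟨ zero3-⊕ _ ⟨
    zero3 ⊕ cross n (cross a b)                  ≡⟨ cong (_⊕ cross n (cross a b)) (trans (cong (_• b) (trans (dot-comm a n) n⊥a)) (0•≡zero3 b)) ⟨
    ((dot a n) • b) ⊕ cross n (cross a b)        ≡⟨ triple-product a b n ⟨
    (dot b n) • a                                ≡⟨ cong (_• a) (trans (dot-comm b n) n⊥b) ⟩
    0# • a                                       ≡⟨ 0•≡zero3 a ⟩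
    zero3                                        ∎
    where open ≡-Reasoning

  -- If w and z were distinct points, both lines would have the normal `cross w z`; then c and d
  -- would lie on the line ab, which `distinct` excludes.
  meet-unique : ∀ {a b c d z w} → Meet a b c d z → OnLine a b w → OnLine c d w → ¬ NonZero3 (cross w z)
  meet-unique {a} {b} {c} {d} {z} {w} meet w-on-ab w-on-cd m≢0 = distinct
    ( trans (det3-cross a b c) (on-ab c (trans (sym (det3-cross c d c)) (det3-repeat c d)))
    , trans (det3-cross a b d) (on-ab d (trans (sym (det3-cross c d d)) (trans (sym (det3-rotate d c d)) (det3-repeat d c)))))
    where
    open Meet meet
    ab∥m : cross (cross a b) (cross w z) ≡ zero3
    ab∥m = orthogonal-parallel (trans (sym (det3-cross a b w)) w-on-ab) (trans (sym (det3-cross a b z)) z-on-ab)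
    cd∥m : cross (cross c d) (cross w z) ≡ zero3
    cd∥m = orthogonal-parallel (trans (sym (det3-cross c d w)) w-on-cd) (trans (sym (det3-cross c d z)) z-on-cd)
    on-ab : ∀ v → dot (cross c d) v ≡ 0# → dot (cross a b) v ≡ 0#
    on-ab v cd⊥v = parallel-orthogonal m≢0 (cross-neg ab∥m) (parallel-orthogonal cd-line cd∥m cd⊥v)

  ∼-scalar≢0 : ∀ {a b} (a∼b : a ∼ b) → ¬ proj₁ (proj₂ (proj₂ a∼b)) ≡ 0#
  ∼-scalar≢0 {a} (_ , b≢0 , t , b≡ta) t≡0 = b≢0 (trans b≡ta (trans (cong (_• a) t≡0) (0•≡zero3 a)))

  -- Cross ratios and corner invariants through determinants.

  module CrossRatioProperties {a b c d r} (cr : CrossRatio a b c d r) where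
    open CrossRatio cr

    private
      coordinate-≢ : ∀ {u w s t} → u ∼ (p ⊕ (s • q)) → w ∼ (p ⊕ (t • q)) → ¬ s − t ≡ 0# → NonZero3 (cross u w)
      coordinate-≢ {u} {w} {s} {t} (_ , _ , l , pu) (_ , _ , m , pw) s≢t u∥w = s≢t (trans
        (solve 2 (λ s t → s :- t := :- (t :- s)) refl s t)
        (trans (cong -_ (•-cancel-zero3 pq-indep (begin
          (t − s) • cross p q                     ≡⟨ cross-affine p q s t ⟨
          cross (p ⊕ (s • q)) (p ⊕ (t • q))       ≡⟨ cong₂ cross pu pw ⟩
          cross (l • u) (m • w)                   ≡⟨ cross-scale l m u w ⟩
          (l * m) • cross u w                     ≡⟨ cong ((l * m) •_) u∥w ⟩
          (l * m) • zero3                         ≡⟨ •-zero3 _ ⟩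
          zero3                                   ∎)))
          (solve 0 (:- :0 := :0) refl)))
        where open ≡-Reasoning

      bracket : ∀ o {u w s t} (u∼ : u ∼ (p ⊕ (s • q))) (w∼ : w ∼ (p ⊕ (t • q))) →
        (t − s) * det3 o p q ≡ proj₁ (proj₂ (proj₂ u∼)) * proj₁ (proj₂ (proj₂ w∼)) * det3 o u w
      bracket o {u} {w} {s} {t} (_ , _ , l , pu) (_ , _ , m , pw) = begin
        (t − s) * det3 o p q                    ≡⟨ det3-affine o p q s t ⟨
        det3 o (p ⊕ (s • q)) (p ⊕ (t • q))      ≡⟨ cong (dot o) (trans (cong₂ cross pu pw) (cross-scale l m u w)) ⟩
        dot o ((l * m) • cross u w)             ≡⟨ dot-scale (l * m) o (cross u w) ⟩
        l * m * det3 o u w                      ∎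
        where open ≡-Reasoning

    ac-distinct : NonZero3 (cross a c)
    ac-distinct = coordinate-≢ a-coord c-coord den₁

    bd-distinct : NonZero3 (cross b d)
    bd-distinct = coordinate-≢ b-coord d-coord den₂

    module _ (o : V3) where
      private
        δ = det3 o p q
        l₁ = proj₁ (proj₂ (proj₂ a-coord))
        l₂ = proj₁ (proj₂ (proj₂ b-coord))
        l₃ = proj₁ (proj₂ (proj₂ c-coord))
        l₄ = proj₁ (proj₂ (proj₂ d-coord))

      -- This is projection of the line from o. Each scalar relating a point to its affine lift
      -- occurs once on either side and cancels, while the square of `δ` is carried along and never
      -- divided by.
      projected-value : r * (det3 o a c * det3 o b d) ≡ det3 o a b * det3 o c d
      projected-value = *-cancelˡ (*-≢0 (*-≢0 (∼-scalar≢0 a-coord) (∼-scalar≢0 b-coord))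
                                        (*-≢0 (∼-scalar≢0 c-coord) (∼-scalar≢0 d-coord))) (begin
        l₁ * l₂ * (l₃ * l₄) * (r * (det3 o a c * det3 o b d))
          ≡⟨ solve 7 (λ l₁ l₂ l₃ l₄ r u v → l₁ :* l₂ :* (l₃ :* l₄) :* (r :* (u :* v)) := r :* ((l₁ :* l₃ :* u) :* (l₂ :* l₄ :* v)))
               refl l₁ l₂ l₃ l₄ r (det3 o a c) (det3 o b d) ⟩
        r * ((l₁ * l₃ * det3 o a c) * (l₂ * l₄ * det3 o b d))
          ≡⟨ cong₂ (λ u v → r * (u * v)) (bracket o a-coord c-coord) (bracket o b-coord d-coord) ⟨
        r * (((t₃ − t₁) * δ) * ((t₄ − t₂) * δ))
          ≡⟨ solve 6 (λ r t₁ t₂ t₃ t₄ δ → r :* (((t₃ :- t₁) :* δ) :* ((t₄ :- t₂) :* δ)) := (r :* ((t₁ :- t₃) :* (t₂ :- t₄))) :* (δ :* δ))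
               refl r t₁ t₂ t₃ t₄ δ ⟩
        (r * ((t₁ − t₃) * (t₂ − t₄))) * (δ * δ)
          ≡⟨ cong (_* (δ * δ)) value ⟩
        ((t₁ − t₂) * (t₃ − t₄)) * (δ * δ)
          ≡⟨ solve 5 (λ t₁ t₂ t₃ t₄ δ → ((t₁ :- t₂) :* (t₃ :- t₄)) :* (δ :* δ) := ((t₂ :- t₁) :* δ) :* ((t₄ :- t₃) :* δ))
               refl t₁ t₂ t₃ t₄ δ ⟩
        ((t₂ − t₁) * δ) * ((t₄ − t₃) * δ)
          ≡⟨ cong₂ _*_ (bracket o a-coord b-coord) (bracket o c-coord d-coord) ⟩
        (l₁ * l₂ * det3 o a b) * (l₃ * l₄ * det3 o c d)
          ≡⟨ solve 6 (λ l₁ l₂ l₃ l₄ u v → (l₁ :* l₂ :* u) :* (l₃ :* l₄ :* v) := l₁ :* l₂ :* (l₃ :* l₄) :* (u :* v))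
               refl l₁ l₂ l₃ l₄ (det3 o a b) (det3 o c d) ⟩
        l₁ * l₂ * (l₃ * l₄) * (det3 o a b * det3 o c d) ∎)
        where open ≡-Reasoning

      module _ (oab≢0 : ¬ det3 o a b ≡ 0#) where
        private
          δ≢0 : ¬ δ ≡ 0#
          δ≢0 = *-≢0ʳ λ eq → *-≢0 (*-≢0 (∼-scalar≢0 a-coord) (∼-scalar≢0 b-coord)) oab≢0
            (trans (sym (bracket o a-coord b-coord)) eq)

          reverse-≢0 : ∀ {s t} → ¬ s − t ≡ 0# → ¬ t − s ≡ 0#
          reverse-≢0 {s} {t} s≢t t≡s = s≢t (trans (solve 2 (λ s t → s :- t := :- (t :- s)) refl s t)
            (trans (cong -_ t≡s) (solve 0 (:- :0 := :0) refl)))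

        projected-ac≢0 : ¬ det3 o a c ≡ 0#
        projected-ac≢0 = *-≢0ʳ λ eq → *-≢0 (reverse-≢0 den₁) δ≢0 (trans (bracket o a-coord c-coord) eq)

        projected-bd≢0 : ¬ det3 o b d ≡ 0#
        projected-bd≢0 = *-≢0ʳ λ eq → *-≢0 (reverse-≢0 den₂) δ≢0 (trans (bracket o b-coord d-coord) eq)

  -- r is the corner invariant of five consecutive vertices: IsCornerX reads
  -- the polygon forwards, IsCornerY backwards.
  record Corner (a b c d e : V3) (r : Carrier) : Set where
    field
      {z₃ z₄} : V3
      meet₃ : Meet a b c d z₃
      meet₄ : Meet a b d e z₄
      cr : CrossRatio a b z₃ z₄ r

  module CornerProperties {a b c d e r} (corner : Corner a b c d e r) where
    open Corner corner
    open CrossRatioProperties cr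

    -- Otherwise a would be the intersection z₃, but the denominator of the cross ratio separates a
    -- from z₃. The next lemma argues alike with b and z₄.
    cda≢0 : ¬ det3 c d a ≡ 0#
    cda≢0 cda≡0 = meet-unique meet₃ (det3-repeat a b) cda≡0 ac-distinct

    deb≢0 : ¬ det3 d e b ≡ 0#
    deb≢0 deb≡0 = meet-unique meet₄ (trans (sym (det3-rotate b a b)) (det3-repeat b a)) deb≡0 bd-distinct

    -- The line ab is projected from d to the pencil at d, which carries z₃ to c and z₄ to e.
    corner-value : ¬ det3 b a d ≡ 0# → ¬ det3 c d e ≡ 0# →
      r * (det3 c d a * det3 d e b) ≡ - (det3 b a d * det3 c d e)
    corner-value bad≢0 cde≢0 = begin
      r * (det3 c d a * det3 d e b)
        ≡⟨ cong₂ (λ s t → r * (s * t)) (det3-rotate c d a) (det3-swap d e b) ⟩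
      r * (det3 d a c * - det3 d b e)
        ≡⟨ solve 3 (λ r s t → r :* (s :* (:- t)) := :- (r :* (s :* t))) refl r (det3 d a c) (det3 d b e) ⟩
      - (r * (det3 d a c * det3 d b e))
        ≡⟨ cong -_ projected ⟩
      - (det3 d a b * det3 d c e)
        ≡⟨ cong -_ (solve 2 (λ s t → s :* t := (:- s) :* (:- t)) refl (det3 d a b) (det3 d c e)) ⟩
      - ((- det3 d a b) * (- det3 d c e))
        ≡⟨ cong₂ (λ s t → - (s * t)) bad≡ cde≡ ⟨
      - (det3 b a d * det3 c d e) ∎
      where
      open ≡-Reasoning
      bad≡ : det3 b a d ≡ - det3 d a b
      bad≡ = trans (sym (det3-rotate d b a)) (det3-swap d b a)
      cde≡ : det3 c d e ≡ - det3 d c e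
      cde≡ = trans (det3-rotate c d e) (det3-swap d e c)
      neg-≢0 : ∀ {s t} → s ≡ - t → ¬ s ≡ 0# → ¬ t ≡ 0#
      neg-≢0 s≡-t s≢0 t≡0 = s≢0 (trans s≡-t (trans (cong -_ t≡0) (solve 0 (:- :0 := :0) refl)))
      dab≢0 = neg-≢0 bad≡ bad≢0
      dce≢0 = neg-≢0 cde≡ cde≢0
      z₃-on-dc : det3 d z₃ c ≡ 0#
      z₃-on-dc = trans (sym (det3-rotate c d z₃)) (Meet.z-on-cd meet₃)
      z₄-on-de : det3 d e z₄ ≡ 0#
      z₄-on-de = Meet.z-on-cd meet₄
      drop : ∀ {s t u w} → s + t * u ≡ w → u ≡ 0# → s ≡ w
      drop {s} {t} {u} p u≡0 = trans (sym (trans (cong (λ u → s + t * u) u≡0) (trans (cong (s +_) (zeroʳ t)) (+-identityʳ s)))) p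
      -- Three Plücker relations, each with one bracket zero because z₃ lies on dc or z₄ on de. They
      -- trade z₃ for c and z₄ for e at the price of the factors `det3 d z₃ e` and `det3 d c z₄`,
      -- which cancel in `projected`.
      ac-ce : det3 d a z₃ * det3 d c e ≡ det3 d a c * det3 d z₃ e
      ac-ce = drop (plücker d a z₃ c e) z₃-on-dc
      bd-ce : det3 d b z₄ * det3 d c e ≡ det3 d b e * det3 d c z₄
      bd-ce = drop (trans (+-comm _ _) (plücker d b c e z₄)) z₄-on-de
      cd-ce : det3 d z₃ z₄ * det3 d c e ≡ det3 d z₃ e * det3 d c z₄
      cd-ce = drop (trans (+-comm _ _) (plücker d z₃ c e z₄)) z₄-on-de
      z₃e≢0 : ¬ det3 d z₃ e ≡ 0#
      z₃e≢0 = *-≢0ʳ λ eq → *-≢0 (projected-ac≢0 d dab≢0) dce≢0 (trans ac-ce eq)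
      cz₄≢0 : ¬ det3 d c z₄ ≡ 0#
      cz₄≢0 = *-≢0ʳ λ eq → *-≢0 (projected-bd≢0 d dab≢0) dce≢0 (trans bd-ce eq)
      projected : r * (det3 d a c * det3 d b e) ≡ det3 d a b * det3 d c e
      projected = *-cancelˡ (*-≢0 z₃e≢0 cz₄≢0) (begin
        det3 d z₃ e * det3 d c z₄ * (r * (det3 d a c * det3 d b e))
          ≡⟨ solve 5 (λ s t r u v → s :* t :* (r :* (u :* v)) := r :* ((u :* s) :* (v :* t))) refl
               (det3 d z₃ e) (det3 d c z₄) r (det3 d a c) (det3 d b e) ⟩
        r * ((det3 d a c * det3 d z₃ e) * (det3 d b e * det3 d c z₄))
          ≡⟨ cong₂ (λ s t → r * (s * t)) ac-ce bd-ce ⟨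
        r * ((det3 d a z₃ * det3 d c e) * (det3 d b z₄ * det3 d c e))
          ≡⟨ solve 4 (λ r s t u → r :* ((s :* u) :* (t :* u)) := (r :* (s :* t)) :* (u :* u)) refl
               r (det3 d a z₃) (det3 d b z₄) (det3 d c e) ⟩
        (r * (det3 d a z₃ * det3 d b z₄)) * (det3 d c e * det3 d c e)
          ≡⟨ cong (_* (det3 d c e * det3 d c e)) (projected-value d) ⟩
        (det3 d a b * det3 d z₃ z₄) * (det3 d c e * det3 d c e)
          ≡⟨ solve 3 (λ s t u → (s :* t) :* (u :* u) := (t :* u) :* (s :* u)) refl
               (det3 d a b) (det3 d z₃ z₄) (det3 d c e) ⟩
        (det3 d z₃ z₄ * det3 d c e) * (det3 d a b * det3 d c e)
          ≡⟨ cong (_* (det3 d a b * det3 d c e)) cd-ce ⟩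
        det3 d z₃ e * det3 d c z₄ * (det3 d a b * det3 d c e) ∎)

  -- Brackets of points on a conic in terms of its bilinear form.

  module ConicProperties (C : NondegConic) where
    open NondegConic C

    form : V3 → V3 → Carrier
    form u w = dot u (apply Q w)

    κ : Carrier
    κ = detM Q

    form-symmetric : ∀ u w → form u w ≡ form w u
    form-symmetric (u₁ , u₂ , u₃) (w₁ , w₂ , w₃) with Q | symmetric
    ... | (p₁ , p₂ , p₃) , (_ , p₄ , p₅) , (_ , _ , p₆) | refl , refl , refl =
      solve 12 (λ p₁ p₂ p₃ p₄ p₅ p₆ u₁ u₂ u₃ w₁ w₂ w₃ →
        let A = (p₁ , p₂ , p₃) , (p₂ , p₄ , p₅) , (p₃ , p₅ , p₆) ; u = u₁ , u₂ , u₃ ; w = w₁ , w₂ , w₃ in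
        :dot u (:apply A w) := :dot w (:apply A u)) refl p₁ p₂ p₃ p₄ p₅ p₆ u₁ u₂ u₃ w₁ w₂ w₃

    -- Multiplicativity of the determinant, used for Q and then for the matrix with rows a, b, c.
    gram : ∀ a b c x y z → κ * (det3 a b c * det3 x y z) ≡
      det3 (form a x , form b x , form c x) (form a y , form b y , form c y) (form a z , form b z , form c z)
    gram a b c x y z = begin
      κ * (det3 a b c * det3 x y z)   ≡⟨ solve 3 (λ k s t → k :* (s :* t) := s :* (k :* t)) refl κ (det3 a b c) (det3 x y z) ⟩
      det3 a b c * (κ * det3 x y z)   ≡⟨ cong (det3 a b c *_) (det3-apply Q x y z) ⟨
      det3 a b c * det3 (apply Q x) (apply Q y) (apply Q z) ≡⟨ det3-apply (a , b , c) (apply Q x) (apply Q y) (apply Q z) ⟨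
      _ ∎
      where open ≡-Reasoning

    -- Since y and z lie on the conic, two entries of the Gram matrix vanish. The second factor of
    -- what remains is the numerator of a cross ratio on the conic, which is how brackets and cross
    -- ratios are linked.
    gram-adjacent : ∀ {x y z w} → OnConic C y → OnConic C z →
      κ * (det3 x y z * det3 y z w) ≡
      form y z * (form x y * form z w + form x z * form y w − form x w * form y z)
    gram-adjacent {x} {y} {z} {w} yy≡0 zz≡0 = begin
      κ * (det3 x y z * det3 y z w)
        ≡⟨ gram x y z y z w ⟩
      det3 (form x y , form y y , form z y) (form x z , form y z , form z z) (form x w , form y w , form z w)
        ≡⟨ cong₂ (λ s t → det3 (form x y , s , form z y) (form x z , form y z , t) (form x w , form y w , form z w)) yy≡0 zz≡0 ⟩
      det3 (form x y , 0# , form z y) (form x z , form y z , 0#) (form x w , form y w , form z w)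
        ≡⟨ cong (λ s → det3 (form x y , 0# , s) (form x z , form y z , 0#) (form x w , form y w , form z w)) (form-symmetric z y) ⟩
      det3 (form x y , 0# , form y z) (form x z , form y z , 0#) (form x w , form y w , form z w)
        ≡⟨ solve 6 (λ xy yz xz xw yw zw →
             :det3 (xy , :0 , yz) (xz , yz , :0) (xw , yw , zw)
             := yz :* (xy :* zw :+ xz :* yw :- xw :* yz)) refl
             (form x y) (form y z) (form x z) (form x w) (form y w) (form z w) ⟩
      form y z * (form x y * form z w + form x z * form y w − form x w * form y z) ∎
      where open ≡-Reasoning

    -- The case w = x of the previous identity. It ties noncollinearity of three points of the conic
    -- to the nonvanishing of their pairings, in both directions.
    gram-square : ∀ {a b c} → OnConic C a → OnConic C b → OnConic C c →
      κ * (det3 a b c * det3 a b c) ≡ 2# * (form a b * form b c * form a c)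
    gram-square {a} {b} {c} aa≡0 bb≡0 cc≡0 = begin
      κ * (det3 a b c * det3 a b c)
        ≡⟨ cong (λ t → κ * (det3 a b c * t)) (det3-rotate a b c) ⟩
      κ * (det3 a b c * det3 b c a)
        ≡⟨ gram-adjacent bb≡0 cc≡0 ⟩
      form b c * (form a b * form c a + form a c * form b a − form a a * form b c)
        ≡⟨ cong₂ (λ s t → form b c * (form a b * s + form a c * t − form a a * form b c)) (form-symmetric c a) (form-symmetric b a) ⟩
      form b c * (form a b * form a c + form a c * form a b − form a a * form b c)
        ≡⟨ cong (λ s → form b c * (form a b * form a c + form a c * form a b − s * form b c)) aa≡0 ⟩
      form b c * (form a b * form a c + form a c * form a b − 0# * form b c)
        ≡⟨ solve 3 (λ ab bc ac → bc :* (ab :* ac :+ ac :* ab :- :0 :* bc) := :2 :* (ab :* bc :* ac)) refl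
             (form a b) (form b c) (form a c) ⟩
      2# * (form a b * form b c * form a c) ∎
      where open ≡-Reasoning

    module _ {a b c} (a∈C : OnConic C a) (b∈C : OnConic C b) (c∈C : OnConic C c) where
      noncollinear⇒form≢0 : ¬ det3 a b c ≡ 0# →
        ¬ form a b ≡ 0# × ¬ form b c ≡ 0# × ¬ form a c ≡ 0#
      noncollinear⇒form≢0 abc≢0 = *-≢0ˡ (*-≢0ˡ product≢0) , *-≢0ʳ (*-≢0ˡ product≢0) , *-≢0ʳ product≢0
        where
        product≢0 : ¬ form a b * form b c * form a c ≡ 0#
        product≢0 = *-≢0ʳ λ eq → *-≢0 nondegenerate (*-≢0 abc≢0 abc≢0) (trans (gram-square a∈C b∈C c∈C) eq)

      form≢0⇒noncollinear : ¬ form a b ≡ 0# → ¬ form b c ≡ 0# → ¬ form a c ≡ 0# → ¬ det3 a b c ≡ 0#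
      form≢0⇒noncollinear ab≢0 bc≢0 ac≢0 = *-≢0ˡ (*-≢0ʳ λ eq →
        *-≢0 2≢0 (*-≢0 (*-≢0 ab≢0 bc≢0) ac≢0) (trans (sym (gram-square a∈C b∈C c∈C)) eq))

-- Corner invariants of five points on a conic.

module InscribedPentagon (R : RealField) (C : Geometry.NondegConic R) where
  open RealFieldProperties R
  open ℤ-Solver using (solve; _:=_; _:+_; _:*_; :-_; _:-_)
  open Geometry R
  open ProjectivePlane R
  open ConicProperties C
  open NondegConic C using (nondegenerate)

  -- s is the cross ratio [a, b, c, d] in a projective coordinate t on the conic,
  -- where form a b is proportional to (t_a − t_b)².
  ConicCrossRatio : V3 → V3 → V3 → V3 → Carrier → Set
  ConicCrossRatio a b c d s =
    s * (2# * (form a c * form b d)) ≡ form a b * form c d + form a c * form b d − form a d * form b c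

  -- Serves to read the polygon backwards: the facts about y are those about x for the reversed
  -- pentagon.
  conicCrossRatio-reverse : ∀ {a b c d s} → ConicCrossRatio a b c d s → ConicCrossRatio d c b a s
  conicCrossRatio-reverse {a} {b} {c} {d} {s} p
    rewrite form-symmetric d b | form-symmetric c a | form-symmetric d c | form-symmetric b a
          | form-symmetric d a | form-symmetric c b =
    trans (cong (λ t → s * (2# * t)) (*-comm (form b d) (form a c)))
      (trans p (solve 6 (λ ab cd ac bd ad bc → ab :* cd :+ ac :* bd :- ad :* bc := cd :* ab :+ bd :* ac :- ad :* bc) refl
        (form a b) (form c d) (form a c) (form b d) (form a d) (form b c)))

  module _ {a b c d e x s s′}
           (a∈C : OnConic C a) (b∈C : OnConic C b) (c∈C : OnConic C c) (d∈C : OnConic C d) (e∈C : OnConic C e)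
           (corner : Corner a b c d e x)
           -- These two noncollinearities are supplied by the corner invariant of the same five
           -- points in the opposite direction.
           (bad≢0 : ¬ det3 b a d ≡ 0#) (cbe≢0 : ¬ det3 c b e ≡ 0#)
           (abcd-s : ConicCrossRatio a b c d s) (bcde-s′ : ConicCrossRatio b c d e s′) where
    open CornerProperties corner

    private
      α = det3 c d a
      β = det3 d e b
      γ = det3 b a d
      δ = det3 c d e

      cd-da-ca≢0 = noncollinear⇒form≢0 c∈C d∈C a∈C cda≢0
      de-eb-db≢0 = noncollinear⇒form≢0 d∈C e∈C b∈C deb≢0
      cb-be-ce≢0 = noncollinear⇒form≢0 c∈C b∈C e∈C cbe≢0

      flip : ∀ u w → ¬ form u w ≡ 0# → ¬ form w u ≡ 0#
      flip u w uw≢0 wu≡0 = uw≢0 (trans (form-symmetric u w) wu≡0)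

      ad≢0 = flip d a (proj₁ (proj₂ cd-da-ca≢0))
      ac≢0 = flip c a (proj₂ (proj₂ cd-da-ca≢0))
      bd≢0 = flip d b (proj₂ (proj₂ de-eb-db≢0))
      de≢0 = proj₁ de-eb-db≢0
      ce≢0 = proj₂ (proj₂ cb-be-ce≢0)
      cd≢0 = proj₁ cd-da-ca≢0

    -- Its three pairings are nonzero because each of them occurs in another noncollinear triple; on
    -- the conic this suffices.
    cde≢0 : ¬ det3 c d e ≡ 0#
    cde≢0 = form≢0⇒noncollinear c∈C d∈C e∈C cd≢0 de≢0 ce≢0

    value : x * (α * β) ≡ - (γ * δ)
    value = corner-value bad≢0 cde≢0

    private
      -- The factor `form a d` completes the numerator of s to the right side of `gram-adjacent` for
      -- b, a, d, c.
      s-scaled : s * (2# * (form a c * form b d)) * form a d ≡ - (κ * (γ * α))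
      s-scaled = begin
        s * (2# * (form a c * form b d)) * form a d
          ≡⟨ cong (_* form a d) abcd-s ⟩
        (form a b * form c d + form a c * form b d − form a d * form b c) * form a d
          ≡⟨ solve 6 (λ ab cd ac bd ad bc → (ab :* cd :+ ac :* bd :- ad :* bc) :* ad := ad :* (ab :* cd :+ bd :* ac :- bc :* ad)) refl
               (form a b) (form c d) (form a c) (form b d) (form a d) (form b c) ⟩
        form a d * (form a b * form c d + form b d * form a c − form b c * form a d)
          ≡⟨ cong₂ (λ p q → form a d * (p * q + form b d * form a c − form b c * form a d)) (form-symmetric a b) (form-symmetric c d) ⟩
        form a d * (form b a * form d c + form b d * form a c − form b c * form a d)
          ≡⟨ gram-adjacent a∈C d∈C ⟨
        κ * (γ * det3 a d c)
          ≡⟨ cong (λ t → κ * (γ * t)) (trans (det3-swap a d c) (cong -_ (det3-rotate a c d))) ⟩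
        κ * (γ * - α)
          ≡⟨ solve 3 (λ k g a → k :* (g :* (:- a)) := :- (k :* (g :* a))) refl κ γ α ⟩
        - (κ * (γ * α)) ∎
        where open ≡-Reasoning

      -- Subtracting a cross ratio from 1 permutes its points: the numerator of 1 - s′ is that of b,
      -- d, e, c, and `gram-adjacent` applies again.
      1-s′-scaled : (1# − s′) * (2# * (form b d * form c e)) * form d e ≡ κ * (β * δ)
      1-s′-scaled = begin
        (1# − s′) * (2# * (form b d * form c e)) * form d e
          ≡⟨ solve 4 (λ s′ bd ce de → (:1 :- s′) :* (:2 :* (bd :* ce)) :* de := (:2 :* (bd :* ce) :- s′ :* (:2 :* (bd :* ce))) :* de) refl
               s′ (form b d) (form c e) (form d e) ⟩
        (2# * (form b d * form c e) − s′ * (2# * (form b d * form c e))) * form d e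
          ≡⟨ cong (λ t → (2# * (form b d * form c e) − t) * form d e) bcde-s′ ⟩
        (2# * (form b d * form c e) − (form b c * form d e + form b d * form c e − form b e * form c d)) * form d e
          ≡⟨ solve 6 (λ bd ce bc de be cd → (:2 :* (bd :* ce) :- (bc :* de :+ bd :* ce :- be :* cd)) :* de
                                         := de :* (bd :* ce :+ be :* cd :- bc :* de)) refl
               (form b d) (form c e) (form b c) (form d e) (form b e) (form c d) ⟩
        form d e * (form b d * form c e + form b e * form c d − form b c * form d e)
          ≡⟨ cong₂ (λ p q → form d e * (form b d * p + form b e * q − form b c * form d e)) (form-symmetric c e) (form-symmetric c d) ⟩
        form d e * (form b d * form e c + form b e * form d c − form b c * form d e)
          ≡⟨ gram-adjacent d∈C e∈C ⟨
        κ * (det3 b d e * det3 d e c)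
          ≡⟨ cong₂ (λ p q → κ * (p * q)) (det3-rotate b d e) (sym (det3-rotate c d e)) ⟩
        κ * (β * δ) ∎
        where open ≡-Reasoning

    crossRatio≢0 : ¬ s ≡ 0#
    crossRatio≢0 = *-≢0ˡ (*-≢0ˡ λ p → *-≢0 nondegenerate (*-≢0 bad≢0 cda≢0)
      (trans (solve 1 (λ t → t := :- (:- t)) refl (κ * (γ * α)))
        (trans (cong -_ (trans (sym s-scaled) p)) (solve 0 (:- :0 := :0) refl))))

    -- After `1-s′-scaled` and `value` the bracket of c, d, e appears squared. Two uses of
    -- `gram-square` trade it for the square of the bracket of c, d, a, and `s-scaled` recognises s
    -- in the result.
    corner-crossRatio : x * (1# − s′) ≡ s
    corner-crossRatio = *-cancelˡ {(2# * (form b d * form c e) * form d e) * (α * (form a c * form a d))}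
      (*-≢0 (*-≢0 (*-≢0 2≢0 (*-≢0 bd≢0 ce≢0)) de≢0) (*-≢0 cda≢0 (*-≢0 ac≢0 ad≢0))) (begin
      (2# * (bd * ce) * de) * (α * (ac * ad)) * (x * (1# − s′))
        ≡⟨ solve 8 (λ bd ce de α ac ad x t → (:2 :* (bd :* ce) :* de) :* (α :* (ac :* ad)) :* (x :* t)
                                          := x :* α :* (t :* (:2 :* (bd :* ce)) :* de) :* (ac :* ad)) refl bd ce de α ac ad x (1# − s′) ⟩
      x * α * ((1# − s′) * (2# * (bd * ce)) * de) * (ac * ad)
        ≡⟨ cong (λ t → x * α * t * (ac * ad)) 1-s′-scaled ⟩
      x * α * (κ * (β * δ)) * (ac * ad)
        ≡⟨ solve 7 (λ x α κ β δ ac ad → x :* α :* (κ :* (β :* δ)) :* (ac :* ad) := x :* (α :* β) :* (κ :* δ) :* (ac :* ad)) refl x α κ β δ ac ad ⟩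
      x * (α * β) * (κ * δ) * (ac * ad)
        ≡⟨ cong (λ t → t * (κ * δ) * (ac * ad)) value ⟩
      - (γ * δ) * (κ * δ) * (ac * ad)
        ≡⟨ solve 5 (λ γ δ κ ac ad → (:- (γ :* δ)) :* (κ :* δ) :* (ac :* ad) := (:- γ) :* (κ :* (δ :* δ)) :* (ac :* ad)) refl γ δ κ ac ad ⟩
      - γ * (κ * (δ * δ)) * (ac * ad)
        ≡⟨ cong (λ t → - γ * t * (ac * ad)) (gram-square c∈C d∈C e∈C) ⟩
      - γ * (2# * (cd * de * ce)) * (ac * ad)
        ≡⟨ solve 6 (λ γ cd de ce ac ad → (:- γ) :* (:2 :* (cd :* de :* ce)) :* (ac :* ad) := (:- γ) :* (:2 :* (cd :* ad :* ac)) :* (de :* ce)) refl γ cd de ce ac ad ⟩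
      - γ * (2# * (cd * ad * ac)) * (de * ce)
        ≡⟨ cong₂ (λ p q → - γ * (2# * (cd * p * q)) * (de * ce)) (form-symmetric a d) (form-symmetric a c) ⟩
      - γ * (2# * (cd * form d a * form c a)) * (de * ce)
        ≡⟨ cong (λ t → - γ * t * (de * ce)) (gram-square c∈C d∈C a∈C) ⟨
      - γ * (κ * (α * α)) * (de * ce)
        ≡⟨ solve 5 (λ γ κ α de ce → (:- γ) :* (κ :* (α :* α)) :* (de :* ce) := (:- (κ :* (γ :* α))) :* (α :* (de :* ce))) refl γ κ α de ce ⟩
      - (κ * (γ * α)) * (α * (de * ce))
        ≡⟨ cong (_* (α * (de * ce))) s-scaled ⟨
      s * (2# * (ac * bd)) * ad * (α * (de * ce))
        ≡⟨ solve 7 (λ s ac bd ad α de ce → s :* (:2 :* (ac :* bd)) :* ad :* (α :* (de :* ce)) := (:2 :* (bd :* ce) :* de) :* (α :* (ac :* ad)) :* s) refl s ac bd ad α de ce ⟩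
      (2# * (bd * ce) * de) * (α * (ac * ad)) * s ∎)
      where
      open ≡-Reasoning
      ac = form a c
      ad = form a d
      bd = form b d
      ce = form c e
      de = form d e
      cd = form c d

-- Periodic cross ratio coordinates.

module CrossRatioCoordinates (R : RealField) where
  open RealFieldProperties R
  open RealField R using (inverse)
  open ℤ-Solver using (solve; _:=_; _:*_; :-_; _:-_)
  open Geometry R
  open ProjectivePlane R

  -- The coordinate c j is the cross ratio of four consecutive vertices on the conic.
  record Coordinates (n : ℕ) (X Y : ℕ → Carrier) : Set where
    field
      c : ℕ → Carrier
      c≢0 : ∀ j → ¬ c j ≡ 0#
      c-periodic : ∀ j → c (j ℕ.+ n) ≡ c j
      X-relation : ∀ j → X j * (1# − c (suc j)) ≡ c j
      Y-relation : ∀ j → Y j * (1# − c j) ≡ c (suc j)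

  -- A constant c has to satisfy c / (1 - c) = 1, whence 1/2.
  constant-coordinates : ∀ {n X Y} → (∀ j → X j ≡ 1#) → (∀ j → Y j ≡ 1#) → Coordinates n X Y
  constant-coordinates {n} {X} {Y} X≡1 Y≡1 = record
    { c = λ _ → ½
    ; c≢0 = λ _ → *-≢0ʳ λ p → 0≢1′ (trans (sym p) 2½≡1)
    ; c-periodic = λ _ → refl
    ; X-relation = λ j → trans (cong (_* (1# − ½)) (X≡1 j)) 1-½≡½
    ; Y-relation = λ j → trans (cong (_* (1# − ½)) (Y≡1 j)) 1-½≡½
    }
    where
    0≢1′ : ¬ 0# ≡ 1#
    0≢1′ = RealField.0≢1 R
    ½ = proj₁ (inverse 2# 2≢0)
    2½≡1 : 2# * ½ ≡ 1#
    2½≡1 = proj₂ (inverse 2# 2≢0)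
    1-½≡½ : 1# * (1# − ½) ≡ ½
    1-½≡½ = trans (cong (λ t → 1# * (t − ½)) (sym 2½≡1)) (solve 1 (λ h → :1 :* (:2 :* h :- h) := h) refl ½)

  module _ {n : ℕ} {X Y : ℕ → Carrier}
           (X-periodic : ∀ j → X (j ℕ.+ n) ≡ X j) (Y-periodic : ∀ j → Y (j ℕ.+ n) ≡ Y j)
           (c : ℕ → Carrier) (c≢0 : ∀ j → ¬ c j ≡ 0#)
           (X-relation : ∀ j → X j * (1# − c (suc j)) ≡ c j)
           (Y-relation : ∀ j → Y j * (1# − c j) ≡ c (suc j)) where

    private
      Periodic : ℕ → Set
      Periodic j = c (j ℕ.+ n) ≡ c j

      -- The Y-relation determines c (j + 1) from c j and the X-relation does the converse, so
      -- periodicity at one index spreads both ways.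
      up : ∀ {j} → Periodic j → Periodic (suc j)
      up {j} p = begin
        c (suc j ℕ.+ n)                     ≡⟨ Y-relation (j ℕ.+ n) ⟨
        Y (j ℕ.+ n) * (1# − c (j ℕ.+ n))    ≡⟨ cong₂ (λ s t → s * (1# − t)) (Y-periodic j) p ⟩
        Y j * (1# − c j)                    ≡⟨ Y-relation j ⟩
        c (suc j)                           ∎
        where open ≡-Reasoning

      down : ∀ {j} → Periodic (suc j) → Periodic j
      down {j} p = begin
        c (j ℕ.+ n)                             ≡⟨ X-relation (j ℕ.+ n) ⟨
        X (j ℕ.+ n) * (1# − c (suc j ℕ.+ n))    ≡⟨ cong₂ (λ s t → s * (1# − t)) (X-periodic j) p ⟩
        X j * (1# − c (suc j))                  ≡⟨ X-relation j ⟩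
        c j                                     ∎
        where open ≡-Reasoning

      to-zero : ∀ j → Periodic j → Periodic 0
      to-zero zero p = p
      to-zero (suc j) p = to-zero j (down p)

      from-zero : Periodic 0 → ∀ j → Periodic j
      from-zero p zero = p
      from-zero p (suc j) = up (from-zero p j)

      -- Eliminates c j from the two relations. Where X j * Y j ≠ 1 this expresses c (j + 1) through
      -- X j and Y j, which are periodic.
      eliminate : ∀ j → c (suc j) * (1# − X j * Y j) ≡ Y j * (1# − X j)
      eliminate j = begin
        c (suc j) * (1# − X j * Y j)
          ≡⟨ solve 3 (λ s x y → s :* (:1 :- x :* y) := s :- x :* y :* s) refl (c (suc j)) (X j) (Y j) ⟩
        c (suc j) − X j * Y j * c (suc j)
          ≡⟨ cong (λ t → t − X j * Y j * c (suc j)) (trans (sym (Y-relation j)) (cong (λ t → Y j * (1# − t)) (sym (X-relation j)))) ⟩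
        Y j * (1# − X j * (1# − c (suc j))) − X j * Y j * c (suc j)
          ≡⟨ solve 3 (λ s x y → y :* (:1 :- x :* (:1 :- s)) :- x :* y :* s := y :* (:1 :- x)) refl (c (suc j)) (X j) (Y j) ⟩
        Y j * (1# − X j) ∎
        where open ≡-Reasoning

    periodic-if-nondegenerate : ∀ j → ¬ X j * Y j ≡ 1# → Coordinates n X Y
    periodic-if-nondegenerate j XY≢1 = record
      { c = c ; c≢0 = c≢0 ; c-periodic = from-zero (to-zero (suc j) periodic)
      ; X-relation = X-relation ; Y-relation = Y-relation }
      where
      open ≡-Reasoning
      periodic : Periodic (suc j)
      periodic = *-cancelˡ {1# − X j * Y j} (λ p → XY≢1 (sym (+-cancel-≡ p))) (begin
        (1# − X j * Y j) * c (suc j ℕ.+ n)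
          ≡⟨ cong₂ (λ s t → (1# − s * t) * c (suc j ℕ.+ n)) (X-periodic j) (Y-periodic j) ⟨
        (1# − X (j ℕ.+ n) * Y (j ℕ.+ n)) * c (suc j ℕ.+ n)
          ≡⟨ *-comm _ _ ⟩
        c (suc j ℕ.+ n) * (1# − X (j ℕ.+ n) * Y (j ℕ.+ n))
          ≡⟨ eliminate (j ℕ.+ n) ⟩
        Y (j ℕ.+ n) * (1# − X (j ℕ.+ n))
          ≡⟨ cong₂ (λ s t → t * (1# − s)) (X-periodic j) (Y-periodic j) ⟩
        Y j * (1# − X j)
          ≡⟨ eliminate j ⟨
        c (suc j) * (1# − X j * Y j)
          ≡⟨ *-comm _ _ ⟩
        (1# − X j * Y j) * c (suc j) ∎)

    -- If X j * Y j = 1 for all j (as for a polygon with vertices of period 4), c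
    -- need not be periodic, but then X and Y are identically 1.
    coordinates-exist : ¬ ¬ Coordinates n X Y
    coordinates-exist none = none (constant-coordinates X≡1 Y≡1)
      where
      open ≡-Reasoning
      XY≡1 : ∀ j → X j * Y j ≡ 1#
      XY≡1 j = ≡-stable λ XY≢1 → none (periodic-if-nondegenerate j XY≢1)
      Y≡1 : ∀ j → Y j ≡ 1#
      Y≡1 j = sym (+-cancel-≡ (begin
        1# − Y j                        ≡⟨ cong (λ t → t − Y j) (XY≡1 j) ⟨
        X j * Y j − Y j                 ≡⟨ solve 2 (λ x y → x :* y :- y := :- (y :* (:1 :- x))) refl (X j) (Y j) ⟩
        - (Y j * (1# − X j))            ≡⟨ cong -_ (eliminate j) ⟨
        - (c (suc j) * (1# − X j * Y j)) ≡⟨ cong (λ t → - (c (suc j) * (1# − t))) (XY≡1 j) ⟩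
        - (c (suc j) * (1# − 1#))       ≡⟨ solve 1 (λ s → :- (s :* (:1 :- :1)) := :0) refl (c (suc j)) ⟩
        0#                              ∎))
      X≡1 : ∀ j → X j ≡ 1#
      X≡1 j = trans (sym (*-identityʳ (X j))) (trans (cong (X j *_) (sym (Y≡1 j))) (XY≡1 j))

  -- Both products of brackets contain a, b, c, e once and d twice, so new lifts and the matrix A
  -- multiply them by the same `K`.
  corner-invariant : ∀ {a b c d e a′ b′ c′ d′ e′ x x′} (A : Mat3) →
    Corner a b c d e x → Corner a′ b′ c′ d′ e′ x′ →
    (∃ λ t → a′ ≡ t • apply A a) → (∃ λ t → b′ ≡ t • apply A b) → (∃ λ t → c′ ≡ t • apply A c) →
    (∃ λ t → d′ ≡ t • apply A d) → (∃ λ t → e′ ≡ t • apply A e) →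
    x * (det3 c d a * det3 d e b) ≡ - (det3 b a d * det3 c d e) →
    x′ * (det3 c′ d′ a′ * det3 d′ e′ b′) ≡ - (det3 b′ a′ d′ * det3 c′ d′ e′) →
    x′ ≡ x
  corner-invariant {a} {b} {c} {d} {e} {x = x} {x′ = x′} A corner corner′
    (ta , refl) (tb , refl) (tc , refl) (td , refl) (te , refl) value value′ =
    *-cancelˡ {K * (α * β)} (*-≢0 K≢0 (*-≢0 cda≢0 deb≢0)) (begin
      K * (α * β) * x′          ≡⟨ *-comm _ _ ⟩
      x′ * (K * (α * β))        ≡⟨ cong (x′ *_) αβ′ ⟨
      _                         ≡⟨ value′ ⟩
      _                         ≡⟨ cong -_ γδ′ ⟩
      - (K * (γ * δ))           ≡⟨ solve 2 (λ k s → :- (k :* s) := k :* (:- s)) refl K (γ * δ) ⟩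
      K * - (γ * δ)             ≡⟨ cong (K *_) value ⟨
      K * (x * (α * β))         ≡⟨ solve 3 (λ k x s → k :* (x :* s) := k :* s :* x) refl K x (α * β) ⟩
      K * (α * β) * x           ∎)
    where
    open ≡-Reasoning
    open CornerProperties corner
    open CornerProperties corner′ using () renaming (cda≢0 to cda′≢0; deb≢0 to deb′≢0)
    α = det3 c d a
    β = det3 d e b
    γ = det3 b a d
    δ = det3 c d e
    μ = detM A
    K = ta * tb * tc * (td * td * te) * (μ * μ)
    transform : ∀ r s t u v w → det3 (r • apply A u) (s • apply A v) (t • apply A w) ≡ r * s * t * (μ * det3 u v w)
    transform r s t u v w = trans (det3-scale r s t (apply A u) (apply A v) (apply A w)) (cong (r * s * t *_) (det3-apply A u v w))
    αβ′ : det3 (tc • apply A c) (td • apply A d) (ta • apply A a) * det3 (td • apply A d) (te • apply A e) (tb • apply A b) ≡ K * (α * β)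
    αβ′ = trans (cong₂ _*_ (transform tc td ta c d a) (transform td te tb d e b))
      (solve 8 (λ ta tb tc td te μ s t → tc :* td :* ta :* (μ :* s) :* (td :* te :* tb :* (μ :* t))
                 := ta :* tb :* tc :* (td :* td :* te) :* (μ :* μ) :* (s :* t)) refl ta tb tc td te μ α β)
    γδ′ : det3 (tb • apply A b) (ta • apply A a) (td • apply A d) * det3 (tc • apply A c) (td • apply A d) (te • apply A e) ≡ K * (γ * δ)
    γδ′ = trans (cong₂ _*_ (transform tb ta td b a d) (transform tc td te c d e))
      (solve 8 (λ ta tb tc td te μ s t → tb :* ta :* td :* (μ :* s) :* (tc :* td :* te :* (μ :* t))
                 := ta :* tb :* tc :* (td :* td :* te) :* (μ :* μ) :* (s :* t)) refl ta tb tc td te μ γ δ)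
    -- `K` divides a product of two brackets of the second corner, both of which are nonzero.
    K≢0 : ¬ K ≡ 0#
    K≢0 = *-≢0ˡ λ p → *-≢0 cda′≢0 deb′≢0 (trans αβ′ p)

  -- From an inscribed twisted polygon to coordinates.

  module InscribedPolygon (n : ℕ) (v : ℤ → V3) (polygon : TwistedPolygon n v)
                          (C : NondegConic) (on-conic : ∀ i → OnConic C (v i))
                          (x y : ℤ → Carrier)
                          (corner-x : ∀ i → IsCornerX v i (x i)) (corner-y : ∀ i → IsCornerY v i (y i)) where
    open TwistedPolygon polygon
    open ConicProperties C
    open InscribedPentagon R C

    -- Indices are shifted so that the corner invariants with index j involve the vertices j, …, j + 4.
    private
      u : ℕ → V3
      u j = v (ℤ.+ j ℤ.- ℤ.+ 4)

    X Y : ℕ → Carrier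
    X j = x (ℤ.+ j ℤ.- ℤ.+ 2)
    Y j = y (ℤ.+ j ℤ.- ℤ.+ 2)

    private
      vertex : ∀ j k b → ℤ.- (ℤ.+ 2) ℤ.+ b ≡ ℤ.+ k ℤ.- ℤ.+ 4 → v (ℤ.+ j ℤ.- ℤ.+ 2 ℤ.+ b) ≡ u (k ℕ.+ j)
      vertex j k b p = cong v (begin
        ℤ.+ j ℤ.- ℤ.+ 2 ℤ.+ b                 ≡⟨ ℤₚ.+-assoc (ℤ.+ j) (ℤ.- (ℤ.+ 2)) b ⟩
        ℤ.+ j ℤ.+ (ℤ.- (ℤ.+ 2) ℤ.+ b)         ≡⟨ cong (λ t → ℤ.+ j ℤ.+ t) p ⟩
        ℤ.+ j ℤ.+ (ℤ.+ k ℤ.- ℤ.+ 4)           ≡⟨ ℤₚ.+-assoc (ℤ.+ j) (ℤ.+ k) (ℤ.- (ℤ.+ 4)) ⟨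
        ℤ.+ (j ℕ.+ k) ℤ.- ℤ.+ 4               ≡⟨ cong (λ t → ℤ.+ t ℤ.- ℤ.+ 4) (ℕₚ.+-comm j k) ⟩
        ℤ.+ (k ℕ.+ j) ℤ.- ℤ.+ 4               ∎)
        where open ≡-Reasoning

      module _ (j : ℕ) where
        private
          i = ℤ.+ j ℤ.- ℤ.+ 2
          v-2 = vertex j 0 (ℤ.- (ℤ.+ 2)) refl
          v-1 = vertex j 1 (ℤ.- (ℤ.+ 1)) refl
          v-0 = trans (cong v (sym (ℤₚ.+-identityʳ i))) (vertex j 2 (ℤ.+ 0) refl)
          v+1 = vertex j 3 (ℤ.+ 1) refl
          v+2 = vertex j 4 (ℤ.+ 2) refl

        cornerX : Corner (u j) (u (1 ℕ.+ j)) (u (2 ℕ.+ j)) (u (3 ℕ.+ j)) (u (4 ℕ.+ j)) (X j)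
        cornerX rewrite sym v-2 | sym v-1 | sym v-0 | sym v+1 | sym v+2 = record
          { meet₃ = meet₃ ; meet₄ = meet₄ ; cr = cr }
          where open IsCornerX (corner-x i)

        cornerY : Corner (u (4 ℕ.+ j)) (u (3 ℕ.+ j)) (u (2 ℕ.+ j)) (u (1 ℕ.+ j)) (u j) (Y j)
        cornerY rewrite sym v-2 | sym v-1 | sym v-0 | sym v+1 | sym v+2 = record
          { meet₃ = meet₃ ; meet₄ = meet₄ ; cr = cr }
          where open IsCornerY (corner-y i)

        module CX = CornerProperties cornerX
        module CY = CornerProperties cornerY

      on : ∀ j → OnConic C (u j)
      on j = on-conic (ℤ.+ j ℤ.- ℤ.+ 4)

      form-02≢0 : ∀ j → ¬ form (u j) (u (2 ℕ.+ j)) ≡ 0#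
      form-02≢0 j p = proj₂ (proj₂ (noncollinear⇒form≢0 (on (2 ℕ.+ j)) (on (3 ℕ.+ j)) (on j) (CX.cda≢0 j)))
        (trans (form-symmetric _ _) p)

      crossRatio : ∀ j → ∃ (ConicCrossRatio (u j) (u (1 ℕ.+ j)) (u (2 ℕ.+ j)) (u (3 ℕ.+ j)))
      crossRatio j = N * proj₁ inv , trans (*-assoc N (proj₁ inv) D)
        (trans (cong (N *_) (trans (*-comm (proj₁ inv) D) (proj₂ inv))) (*-identityʳ N))
        where
        q : ℕ → ℕ → Carrier
        q k l = form (u (k ℕ.+ j)) (u (l ℕ.+ j))
        N = q 0 1 * q 2 3 + q 0 2 * q 1 3 − q 0 3 * q 1 2
        D = 2# * (q 0 2 * q 1 3)
        inv = inverse D (*-≢0 2≢0 (*-≢0 (form-02≢0 j) (form-02≢0 (suc j))))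

      monodromy-at : ∀ j → ∃ λ t → u (j ℕ.+ n) ≡ t • apply M (u j)
      monodromy-at j with monodromy (ℤ.+ j ℤ.- ℤ.+ 4)
      ... | _ , _ , t , p = t , trans (cong v (begin
          ℤ.+ (j ℕ.+ n) ℤ.- ℤ.+ 4             ≡⟨ cong (λ t → ℤ.+ t ℤ.- ℤ.+ 4) (ℕₚ.+-comm j n) ⟩
          ℤ.+ n ℤ.+ ℤ.+ j ℤ.- ℤ.+ 4           ≡⟨ ℤₚ.+-assoc (ℤ.+ n) (ℤ.+ j) (ℤ.- (ℤ.+ 4)) ⟩
          ℤ.+ n ℤ.+ (ℤ.+ j ℤ.- ℤ.+ 4)         ≡⟨ ℤₚ.+-comm (ℤ.+ n) (ℤ.+ j ℤ.- ℤ.+ 4) ⟩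
          ℤ.+ j ℤ.- ℤ.+ 4 ℤ.+ ℤ.+ n           ∎)) p
        where open ≡-Reasoning

      X-value : ∀ j → _
      X-value j = value (on j) (on (1 ℕ.+ j)) (on (2 ℕ.+ j)) (on (3 ℕ.+ j)) (on (4 ℕ.+ j)) (cornerX j)
        (CY.deb≢0 j) (CY.cda≢0 j) (proj₂ (crossRatio j)) (proj₂ (crossRatio (suc j)))

      -- In the reversed pentagon the first four vertices carry the cross ratio of index j + 1 and
      -- the last four that of index j; hence the exchange of indices between the X-relation and the
      -- Y-relation.
      Y-value : ∀ j → _
      Y-value j = value (on (4 ℕ.+ j)) (on (3 ℕ.+ j)) (on (2 ℕ.+ j)) (on (1 ℕ.+ j)) (on j) (cornerY j)
        (CX.deb≢0 j) (CX.cda≢0 j) (conicCrossRatio-reverse (proj₂ (crossRatio (suc j)))) (conicCrossRatio-reverse (proj₂ (crossRatio j)))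

    -- The monodromy carries each corner to the one n steps later, and the bracket formula is a
    -- projective invariant.
    X-periodic : ∀ j → X (j ℕ.+ n) ≡ X j
    X-periodic j = corner-invariant M (cornerX j) (cornerX (j ℕ.+ n))
      (monodromy-at j) (monodromy-at (1 ℕ.+ j)) (monodromy-at (2 ℕ.+ j)) (monodromy-at (3 ℕ.+ j)) (monodromy-at (4 ℕ.+ j))
      (X-value j) (X-value (j ℕ.+ n))

    Y-periodic : ∀ j → Y (j ℕ.+ n) ≡ Y j
    Y-periodic j = corner-invariant M (cornerY j) (cornerY (j ℕ.+ n))
      (monodromy-at (4 ℕ.+ j)) (monodromy-at (3 ℕ.+ j)) (monodromy-at (2 ℕ.+ j)) (monodromy-at (1 ℕ.+ j)) (monodromy-at j)
      (Y-value j) (Y-value (j ℕ.+ n))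

    inscribed-coordinates : ¬ ¬ Coordinates n X Y
    inscribed-coordinates = coordinates-exist X-periodic Y-periodic (λ j → proj₁ (crossRatio j))
      (λ j → crossRatio≢0 (on j) (on (1 ℕ.+ j)) (on (2 ℕ.+ j)) (on (3 ℕ.+ j)) (on (4 ℕ.+ j)) (cornerX j)
        (CY.deb≢0 j) (CY.cda≢0 j) (proj₂ (crossRatio j)) (proj₂ (crossRatio (suc j))))
      (λ j → corner-crossRatio (on j) (on (1 ℕ.+ j)) (on (2 ℕ.+ j)) (on (3 ℕ.+ j)) (on (4 ℕ.+ j)) (cornerX j)
        (CY.deb≢0 j) (CY.cda≢0 j) (proj₂ (crossRatio j)) (proj₂ (crossRatio (suc j))))
      (λ j → corner-crossRatio (on (4 ℕ.+ j)) (on (3 ℕ.+ j)) (on (2 ℕ.+ j)) (on (1 ℕ.+ j)) (on j) (cornerY j)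
        (CX.deb≢0 j) (CX.cda≢0 j) (conicCrossRatio-reverse (proj₂ (crossRatio (suc j)))) (conicCrossRatio-reverse (proj₂ (crossRatio j))))

-- Three-term state recursions, their traces and the map between them.

module TransferMatrices (R : RealField) where
  open RealFieldProperties R
  open ℤ-Solver using (solve; _:=_; _:+_; _:*_; :-_; _:-_)
  open Geometry R
  open ProjectivePlane R using (≡3)
  open CrossRatioCoordinates R using (Coordinates)

  e₁ e₂ e₃ : V3
  e₁ = 1# , 0# , 0#
  e₂ = 0# , 1# , 0#
  e₃ = 0# , 0# , 1#

  π₁ π₂ π₃ : V3 → Carrier
  π₁ (s₁ , _ , _) = s₁
  π₂ (_ , s₂ , _) = s₂
  π₃ (_ , _ , s₃) = s₃

  Weight : Set
  Weight = ℕ → Carrier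

  -- One step of the recursion f (j+1) = f j + A j * f (j-1) + B j * f (j-2), on the state (f j, f (j-1), f (j-2)).
  step : Weight → Weight → ℕ → V3 → V3
  step A B j (s₁ , s₂ , s₃) = s₁ + A j * s₂ + B j * s₃ , s₁ , s₂

  run : Weight → Weight → ℕ → ℕ → V3 → V3
  run A B i zero    s = s
  run A B i (suc m) s = run A B (suc i) m (step A B i s)

  trace : Weight → Weight → ℕ → Carrier
  trace A B n = π₁ (run A B 0 n e₁) + π₂ (run A B 0 n e₂) + π₃ (run A B 0 n e₃)

  Linear : (V3 → V3) → Set
  Linear f = ∀ t s w → f ((t • s) ⊕ w) ≡ (t • f s) ⊕ f w

  step-linear : ∀ A B j → Linear (step A B j)
  step-linear A B j t (s₁ , s₂ , s₃) (w₁ , w₂ , w₃) = ≡3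
    (solve 9 (λ a b t s₁ s₂ s₃ w₁ w₂ w₃ →
      (t :* s₁ :+ w₁) :+ a :* (t :* s₂ :+ w₂) :+ b :* (t :* s₃ :+ w₃)
      := t :* (s₁ :+ a :* s₂ :+ b :* s₃) :+ (w₁ :+ a :* w₂ :+ b :* w₃)) refl (A j) (B j) t s₁ s₂ s₃ w₁ w₂ w₃)
    refl refl

  run-linear : ∀ A B i m → Linear (run A B i m)
  run-linear A B i zero t s w = refl
  run-linear A B i (suc m) t s w = trans (cong (run A B (suc i) m) (step-linear A B i t s w))
    (run-linear A B (suc i) m t (step A B i s) (step A B i w))

  combination : V3 → V3 → V3 → V3 → V3
  combination (s₁ , s₂ , s₃) a b c = (s₁ • a) ⊕ ((s₂ • b) ⊕ (s₃ • c))

  linear-combination : ∀ {f} → Linear f → ∀ s → f s ≡ combination s (f e₁) (f e₂) (f e₃)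
  linear-combination {f} lin s@(s₁ , s₂ , s₃) = begin
    f s                                                                    ≡⟨ cong f decompose ⟩
    f ((s₁ • e₁) ⊕ ((s₂ • e₂) ⊕ ((s₃ • e₃) ⊕ zero3)))                      ≡⟨ lin s₁ e₁ _ ⟩
    (s₁ • f e₁) ⊕ f ((s₂ • e₂) ⊕ ((s₃ • e₃) ⊕ zero3))                      ≡⟨ cong ((s₁ • f e₁) ⊕_) (lin s₂ e₂ _) ⟩
    (s₁ • f e₁) ⊕ ((s₂ • f e₂) ⊕ f ((s₃ • e₃) ⊕ zero3))                    ≡⟨ cong (λ w → (s₁ • f e₁) ⊕ ((s₂ • f e₂) ⊕ w)) (lin s₃ e₃ zero3) ⟩
    (s₁ • f e₁) ⊕ ((s₂ • f e₂) ⊕ ((s₃ • f e₃) ⊕ f zero3))                  ≡⟨ cong (λ w → (s₁ • f e₁) ⊕ ((s₂ • f e₂) ⊕ w)) (trans (cong ((s₃ • f e₃) ⊕_) f-zero3) (⊕-zero3 _)) ⟩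
    combination s (f e₁) (f e₂) (f e₃)                                     ∎
    where
    open ≡-Reasoning
    ⊕-zero3 : ∀ a → a ⊕ zero3 ≡ a
    ⊕-zero3 _ = ≡3 (+-identityʳ _) (+-identityʳ _) (+-identityʳ _)
    decompose : s ≡ (s₁ • e₁) ⊕ ((s₂ • e₂) ⊕ ((s₃ • e₃) ⊕ zero3))
    decompose = ≡3
      (solve 3 (λ a b c → a := a :* :1 :+ (b :* :0 :+ (c :* :0 :+ :0))) refl s₁ s₂ s₃)
      (solve 3 (λ a b c → b := a :* :0 :+ (b :* :1 :+ (c :* :0 :+ :0))) refl s₁ s₂ s₃)
      (solve 3 (λ a b c → c := a :* :0 :+ (b :* :0 :+ (c :* :1 :+ :0))) refl s₁ s₂ s₃)
    -- `Linear` is a single equation; its instance with scalar -1 at the zero vector yields this.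
    f-zero3 : f zero3 ≡ zero3
    f-zero3 = begin
      f zero3                              ≡⟨ cong f (≡3 minus minus minus) ⟩
      f (((- 1#) • zero3) ⊕ zero3)         ≡⟨ lin (- 1#) zero3 zero3 ⟩
      ((- 1#) • f zero3) ⊕ f zero3         ≡⟨ ≡3 (cancel _) (cancel _) (cancel _) ⟩
      zero3                                ∎
      where
      minus : 0# ≡ - 1# * 0# + 0#
      minus = solve 0 (:0 := (:- :1) :* :0 :+ :0) refl
      cancel : ∀ a → - 1# * a + a ≡ 0#
      cancel = solve 1 (λ a → (:- :1) :* a :+ a := :0) refl

  -- In matrix terms T G = G S, where G has the columns g₁, g₂, g₃. G may be singular, so the traces
  -- are compared after multiplication by det G.
  module _ (S T : V3 → V3) (T-linear : Linear T) (g₁ g₂ g₃ : V3)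
           (T-g₁ : T g₁ ≡ combination (S e₁) g₁ g₂ g₃) (T-g₂ : T g₂ ≡ combination (S e₂) g₁ g₂ g₃)
           (T-g₃ : T g₃ ≡ combination (S e₃) g₁ g₂ g₃) where

    private
      trace-S trace-T : Carrier
      trace-S = π₁ (S e₁) + π₂ (S e₂) + π₃ (S e₃)
      trace-T = π₁ (T e₁) + π₂ (T e₂) + π₃ (T e₃)

      derivation : V3 → V3 → V3 → Carrier
      derivation x y z = det3 x g₂ g₃ + det3 g₁ y g₃ + det3 g₁ g₂ z

      :combination : ∀ {n} (s₁ s₂ s₃ a b c : ℤ-Solver.Polynomial n) → ℤ-Solver.Polynomial n
      :combination s₁ s₂ s₃ a b c = s₁ :* a :+ (s₂ :* b :+ s₃ :* c)

      :det3 : ∀ {n} (a₁ a₂ a₃ b₁ b₂ b₃ c₁ c₂ c₃ : ℤ-Solver.Polynomial n) → ℤ-Solver.Polynomial n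
      :det3 a₁ a₂ a₃ b₁ b₂ b₃ c₁ c₂ c₃ =
        a₁ :* (b₂ :* c₃ :- b₃ :* c₂) :+ a₂ :* (b₃ :* c₁ :- b₁ :* c₃) :+ a₃ :* (b₁ :* c₂ :- b₂ :* c₁)

      derivation-T : derivation (combination g₁ (T e₁) (T e₂) (T e₃)) (combination g₂ (T e₁) (T e₂) (T e₃))
                                (combination g₃ (T e₁) (T e₂) (T e₃)) ≡ det3 g₁ g₂ g₃ * trace-T
      derivation-T = solve 18 (λ x₁ x₂ x₃ y₁ y₂ y₃ z₁ z₂ z₃ a₁ a₂ a₃ b₁ b₂ b₃ c₁ c₂ c₃ →
          :det3 (:combination x₁ x₂ x₃ a₁ b₁ c₁) (:combination x₁ x₂ x₃ a₂ b₂ c₂) (:combination x₁ x₂ x₃ a₃ b₃ c₃) y₁ y₂ y₃ z₁ z₂ z₃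
          :+ :det3 x₁ x₂ x₃ (:combination y₁ y₂ y₃ a₁ b₁ c₁) (:combination y₁ y₂ y₃ a₂ b₂ c₂) (:combination y₁ y₂ y₃ a₃ b₃ c₃) z₁ z₂ z₃
          :+ :det3 x₁ x₂ x₃ y₁ y₂ y₃ (:combination z₁ z₂ z₃ a₁ b₁ c₁) (:combination z₁ z₂ z₃ a₂ b₂ c₂) (:combination z₁ z₂ z₃ a₃ b₃ c₃)
          := :det3 x₁ x₂ x₃ y₁ y₂ y₃ z₁ z₂ z₃ :* (a₁ :+ b₂ :+ c₃)) refl
        (π₁ g₁) (π₂ g₁) (π₃ g₁) (π₁ g₂) (π₂ g₂) (π₃ g₂) (π₁ g₃) (π₂ g₃) (π₃ g₃)
        (π₁ (T e₁)) (π₂ (T e₁)) (π₃ (T e₁)) (π₁ (T e₂)) (π₂ (T e₂)) (π₃ (T e₂)) (π₁ (T e₃)) (π₂ (T e₃)) (π₃ (T e₃))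

      derivation-S : derivation (combination (S e₁) g₁ g₂ g₃) (combination (S e₂) g₁ g₂ g₃)
                                (combination (S e₃) g₁ g₂ g₃) ≡ det3 g₁ g₂ g₃ * trace-S
      derivation-S = solve 18 (λ x₁ x₂ x₃ y₁ y₂ y₃ z₁ z₂ z₃ a₁ a₂ a₃ b₁ b₂ b₃ c₁ c₂ c₃ →
          :det3 (:combination a₁ a₂ a₃ x₁ y₁ z₁) (:combination a₁ a₂ a₃ x₂ y₂ z₂) (:combination a₁ a₂ a₃ x₃ y₃ z₃) y₁ y₂ y₃ z₁ z₂ z₃
          :+ :det3 x₁ x₂ x₃ (:combination b₁ b₂ b₃ x₁ y₁ z₁) (:combination b₁ b₂ b₃ x₂ y₂ z₂) (:combination b₁ b₂ b₃ x₃ y₃ z₃) z₁ z₂ z₃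
          :+ :det3 x₁ x₂ x₃ y₁ y₂ y₃ (:combination c₁ c₂ c₃ x₁ y₁ z₁) (:combination c₁ c₂ c₃ x₂ y₂ z₂) (:combination c₁ c₂ c₃ x₃ y₃ z₃)
          := :det3 x₁ x₂ x₃ y₁ y₂ y₃ z₁ z₂ z₃ :* (a₁ :+ b₂ :+ c₃)) refl
        (π₁ g₁) (π₂ g₁) (π₃ g₁) (π₁ g₂) (π₂ g₂) (π₃ g₂) (π₁ g₃) (π₂ g₃) (π₃ g₃)
        (π₁ (S e₁)) (π₂ (S e₁)) (π₃ (S e₁)) (π₁ (S e₂)) (π₂ (S e₂)) (π₃ (S e₂)) (π₁ (S e₃)) (π₂ (S e₃)) (π₃ (S e₃))

    -- Both sides are the derivative of the determinant along T.
    conjugate-trace : det3 g₁ g₂ g₃ * trace-S ≡ det3 g₁ g₂ g₃ * trace-T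
    conjugate-trace = begin
      det3 g₁ g₂ g₃ * trace-S            ≡⟨ derivation-S ⟨
      derivation _ _ _                   ≡⟨ cong₂ (λ x y → derivation x y _) T-g₁ T-g₂ ⟨
      derivation (T g₁) (T g₂) _         ≡⟨ cong (derivation (T g₁) (T g₂)) T-g₃ ⟨
      derivation (T g₁) (T g₂) (T g₃)    ≡⟨ cong₂ (λ x y → derivation x y (T g₃)) (linear-combination T-linear g₁) (linear-combination T-linear g₂) ⟩
      derivation _ _ (T g₃)              ≡⟨ cong (derivation _ _) (linear-combination T-linear g₃) ⟩
      derivation _ _ _                   ≡⟨ derivation-T ⟩
      det3 g₁ g₂ g₃ * trace-T            ∎
      where open ≡-Reasoning

  module Intertwining {n X Y} (coordinates : Coordinates n X Y) (z : Carrier) where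
    open Coordinates coordinates

    A B A′ B′ : Weight
    A j  = z * X (suc j)
    B j  = z * - (X j * Y j * X (suc j))
    A′ j = z * Y (suc j)
    B′ j = z * - (Y j * X (suc j) * Y (suc j))

    -- f ↦ c f + (1 − c) f⁺ maps solutions of the recursion with weights A, B
    -- to solutions of the one with weights A′, B′.
    gauge : ℕ → V3 → V3
    gauge j (s₁ , s₂ , s₃) =
        c (2 ℕ.+ j) * s₁ + (1# − c (2 ℕ.+ j)) * (s₁ + A j * s₂ + B j * s₃)
      , c (1 ℕ.+ j) * s₂ + (1# − c (1 ℕ.+ j)) * s₁
      , c j * s₃ + (1# − c j) * s₂

    private
      difference≡0 : ∀ {a b} → a ≡ b → a − b ≡ 0#
      difference≡0 {b = b} p = trans (cong (_− b) p) (-‿inverseʳ b)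

      -- The error in `intertwining` when the relations are not assumed, as a combination of the
      -- residuals ρ of the five relations involved. The solver verifies this polynomial identity,
      -- and then the residuals are set to zero.
      deviation : (X₀ Y₀ X₁ Y₁ s₁ s₂ s₃ ρ₁ ρ₂ ρ₃ ρ₄ ρ₅ : Carrier) → Carrier
      deviation X₀ Y₀ X₁ Y₁ s₁ s₂ s₃ ρ₁ ρ₂ ρ₃ ρ₄ ρ₅ =
        z * (s₁ * (ρ₁ − ρ₂) + s₂ * (X₁ * Y₁ * (ρ₃ − ρ₁) + (Y₁ * ρ₄ − X₁ * ρ₂)) + s₃ * (Y₀ * X₁ * (X₀ * ρ₂ − Y₁ * ρ₅)))

    intertwining : ∀ j s → gauge (suc j) (step A B j s) ≡ step A′ B′ j (gauge j s)
    -- The last two coordinates are shifted copies on both sides and agree by computation.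
    intertwining j s@(s₁ , s₂ , s₃) = ≡3 first refl refl
      where
      open ≡-Reasoning
      X₀ = X j
      Y₀ = Y j
      X₁ = X (1 ℕ.+ j)
      Y₁ = Y (1 ℕ.+ j)
      X₂ = X (2 ℕ.+ j)
      c₀ = c j
      c₁ = c (1 ℕ.+ j)
      c₂ = c (2 ℕ.+ j)
      c₃ = c (3 ℕ.+ j)
      dev : Carrier → Carrier → Carrier → Carrier → Carrier → Carrier
      dev = deviation X₀ Y₀ X₁ Y₁ s₁ s₂ s₃
      first : π₁ (gauge (suc j) (step A B j s)) ≡ π₁ (step A′ B′ j (gauge j s))
      first = begin
        π₁ (gauge (suc j) (step A B j s))
          ≡⟨ solve 13 (λ z s₁ s₂ s₃ X₀ Y₀ X₁ Y₁ X₂ c₀ c₁ c₂ c₃ →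
               let A₀ = z :* X₁
                   B₀ = z :* (:- (X₀ :* Y₀ :* X₁))
                   f = s₁ :+ A₀ :* s₂ :+ B₀ :* s₃
                   g₁ = c₂ :* s₁ :+ (:1 :- c₂) :* f
                   g₂ = c₁ :* s₂ :+ (:1 :- c₁) :* s₁
                   g₃ = c₀ :* s₃ :+ (:1 :- c₀) :* s₂
                   ρ₁ = X₂ :* (:1 :- c₃) :- c₂
                   ρ₂ = Y₁ :* (:1 :- c₁) :- c₂
                   ρ₃ = Y₀ :* (:1 :- c₀) :- c₁
                   ρ₄ = X₁ :* (:1 :- c₂) :- c₁
                   ρ₅ = X₀ :* (:1 :- c₁) :- c₀
               in c₃ :* f :+ (:1 :- c₃) :* (f :+ z :* X₂ :* s₁ :+ z :* (:- (X₁ :* Y₁ :* X₂)) :* s₂)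
                  := (g₁ :+ z :* Y₁ :* g₂ :+ z :* (:- (Y₀ :* X₁ :* Y₁)) :* g₃)
                     :+ z :* (s₁ :* (ρ₁ :- ρ₂) :+ s₂ :* (X₁ :* Y₁ :* (ρ₃ :- ρ₁) :+ (Y₁ :* ρ₄ :- X₁ :* ρ₂)) :+ s₃ :* (Y₀ :* X₁ :* (X₀ :* ρ₂ :- Y₁ :* ρ₅))))
               refl z s₁ s₂ s₃ X₀ Y₀ X₁ Y₁ X₂ c₀ c₁ c₂ c₃ ⟩
        new + dev (X₂ * (1# − c₃) − c₂) (Y₁ * (1# − c₁) − c₂) (Y₀ * (1# − c₀) − c₁) (X₁ * (1# − c₂) − c₁) (X₀ * (1# − c₁) − c₀)
          ≡⟨ cong₂ (λ p q → new + dev p q (Y₀ * (1# − c₀) − c₁) (X₁ * (1# − c₂) − c₁) (X₀ * (1# − c₁) − c₀))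
               (difference≡0 (X-relation (2 ℕ.+ j))) (difference≡0 (Y-relation (1 ℕ.+ j))) ⟩
        new + dev 0# 0# (Y₀ * (1# − c₀) − c₁) (X₁ * (1# − c₂) − c₁) (X₀ * (1# − c₁) − c₀)
          ≡⟨ cong₂ (λ p q → new + dev 0# 0# p q (X₀ * (1# − c₁) − c₀))
               (difference≡0 (Y-relation j)) (difference≡0 (X-relation (1 ℕ.+ j))) ⟩
        new + dev 0# 0# 0# 0# (X₀ * (1# − c₁) − c₀)
          ≡⟨ cong (λ p → new + dev 0# 0# 0# 0# p) (difference≡0 (X-relation j)) ⟩
        new + dev 0# 0# 0# 0# 0#
          ≡⟨ solve 9 (λ new z s₁ s₂ s₃ X₀ Y₀ X₁ Y₁ →
               new :+ z :* (s₁ :* (:0 :- :0) :+ s₂ :* (X₁ :* Y₁ :* (:0 :- :0) :+ (Y₁ :* :0 :- X₁ :* :0)) :+ s₃ :* (Y₀ :* X₁ :* (X₀ :* :0 :- Y₁ :* :0)))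
               := new) refl new z s₁ s₂ s₃ X₀ Y₀ X₁ Y₁ ⟩
        new ∎
        where new = π₁ (step A′ B′ j (gauge j s))

    gauge-linear : ∀ j → Linear (gauge j)
    gauge-linear j t (s₁ , s₂ , s₃) (w₁ , w₂ , w₃) = ≡3
      (solve 10 (λ c a b t s₁ s₂ s₃ w₁ w₂ w₃ →
        c :* (t :* s₁ :+ w₁) :+ (:1 :- c) :* ((t :* s₁ :+ w₁) :+ a :* (t :* s₂ :+ w₂) :+ b :* (t :* s₃ :+ w₃))
        := t :* (c :* s₁ :+ (:1 :- c) :* (s₁ :+ a :* s₂ :+ b :* s₃)) :+ (c :* w₁ :+ (:1 :- c) :* (w₁ :+ a :* w₂ :+ b :* w₃)))
        refl (c (2 ℕ.+ j)) (A j) (B j) t s₁ s₂ s₃ w₁ w₂ w₃)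
      (mix (c (1 ℕ.+ j)) t s₂ s₁ w₂ w₁) (mix (c j) t s₃ s₂ w₃ w₂)
      where
      mix : ∀ c t s s′ w w′ → c * (t * s + w) + (1# − c) * (t * s′ + w′) ≡ t * (c * s + (1# − c) * s′) + (c * w + (1# − c) * w′)
      mix = solve 6 (λ c t s s′ w w′ → c :* (t :* s :+ w) :+ (:1 :- c) :* (t :* s′ :+ w′)
                                    := t :* (c :* s :+ (:1 :- c) :* s′) :+ (c :* w :+ (:1 :- c) :* w′)) refl

    run-intertwining : ∀ i m s → gauge (m ℕ.+ i) (run A B i m s) ≡ run A′ B′ i m (gauge i s)
    run-intertwining i zero s = refl
    run-intertwining i (suc m) s = begin
      gauge (suc m ℕ.+ i) (run A B (suc i) m (step A B i s))   ≡⟨ cong (λ k → gauge k (run A B (suc i) m (step A B i s))) (ℕₚ.+-suc m i) ⟨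
      gauge (m ℕ.+ suc i) (run A B (suc i) m (step A B i s))   ≡⟨ run-intertwining (suc i) m (step A B i s) ⟩
      run A′ B′ (suc i) m (gauge (suc i) (step A B i s))       ≡⟨ cong (run A′ B′ (suc i) m) (intertwining i s) ⟩
      run A′ B′ (suc i) m (step A′ B′ i (gauge i s))           ∎
      where open ≡-Reasoning

    module _ (X-periodic : ∀ j → X (j ℕ.+ n) ≡ X j) (Y-periodic : ∀ j → Y (j ℕ.+ n) ≡ Y j) where
      gauge-periodic : ∀ s → gauge (n ℕ.+ 0) s ≡ gauge 0 s
      gauge-periodic (s₁ , s₂ , s₃) rewrite ℕₚ.+-identityʳ n
        | X-periodic 0 | X-periodic 1 | Y-periodic 0 | c-periodic 0 | c-periodic 1 | c-periodic 2 = refl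

      traces-agree : det3 (gauge 0 e₁) (gauge 0 e₂) (gauge 0 e₃) * trace A B n
                     ≡ det3 (gauge 0 e₁) (gauge 0 e₂) (gauge 0 e₃) * trace A′ B′ n
      traces-agree = conjugate-trace (run A B 0 n) (run A′ B′ 0 n) (run-linear A′ B′ 0 n)
        (gauge 0 e₁) (gauge 0 e₂) (gauge 0 e₃) (image e₁) (image e₂) (image e₃)
        where
        image : ∀ s → run A′ B′ 0 n (gauge 0 s) ≡ combination (run A B 0 n s) (gauge 0 e₁) (gauge 0 e₂) (gauge 0 e₃)
        image s = trans (sym (run-intertwining 0 n s))
          (trans (gauge-periodic (run A B 0 n s)) (linear-combination (gauge-linear 0) (run A B 0 n s)))

    gauge-slope : Carrier
    gauge-slope = - ((1# − c 1) * (1# − c 2) * (X 1 * c 0 + (1# − c 0) * (X 0 * Y 0 * X 1)))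

    -- Only the first coordinate of `gauge` involves z, and linearly. At z = 0 the matrix is
    -- triangular with diagonal 1, c 1, c 0.
    gauge-determinant : det3 (gauge 0 e₁) (gauge 0 e₂) (gauge 0 e₃) ≡ c 0 * c 1 + z * gauge-slope
    gauge-determinant = solve 7 (λ z X₀ Y₀ X₁ c₀ c₁ c₂ →
        let a = z :* X₁
            b = z :* (:- (X₀ :* Y₀ :* X₁))
            g₁ = λ s₁ s₂ s₃ → c₂ :* s₁ :+ (:1 :- c₂) :* (s₁ :+ a :* s₂ :+ b :* s₃)
            g₂ = λ s₁ s₂ → c₁ :* s₂ :+ (:1 :- c₁) :* s₁
            g₃ = λ s₂ s₃ → c₀ :* s₃ :+ (:1 :- c₀) :* s₂
            x₁ = g₁ :1 :0 :0 ; x₂ = g₂ :1 :0 ; x₃ = g₃ :0 :0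
            y₁ = g₁ :0 :1 :0 ; y₂ = g₂ :0 :1 ; y₃ = g₃ :1 :0
            z₁ = g₁ :0 :0 :1 ; z₂ = g₂ :0 :0 ; z₃ = g₃ :0 :1
        in x₁ :* (y₂ :* z₃ :- y₃ :* z₂) :+ x₂ :* (y₃ :* z₁ :- y₁ :* z₃) :+ x₃ :* (y₁ :* z₂ :- y₂ :* z₁)
           := c₀ :* c₁ :+ z :* (:- ((:1 :- c₁) :* (:1 :- c₂) :* (X₁ :* c₀ :+ (:1 :- c₀) :* (X₀ :* Y₀ :* X₁)))))
      refl z (X 0) (Y 0) (X 1) (c 0) (c 1) (c 2)

-- Generating functions of admissible products as independence polynomials.

module IndependencePolynomial (R : RealField) where
  open RealFieldProperties R
  open ℤ-Solver using (solve; _:=_; _:+_; _:*_; :-_; _:-_)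
  open Geometry R

  sumR-++ : ∀ k l → sumR (k ++ l) ≡ sumR k + sumR l
  sumR-++ [] l = sym (+-identityˡ _)
  sumR-++ (a ∷ k) l = trans (cong (a +_) (sumR-++ k l)) (sym (+-assoc a _ _))

  sumR-scale : ∀ {A : Set} t (f : A → Carrier) l → sumR (map (λ a → t * f a) l) ≡ t * sumR (map f l)
  sumR-scale t f [] = sym (zeroʳ t)
  sumR-scale t f (a ∷ l) = trans (cong (t * f a +_) (sumR-scale t f l)) (sym (distribˡ t _ _))

  sumR-zero : ∀ {A : Set} (l : List A) → sumR (map (λ _ → 0#) l) ≡ 0#
  sumR-zero [] = refl
  sumR-zero (a ∷ l) = trans (+-identityˡ _) (sumR-zero l)

  -- The local function noneCons in Defs.admissible has no name outside its
  -- definition; the left-hand side below is inferred from the use in admissible-∷.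
  noneCons-all : ∀ c f (S′ S : List Factor) → _ ≡ all (not ∘ c f) S

  admissible-∷ : ∀ c f S → admissible c (f ∷ S) ≡ all (not ∘ c f) S ∧ admissible c S
  admissible-∷ c f [] = refl
  admissible-∷ c f (g ∷ S) with g ∷ S
  ... | S′ = cong₂ _∧_ (cong (not (c f g) ∧_) (noneCons-all c f S′ S)) refl

  noneCons-all c f S′ []      = refl
  noneCons-all c f S′ (g ∷ S) = cong (not (c f g) ∧_) (noneCons-all c f S′ S)

  all-∧ : ∀ {A : Set} (p q : A → Bool) S → all (λ a → p a ∧ q a) S ≡ all q S ∧ all p S
  all-∧ p q [] = refl
  all-∧ p q (a ∷ S) rewrite all-∧ p q S with p a | q a
  ... | true  | true  = refl
  ... | true  | false = refl
  ... | false | true  = sym (Boolₚ.∧-zeroʳ _)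
  ... | false | false = refl

  -- Weighted independence polynomial of the graph with adjacency c on the factors of L that satisfy
  -- p: either f is chosen and its neighbours are forbidden, or f is omitted. The predicate records
  -- what earlier choices forbid, so the list itself stays intact.
  indep : (Factor → Factor → Bool) → (Factor → Carrier) → List Factor → (Factor → Bool) → Carrier
  indep c ω []      p = 1#
  indep c ω (f ∷ L) p = (if p f then ω f * indep c ω L (λ g → p g ∧ not (c f g)) else 0#) + indep c ω L p

  term : (Factor → Factor → Bool) → (Factor → Carrier) → (Factor → Bool) → List Factor → Carrier
  term c ω p S = if all p S ∧ admissible c S then prodR (map ω S) else 0#

  sum-of-terms : ∀ c ω L p → sumR (map (term c ω p) (sublists L)) ≡ indep c ω L p
  sum-of-terms c ω [] p = +-identityʳ 1#
  sum-of-terms c ω (f ∷ L) p = begin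
    sumR (map (term c ω p) (map (f ∷_) (sublists L) ++ sublists L))
      ≡⟨ cong sumR (Listₚ.map-++ (term c ω p) (map (f ∷_) (sublists L)) (sublists L)) ⟩
    sumR (map (term c ω p) (map (f ∷_) (sublists L)) ++ map (term c ω p) (sublists L))
      ≡⟨ sumR-++ (map (term c ω p) (map (f ∷_) (sublists L))) _ ⟩
    sumR (map (term c ω p) (map (f ∷_) (sublists L))) + sumR (map (term c ω p) (sublists L))
      ≡⟨ cong₂ _+_ (trans (cong sumR (sym (Listₚ.map-∘ (sublists L)))) (with-f (p f) refl)) (sum-of-terms c ω L p) ⟩
    indep c ω (f ∷ L) p ∎
    where
    open ≡-Reasoning
    p′ : Factor → Bool
    p′ g = p g ∧ not (c f g)
    term-∷ : p f ≡ true → ∀ S → term c ω p (f ∷ S) ≡ ω f * term c ω p′ S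
    term-∷ pf S rewrite pf | admissible-∷ c f S | all-∧ p (not ∘ c f) S
      with all p S | all (not ∘ c f) S | admissible c S
    ... | true  | true  | true  = refl
    ... | true  | true  | false = sym (zeroʳ _)
    ... | true  | false | _     = sym (zeroʳ _)
    ... | false | true  | _     = sym (zeroʳ _)
    ... | false | false | _     = sym (zeroʳ _)
    term-excluded : p f ≡ false → ∀ S → term c ω p (f ∷ S) ≡ 0#
    term-excluded pf S rewrite pf = refl
    with-f : ∀ b → p f ≡ b → sumR (map (term c ω p ∘ (f ∷_)) (sublists L)) ≡ (if b then ω f * indep c ω L p′ else 0#)
    with-f true  pf = trans (cong sumR (Listₚ.map-cong (term-∷ pf) (sublists L)))
      (trans (sumR-scale (ω f) (term c ω p′) (sublists L)) (cong (ω f *_) (sum-of-terms c ω L p′)))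
    with-f false pf = trans (cong sumR (Listₚ.map-cong (term-excluded pf) (sublists L))) (sumR-zero (sublists L))

  -- Agreement is asked only on factors satisfying P, because the comparisons below hold only for
  -- tiles within a given range.
  indep-cong : ∀ {c c′ ω ω′ p p′ L} (P : Factor → Set) →
    (∀ {f g} → P f → P g → c f g ≡ c′ f g) → (∀ {f} → P f → ω f ≡ ω′ f) → (∀ {f} → P f → p f ≡ p′ f) →
    All P L → indep c ω L p ≡ indep c′ ω′ L p′
  indep-cong P c≡ ω≡ p≡ [] = refl
  indep-cong {p = p} P c≡ ω≡ p≡ (_∷_ {x = f} Pf PL) rewrite p≡ Pf | ω≡ Pf
    | indep-cong P c≡ ω≡ (λ Pg → cong₂ (λ s t → s ∧ not t) (p≡ Pg) (c≡ Pf Pg)) PL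
    | indep-cong P c≡ ω≡ p≡ PL = refl

  indep-map : ∀ c ω (φ : Factor → Factor) L p →
    indep c ω (map φ L) p ≡ indep (λ f g → c (φ f) (φ g)) (ω ∘ φ) L (p ∘ φ)
  indep-map c ω φ [] p = refl
  indep-map c ω φ (f ∷ L) p = cong₂ (λ s t → (if p (φ f) then ω (φ f) * s else 0#) + t)
    (indep-map c ω φ L (λ g → p g ∧ not (c (φ f) g))) (indep-map c ω φ L p)

  indep-resp-p : ∀ c ω L {p p′} → (∀ f → p f ≡ p′ f) → indep c ω L p ≡ indep c ω L p′
  indep-resp-p c ω L p≡ = indep-cong {L = L} (λ _ → ⊤) (λ _ _ → refl) (λ _ → refl) (λ {f} _ → p≡ f) (All.universal (λ _ → tt) L)

  -- For a transposition the recursion is unfolded twice; both orders then yield the same four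
  -- choices, since c is symmetric.
  indep-↭ : ∀ {c ω L L′} → (∀ f g → c f g ≡ c g f) → L ↭ L′ → ∀ p → indep c ω L p ≡ indep c ω L′ p
  indep-↭ c-sym Perm.refl p = refl
  indep-↭ {c} {ω} c-sym (prep f L↭L′) p = cong₂ (λ s t → (if p f then ω f * s else 0#) + t)
    (indep-↭ c-sym L↭L′ _) (indep-↭ c-sym L↭L′ p)
  indep-↭ {c} {ω} c-sym (swap {xs = L} {ys = L′} f g L↭L′) p = begin
    (if p f then ω f * ((if p g ∧ not (c f g) then ω g * indep c ω L fg else 0#) + indep c ω L f̂) else 0#)
      + ((if p g then ω g * indep c ω L ĝ else 0#) + indep c ω L p)
      ≡⟨ cong₂ (λ s t → (if p f then ω f * ((if p g ∧ not s then ω g * t else 0#) + indep c ω L f̂) else 0#)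
                        + ((if p g then ω g * indep c ω L ĝ else 0#) + indep c ω L p))
           (c-sym f g) (indep-resp-p c ω L (λ h → trans (Boolₚ.∧-assoc (p h) _ _) (trans (cong (p h ∧_) (Boolₚ.∧-comm (not (c f h)) _)) (sym (Boolₚ.∧-assoc (p h) _ _))))) ⟩
    (if p f then ω f * ((if p g ∧ not (c g f) then ω g * indep c ω L gf else 0#) + indep c ω L f̂) else 0#)
      + ((if p g then ω g * indep c ω L ĝ else 0#) + indep c ω L p)
      ≡⟨ exchange (p f) (p g) (c g f) ⟩
    (if p g then ω g * ((if p f ∧ not (c g f) then ω f * indep c ω L gf else 0#) + indep c ω L ĝ) else 0#)
      + ((if p f then ω f * indep c ω L f̂ else 0#) + indep c ω L p)
      ≡⟨ cong₂ (λ s t → (if p g then ω g * s else 0#) + t)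
           (cong₂ (λ s t → (if p f ∧ not (c g f) then ω f * s else 0#) + t) (indep-↭ c-sym L↭L′ gf) (indep-↭ c-sym L↭L′ ĝ))
           (cong₂ (λ s t → (if p f then ω f * s else 0#) + t) (indep-↭ c-sym L↭L′ f̂) (indep-↭ c-sym L↭L′ p)) ⟩
    _ ∎
    where
    open ≡-Reasoning
    f̂ ĝ fg gf : Factor → Bool
    f̂ h = p h ∧ not (c f h)
    ĝ h = p h ∧ not (c g h)
    fg h = f̂ h ∧ not (c g h)
    gf h = ĝ h ∧ not (c f h)
    exchange : ∀ b b′ d →
      (if b then ω f * ((if b′ ∧ not d then ω g * indep c ω L gf else 0#) + indep c ω L f̂) else 0#)
        + ((if b′ then ω g * indep c ω L ĝ else 0#) + indep c ω L p)
      ≡ (if b′ then ω g * ((if b ∧ not d then ω f * indep c ω L gf else 0#) + indep c ω L ĝ) else 0#)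
        + ((if b then ω f * indep c ω L f̂ else 0#) + indep c ω L p)
    exchange true true true = solve 5 (λ a b s t u → a :* (:0 :+ s) :+ (b :* t :+ u) := b :* (:0 :+ t) :+ (a :* s :+ u)) refl
      (ω f) (ω g) (indep c ω L f̂) (indep c ω L ĝ) (indep c ω L p)
    exchange true true false = solve 6 (λ a b r s t u → a :* (b :* r :+ s) :+ (b :* t :+ u) := b :* (a :* r :+ t) :+ (a :* s :+ u)) refl
      (ω f) (ω g) (indep c ω L gf) (indep c ω L f̂) (indep c ω L ĝ) (indep c ω L p)
    exchange true false d = solve 3 (λ a s u → a :* (:0 :+ s) :+ (:0 :+ u) := :0 :+ (a :* s :+ u)) refl
      (ω f) (indep c ω L f̂) (indep c ω L p)
    exchange false true d = solve 3 (λ b t u → :0 :+ (b :* t :+ u) := b :* (:0 :+ t) :+ (:0 :+ u)) refl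
      (ω g) (indep c ω L ĝ) (indep c ω L p)
    exchange false false d = refl
  indep-↭ c-sym (Perm.trans L↭L′ L′↭L″) p = trans (indep-↭ c-sym L↭L′ p) (indep-↭ c-sym L′↭L″ p)

  evalPoly-cong : ∀ m {f g} z → (∀ k → f k ≡ g k) → evalPoly m f z ≡ evalPoly m g z
  evalPoly-cong zero z f≡g = refl
  evalPoly-cong (suc m) z f≡g = cong₂ (λ s t → s + z * t) (f≡g 0) (evalPoly-cong m z (f≡g ∘ suc))

  evalPoly-+ : ∀ m f g z → evalPoly m (λ k → f k + g k) z ≡ evalPoly m f z + evalPoly m g z
  evalPoly-+ zero f g z = sym (+-identityˡ 0#)
  evalPoly-+ (suc m) f g z = trans (cong (λ t → f 0 + g 0 + z * t) (evalPoly-+ m (f ∘ suc) (g ∘ suc) z))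
    (solve 5 (λ a b z s t → a :+ b :+ z :* (s :+ t) := a :+ z :* s :+ (b :+ z :* t)) refl
      (f 0) (g 0) z (evalPoly m (f ∘ suc) z) (evalPoly m (g ∘ suc) z))

  power : Carrier → ℕ → Carrier
  power z zero = 1#
  power z (suc l) = z * power z l

  evalPoly-monomial : ∀ m l z a → l < m → evalPoly m (λ k → if l ≡ᵇ k then a else 0#) z ≡ power z l * a
  evalPoly-monomial (suc m) zero z a _ = trans
    (cong (λ t → a + z * t) (evalPoly-zero m _ z (λ _ _ → refl)))
    (solve 2 (λ a z → a :+ z :* :0 := :1 :* a) refl a z)
  evalPoly-monomial (suc m) (suc l) z a (s≤s l<m) = trans
    (trans (+-identityˡ _) (cong (z *_) (evalPoly-monomial m l z a l<m)))
    (sym (*-assoc z (power z l) a))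

  -- Each sublist contributes to one coefficient, that of its length, and the bound on the lengths
  -- ensures that none is cut off.
  evalPoly-sum-by-length : ∀ m (adm : List Factor → Bool) (t : List Factor → Carrier) z Ls → All (λ S → length S < m) Ls →
    evalPoly m (λ k → sumR (map t (filterᵇ (λ S → (length S ≡ᵇ k) ∧ adm S) Ls))) z
    ≡ sumR (map (λ S → if adm S then power z (length S) * t S else 0#) Ls)
  evalPoly-sum-by-length m adm t z [] [] = evalPoly-zero m _ z (λ _ _ → refl)
  evalPoly-sum-by-length m adm t z (S ∷ Ls) (S<m ∷ Ls<m) = begin
    evalPoly m (λ k → sumR (map t (filterᵇ (P k) (S ∷ Ls)))) z
      ≡⟨ evalPoly-cong m z split ⟩
    evalPoly m (λ k → (if P k S then t S else 0#) + rest k) z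
      ≡⟨ evalPoly-+ m (λ k → if P k S then t S else 0#) rest z ⟩
    evalPoly m (λ k → if P k S then t S else 0#) z + evalPoly m rest z
      ≡⟨ cong₂ _+_ head (evalPoly-sum-by-length m adm t z Ls Ls<m) ⟩
    _ ∎
    where
    open ≡-Reasoning
    P : ℕ → List Factor → Bool
    P k S = (length S ≡ᵇ k) ∧ adm S
    rest : ℕ → Carrier
    rest k = sumR (map t (filterᵇ (P k) Ls))
    split : ∀ k → sumR (map t (filterᵇ (P k) (S ∷ Ls))) ≡ (if P k S then t S else 0#) + rest k
    split k with P k S
    ... | true  = refl
    ... | false = sym (+-identityˡ _)
    head : evalPoly m (λ k → if P k S then t S else 0#) z ≡ (if adm S then power z (length S) * t S else 0#)
    head with adm S
    ... | true  = trans (evalPoly-cong m z (λ k → cong (λ b → if b then t S else 0#) (Boolₚ.∧-identityʳ (length S ≡ᵇ k))))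
                    (evalPoly-monomial m (length S) z (t S) S<m)
    ... | false = evalPoly-zero m _ z (λ k _ → cong (λ b → if b then t S else 0#) (Boolₚ.∧-zeroʳ (length S ≡ᵇ k)))

  sublists-length : ∀ {A : Set} (L : List A) → All (λ S → length S < suc (length L)) (sublists L)
  sublists-length [] = s≤s z≤n ∷ []
  sublists-length (a ∷ L) = Allₚ.++⁺ (Allₚ.map⁺ (All.map s≤s (sublists-length L)))
    (All.map ℕₚ.m≤n⇒m≤1+n (sublists-length L))

  -- Distributes the sign over the factors, which makes the weight of a product multiplicative.
  signed : (Factor → Carrier) → Factor → Carrier
  signed val (big i) = - val (big i)
  signed val (small i) = val (small i)

  prodR-signed : ∀ z val S → power z (length S) * (sign (bigCount S) * prodR (map val S)) ≡ prodR (map (λ f → z * signed val f) S)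
  prodR-signed z val [] = solve 0 (:1 :* (:1 :* :1) := :1) refl
  prodR-signed z val (big i ∷ S) = trans
    (solve 5 (λ z w s a b → z :* w :* ((:- s) :* (a :* b)) := z :* (:- a) :* (w :* (s :* b))) refl
      z (power z (length S)) (sign (bigCount S)) (val (big i)) (prodR (map val S)))
    (cong (z * - val (big i) *_) (prodR-signed z val S))
  prodR-signed z val (small i ∷ S) = trans
    (solve 5 (λ z w s a b → z :* w :* (s :* (a :* b)) := z :* a :* (w :* (s :* b))) refl
      z (power z (length S)) (sign (bigCount S)) (val (small i)) (prodR (map val S)))
    (cong (z * val (small i) *_) (prodR-signed z val S))

  generating-function : ∀ c val n x y z →
    evalPoly (suc (length (factors n))) (λ k → poly c val n k x y) z
    ≡ indep (c n) (λ f → z * signed (val n x y) f) (factors n) (λ _ → true)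
  generating-function c val n x y z = begin
    _ ≡⟨ evalPoly-sum-by-length (suc (length (factors n))) (admissible (c n))
           (λ S → sign (bigCount S) * prodR (map (val n x y) S)) z (sublists (factors n)) (sublists-length (factors n)) ⟩
    _ ≡⟨ cong sumR (Listₚ.map-cong pointwise (sublists (factors n))) ⟩
    _ ≡⟨ sum-of-terms (c n) (λ f → z * signed (val n x y) f) (factors n) (λ _ → true) ⟩
    _ ∎
    where
    open ≡-Reasoning
    all-true : ∀ (S : List Factor) → all (λ _ → true) S ≡ true
    all-true [] = refl
    all-true (_ ∷ S) = all-true S
    pointwise : ∀ S → (if admissible (c n) S then power z (length S) * (sign (bigCount S) * prodR (map (val n x y) S)) else 0#)
                      ≡ term (c n) (λ f → z * signed (val n x y) f) (λ _ → true) S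
    pointwise S rewrite all-true S with admissible (c n) S
    ... | true  = prodR-signed z (val n x y) S
    ... | false = refl

≡ᵇ-refl : ∀ m → (m ≡ᵇ m) ≡ true
≡ᵇ-refl zero    = refl
≡ᵇ-refl (suc m) = ≡ᵇ-refl m

≡ᵇ-comm : ∀ m n → (m ≡ᵇ n) ≡ (n ≡ᵇ m)
≡ᵇ-comm zero    zero    = refl
≡ᵇ-comm zero    (suc n) = refl
≡ᵇ-comm (suc m) zero    = refl
≡ᵇ-comm (suc m) (suc n) = ≡ᵇ-comm m n

<⇒≡ᵇ-false : ∀ {m n} → m < n → (m ≡ᵇ n) ≡ false
<⇒≡ᵇ-false {zero}  {suc n} _ = refl
<⇒≡ᵇ-false {suc m} {suc n} (s≤s p) = <⇒≡ᵇ-false p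

>⇒≡ᵇ-false : ∀ {m n} → n < m → (m ≡ᵇ n) ≡ false
>⇒≡ᵇ-false {m} {n} p = trans (≡ᵇ-comm m n) (<⇒≡ᵇ-false p)

∨-true₃ : ∀ a b → a ∨ b ∨ true ≡ true
∨-true₃ a b = trans (cong (a ∨_) (Boolₚ.∨-zeroʳ b)) (Boolₚ.∨-zeroʳ a)

∨-true₄ : ∀ a b c → a ∨ b ∨ c ∨ true ≡ true
∨-true₄ a b c = trans (cong (a ∨_) (∨-true₃ b c)) (Boolₚ.∨-zeroʳ a)

≤-offset : ∀ {m n} → m ≤ n → ∃ λ k → n ≡ k ℕ.+ m
≤-offset {m} {n} p = n ℕ.∸ m , sym (ℕₚ.m∸n+n≡m p)

-- Tilings of a cycle and the trace of the recursion.

module CyclicTilings (R : RealField) where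
  open RealFieldProperties R
  open ℤ-Solver using (solve; _:=_; _:+_; _:*_)
  open Geometry R
  open TransferMatrices R
  open IndependencePolynomial R

  sucₙ-< : ∀ {n i} → suc i < n → sucₙ n i ≡ suc i
  sucₙ-< p rewrite <⇒≡ᵇ-false p = refl

  -- small i and big i are tiles covering the cells i, i+1 and i, i+1, i+2 of ℤ/n;
  -- two tiles are consecutive iff they overlap.
  start end : Factor → ℕ
  start (big i)   = i
  start (small i) = i
  end (big i)   = 3 ℕ.+ i
  end (small i) = 2 ℕ.+ i

  2+start≤end : ∀ f → 2 ℕ.+ start f ≤ end f
  2+start≤end (big i)   = ℕₚ.n≤1+n _
  2+start≤end (small i) = ℕₚ.≤-refl

  consO-symmetric : ∀ n f g → consO n f g ≡ consO n g f
  consO-symmetric n (big i) (big j) rewrite ≡ᵇ-comm i j =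
    cong ((j ≡ᵇ i) ∨_) (rearrange (j ≡ᵇ sucₙ n i) (j ≡ᵇ sucₙ n (sucₙ n i)) (i ≡ᵇ sucₙ n j) (i ≡ᵇ sucₙ n (sucₙ n j)))
    where
    rearrange : ∀ a b c d → a ∨ b ∨ c ∨ d ≡ c ∨ d ∨ a ∨ b
    rearrange a b c d = trans (sym (Boolₚ.∨-assoc a b (c ∨ d))) (trans (Boolₚ.∨-comm (a ∨ b) (c ∨ d)) (Boolₚ.∨-assoc c d (a ∨ b)))
  consO-symmetric n (big i) (small j) = refl
  consO-symmetric n (small i) (big j) = refl
  consO-symmetric n (small i) (small j) rewrite ≡ᵇ-comm i j =
    cong ((j ≡ᵇ i) ∨_) (Boolₚ.∨-comm (j ≡ᵇ sucₙ n i) (i ≡ᵇ sucₙ n j))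

  module _ {n : ℕ} where
    private
      suc₁ : ∀ {i} → 2 ℕ.+ i ≤ n → sucₙ n i ≡ suc i
      suc₁ = sucₙ-<

      suc₂ : ∀ {i} → 3 ℕ.+ i ≤ n → sucₙ n (sucₙ n i) ≡ suc (suc i)
      suc₂ {i} p = trans (cong (sucₙ n) (sucₙ-< (ℕₚ.<⇒≤ p))) (sucₙ-< p)

    -- As both ends are at most n, the successors needed do not wrap around, and the offset of the
    -- starts is less than the length of g, which leaves at most three cases.
    overlapping : ∀ f g → end f ≤ n → end g ≤ n → start g ≤ start f → start f < end g → consO n g f ≡ true
    overlapping (big i) (big j) fn gn p q with ≤-offset p
    ... | 0 , refl rewrite ≡ᵇ-refl j = refl
    ... | 1 , refl rewrite suc₁ (ℕₚ.<⇒≤ gn) | ≡ᵇ-refl j = Boolₚ.∨-zeroʳ _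
    ... | 2 , refl rewrite suc₂ gn | ≡ᵇ-refl j = ∨-true₃ (2 ℕ.+ j ≡ᵇ j) (2 ℕ.+ j ≡ᵇ sucₙ n j)
    ... | suc (suc (suc k)) , refl = ⊥-elim (ℕₚ.<⇒≱ q (s≤s (s≤s (s≤s (ℕₚ.m≤n+m j k)))))
    overlapping (small i) (big j) fn gn p q with ≤-offset p
    ... | 0 , refl rewrite ≡ᵇ-refl j = Boolₚ.∨-zeroʳ _
    ... | 1 , refl rewrite suc₁ (ℕₚ.<⇒≤ gn) | ≡ᵇ-refl j = ∨-true₃ (j ≡ᵇ sucₙ n (1 ℕ.+ j)) (1 ℕ.+ j ≡ᵇ j)
    ... | 2 , refl rewrite suc₂ gn | ≡ᵇ-refl j =
      ∨-true₄ (j ≡ᵇ sucₙ n (2 ℕ.+ j)) (2 ℕ.+ j ≡ᵇ j) (2 ℕ.+ j ≡ᵇ sucₙ n j)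
    ... | suc (suc (suc k)) , refl = ⊥-elim (ℕₚ.<⇒≱ q (s≤s (s≤s (s≤s (ℕₚ.m≤n+m j k)))))
    overlapping (big i) (small j) fn gn p q with ≤-offset p
    ... | 0 , refl rewrite ≡ᵇ-refl j = Boolₚ.∨-zeroʳ _
    ... | 1 , refl rewrite suc₁ gn | ≡ᵇ-refl j = refl
    ... | suc (suc k) , refl = ⊥-elim (ℕₚ.<⇒≱ q (s≤s (s≤s (ℕₚ.m≤n+m j k))))
    overlapping (small i) (small j) fn gn p q with ≤-offset p
    ... | 0 , refl rewrite ≡ᵇ-refl j = refl
    ... | 1 , refl rewrite suc₁ gn | ≡ᵇ-refl j = Boolₚ.∨-zeroʳ _
    ... | suc (suc k) , refl = ⊥-elim (ℕₚ.<⇒≱ q (s≤s (s≤s (ℕₚ.m≤n+m j k))))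

    disjoint : ∀ f g → end g ≤ start f → end f ≤ n → consO n f g ≡ false
    disjoint (big i) (big j) p q
      rewrite suc₁ (ℕₚ.<⇒≤ q) | suc₁ {suc i} q
            | suc₁ {j} (ℕₚ.≤-trans (ℕₚ.<⇒≤ p) (ℕₚ.≤-trans (ℕₚ.m≤n+m i 3) q))
            | suc₁ {suc j} (ℕₚ.≤-trans p (ℕₚ.≤-trans (ℕₚ.m≤n+m i 3) q))
            | <⇒≡ᵇ-false {j} {i} (ℕₚ.<⇒≤ (ℕₚ.<⇒≤ p))
            | <⇒≡ᵇ-false {j} {1 ℕ.+ i} (ℕₚ.m≤n⇒m≤1+n (ℕₚ.<⇒≤ (ℕₚ.<⇒≤ p)))
            | <⇒≡ᵇ-false {j} {2 ℕ.+ i} (ℕₚ.m≤n⇒m≤1+n (ℕₚ.m≤n⇒m≤1+n (ℕₚ.<⇒≤ (ℕₚ.<⇒≤ p))))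
            | >⇒≡ᵇ-false {i} {1 ℕ.+ j} (ℕₚ.<⇒≤ p)
            | >⇒≡ᵇ-false {i} {2 ℕ.+ j} p = refl
    disjoint (big i) (small j) p q
      rewrite suc₁ (ℕₚ.<⇒≤ q) | suc₁ {suc i} q
            | suc₁ {j} (ℕₚ.≤-trans p (ℕₚ.≤-trans (ℕₚ.m≤n+m i 3) q))
            | <⇒≡ᵇ-false {j} {i} (ℕₚ.<⇒≤ p)
            | <⇒≡ᵇ-false {j} {1 ℕ.+ i} (ℕₚ.m≤n⇒m≤1+n (ℕₚ.<⇒≤ p))
            | <⇒≡ᵇ-false {j} {2 ℕ.+ i} (ℕₚ.m≤n⇒m≤1+n (ℕₚ.m≤n⇒m≤1+n (ℕₚ.<⇒≤ p)))
            | >⇒≡ᵇ-false {i} {1 ℕ.+ j} p = refl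
    disjoint (small i) (big j) p q
      rewrite suc₁ q
            | suc₁ {j} (ℕₚ.≤-trans (ℕₚ.<⇒≤ p) (ℕₚ.≤-trans (ℕₚ.m≤n+m i 2) q))
            | suc₁ {suc j} (ℕₚ.≤-trans p (ℕₚ.≤-trans (ℕₚ.m≤n+m i 2) q))
            | <⇒≡ᵇ-false {j} {1 ℕ.+ i} (ℕₚ.m≤n⇒m≤1+n (ℕₚ.<⇒≤ (ℕₚ.<⇒≤ p)))
            | >⇒≡ᵇ-false {i} {j} (ℕₚ.<⇒≤ (ℕₚ.<⇒≤ p))
            | >⇒≡ᵇ-false {i} {1 ℕ.+ j} (ℕₚ.<⇒≤ p)
            | >⇒≡ᵇ-false {i} {2 ℕ.+ j} p = refl
    disjoint (small i) (small j) p q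
      rewrite suc₁ q
            | suc₁ {j} (ℕₚ.≤-trans p (ℕₚ.≤-trans (ℕₚ.m≤n+m i 2) q))
            | <⇒≡ᵇ-false {j} {i} (ℕₚ.<⇒≤ p)
            | <⇒≡ᵇ-false {j} {1 ℕ.+ i} (ℕₚ.m≤n⇒m≤1+n (ℕₚ.<⇒≤ p))
            | >⇒≡ᵇ-false {i} {1 ℕ.+ j} p = refl

  -- The tiles within the cells 0, ..., k - 1, by decreasing end, so that `indep` decides the last
  -- cell first.
  tiles : ℕ → List Factor
  tiles 0 = []
  tiles 1 = []
  tiles 2 = small 0 ∷ []
  tiles (suc (suc (suc m))) = big m ∷ small (suc m) ∷ tiles (suc (suc m))

  tiles-end : ∀ k → All (λ f → end f ≤ k) (tiles k)
  tiles-end 0 = []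
  tiles-end 1 = []
  tiles-end 2 = ℕₚ.≤-refl ∷ []
  tiles-end (suc (suc (suc m))) = ℕₚ.≤-refl ∷ ℕₚ.≤-refl ∷ All.map ℕₚ.m≤n⇒m≤1+n (tiles-end (suc (suc m)))

  module _ {c : Factor → Factor → Bool} {ω : Factor → Carrier} where
    skip : ∀ f L p → p f ≡ false → indep c ω (f ∷ L) p ≡ indep c ω L p
    skip f L p pf rewrite pf = +-identityˡ _

    truncate : ∀ k p → (∀ f → end f ≡ suc k → p f ≡ false) → indep c ω (tiles (suc k)) p ≡ indep c ω (tiles k) p
    truncate 0 p excluded = refl
    truncate 1 p excluded = skip (small 0) [] p (excluded (small 0) refl)
    truncate (suc (suc m)) p excluded =
      trans (skip (big m) (small (suc m) ∷ tiles (suc (suc m))) p (excluded (big m) refl))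
        (skip (small (suc m)) (tiles (suc (suc m))) p (excluded (small (suc m)) refl))

    tiles-cong : ∀ k {p p′} → (∀ f → end f ≤ k → p f ≡ p′ f) → indep c ω (tiles k) p ≡ indep c ω (tiles k) p′
    tiles-cong k p≡ = indep-cong {L = tiles k} (λ f → end f ≤ k) (λ _ _ → refl) (λ _ → refl) (λ {f} → p≡ f) (tiles-end k)

  ∧-false : ∀ b {b′} → b′ ≡ true → b ∧ not b′ ≡ false
  ∧-false b refl = Boolₚ.∧-zeroʳ b

  ∧-true : ∀ b {b′} → b′ ≡ false → b ∧ not b′ ≡ b
  ∧-true b refl = Boolₚ.∧-identityʳ b

  module LinearTilings (n : ℕ) (ω : Factor → Carrier) where
    private
      I : List Factor → (Factor → Bool) → Carrier
      I = indep (consO n) ω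

    -- The chosen tile covers the cells m + 1 and m + 2: it excludes the tiles with end m + 2 and
    -- misses those with smaller end.
    after-small : ∀ m p → 3 ℕ.+ m ≤ n →
      I (tiles (2 ℕ.+ m)) (λ g → p g ∧ not (consO n (small (suc m)) g)) ≡ I (tiles (1 ℕ.+ m)) p
    after-small m p m<n = trans
      (truncate (suc m) _ (λ g e → ∧-false (p g) (trans (consO-symmetric n (small (suc m)) g)
        (overlapping (small (suc m)) g m<n (subst (_≤ n) (sym e) (ℕₚ.<⇒≤ m<n))
          (ℕₚ.≤-trans (s≤s⁻¹ (s≤s⁻¹ (subst (2 ℕ.+ start g ≤_) e (2+start≤end g)))) (ℕₚ.n≤1+n m))
          (subst (suc m <_) (sym e) ℕₚ.≤-refl)))))
      (tiles-cong (suc m) (λ g e → ∧-true (p g) (disjoint (small (suc m)) g e m<n)))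

    -- The third covered cell excludes the tiles with end m + 1 as well; the other tile with end m +
    -- 3 is still in the list and has to be skipped.
    after-big : ∀ m p → 3 ℕ.+ m ≤ n →
      I (small (suc m) ∷ tiles (2 ℕ.+ m)) (λ g → p g ∧ not (consO n (big m) g)) ≡ I (tiles m) p
    after-big m p m<n = trans
      (skip (small (suc m)) (tiles (2 ℕ.+ m)) _ (∧-false (p (small (suc m)))
        (overlapping (small (suc m)) (big m) m<n m<n (ℕₚ.n≤1+n m) (s≤s (ℕₚ.n≤1+n _)))))
      (trans (truncate (suc m) _ (λ g e → excluded g
          (subst (_≤ n) (sym e) (ℕₚ.<⇒≤ m<n))
          (s≤s⁻¹ (s≤s⁻¹ (subst (2 ℕ.+ start g ≤_) e (2+start≤end g))))
          (subst (m <_) (sym e) (ℕₚ.n≤1+n _))))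
        (trans (truncate m _ (λ g e → excluded g
            (subst (_≤ n) (sym e) (ℕₚ.<⇒≤ (ℕₚ.<⇒≤ m<n)))
            (ℕₚ.<⇒≤ (s≤s⁻¹ (subst (2 ℕ.+ start g ≤_) e (2+start≤end g))))
            (subst (m <_) (sym e) ℕₚ.≤-refl)))
          (tiles-cong m (λ g e → ∧-true (p g) (disjoint (big m) g e m<n)))))
      where
      excluded : ∀ g → end g ≤ n → start g ≤ m → m < end g → p g ∧ not (consO n (big m) g) ≡ false
      excluded g gn q r = ∧-false (p g) (trans (consO-symmetric n (big m) g) (overlapping (big m) g m<n gn q r))

    -- The last cell is left free or is covered by a tile of length 2 or 3.
    tiles-recursion : ∀ m p → 3 ℕ.+ m ≤ n → p (big m) ≡ true → p (small (suc m)) ≡ true →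
      I (tiles (3 ℕ.+ m)) p ≡
      I (tiles (2 ℕ.+ m)) p + ω (small (suc m)) * I (tiles (1 ℕ.+ m)) p + ω (big m) * I (tiles m) p
    tiles-recursion m p m<n pb ps = begin
      I (tiles (3 ℕ.+ m)) p
        ≡⟨ cong₂ (λ b b′ → (if b then ω (big m) * I (small (suc m) ∷ tiles (2 ℕ.+ m)) (λ g → p g ∧ not (consO n (big m) g)) else 0#)
                  + ((if b′ then ω (small (suc m)) * I (tiles (2 ℕ.+ m)) (λ g → p g ∧ not (consO n (small (suc m)) g)) else 0#) + I (tiles (2 ℕ.+ m)) p)) pb ps ⟩
      ω (big m) * I (small (suc m) ∷ tiles (2 ℕ.+ m)) _ + (ω (small (suc m)) * I (tiles (2 ℕ.+ m)) _ + I (tiles (2 ℕ.+ m)) p)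
        ≡⟨ cong₂ (λ s t → ω (big m) * s + (ω (small (suc m)) * t + I (tiles (2 ℕ.+ m)) p)) (after-big m p m<n) (after-small m p m<n) ⟩
      ω (big m) * I (tiles m) p + (ω (small (suc m)) * I (tiles (1 ℕ.+ m)) p + I (tiles (2 ℕ.+ m)) p)
        ≡⟨ solve 3 (λ s t u → s :+ (t :+ u) := u :+ t :+ s) refl
             (ω (big m) * I (tiles m) p) (ω (small (suc m)) * I (tiles (1 ℕ.+ m)) p) (I (tiles (2 ℕ.+ m)) p) ⟩
      _ ∎
      where open ≡-Reasoning

  from : ℕ → Factor → Bool
  from r f = r ≤ᵇ start f

  ≤⇒≤ᵇ-true : ∀ {m n} → m ≤ n → (m ≤ᵇ n) ≡ true
  ≤⇒≤ᵇ-true {m} {n} p with m ≤ᵇ n | ℕₚ.≤⇒≤ᵇ p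
  ... | true | _ = refl

  run-snoc : ∀ A B i m s → run A B i (suc m) s ≡ step A B (m ℕ.+ i) (run A B i m s)
  run-snoc A B i zero s = refl
  run-snoc A B i (suc m) s = trans (run-snoc A B (suc i) m (step A B i s))
    (cong (λ k → step A B k (run A B (suc i) m (step A B i s))) (ℕₚ.+-suc m i))

  -- The weights A j and B j of the recursion belong to the tiles ending in the
  -- cell j, so that A 0, B 0 and B 1 belong to the tiles across the cut of the cycle.
  module _ (N : ℕ) (ω : Factor → Carrier) (A B : Weight)
           (A-small : ∀ j → 2 ℕ.+ j ≤ 5 ℕ.+ N → A (1 ℕ.+ j) ≡ ω (small j))
           (B-big : ∀ j → 3 ℕ.+ j ≤ 5 ℕ.+ N → B (2 ℕ.+ j) ≡ ω (big j))
           (A-wrap : A 0 ≡ ω (small (4 ℕ.+ N))) (B-wrap₀ : B 0 ≡ ω (big (3 ℕ.+ N))) (B-wrap₁ : B 1 ≡ ω (big (4 ℕ.+ N))) where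
    private
      n = 5 ℕ.+ N
      I : List Factor → (Factor → Bool) → Carrier
      I = indep (consO n) ω
    open LinearTilings n ω

    path : ℕ → ℕ → Carrier
    path r m = π₁ (run A B r m e₁)

    private
      run-state : ∀ r m → run A B r (2 ℕ.+ m) e₁ ≡ (path r (2 ℕ.+ m) , path r (1 ℕ.+ m) , path r m)
      run-state r m = begin
        run A B r (2 ℕ.+ m) e₁ ≡⟨ run-snoc A B r (suc m) e₁ ⟩
        (π₁ (step A B (suc m ℕ.+ r) (run A B r (suc m) e₁)) , path r (suc m) , π₂ (run A B r (suc m) e₁))
          ≡⟨ cong₂ (λ s t → π₁ s , path r (suc m) , π₂ t) (sym (run-snoc A B r (suc m) e₁)) (run-snoc A B r m e₁) ⟩
        _ ∎
        where open ≡-Reasoning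

      path-recursion : ∀ r m → path r (3 ℕ.+ m) ≡
        path r (2 ℕ.+ m) + A (2 ℕ.+ (m ℕ.+ r)) * path r (1 ℕ.+ m) + B (2 ℕ.+ (m ℕ.+ r)) * path r m
      path-recursion r m = trans (cong π₁ (run-snoc A B r (2 ℕ.+ m) e₁))
        (cong (λ s → π₁ (step A B (2 ℕ.+ (m ℕ.+ r)) s)) (run-state r m))

      path-1 : ∀ r → path r 1 ≡ 1#
      path-1 r = solve 2 (λ a b → :1 :+ a :* :0 :+ b :* :0 := :1) refl (A r) (B r)

      path-2 : ∀ r → 2 ℕ.+ r ≤ n → path r 2 ≡ 1# + ω (small r)
      path-2 r p = trans (solve 4 (λ a b a′ b′ → :1 :+ a :* :0 :+ b :* :0 :+ a′ :* :1 :+ b′ :* :0 := :1 :+ a′) refl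
        (A r) (B r) (A (suc r)) (B (suc r))) (cong (1# +_) (A-small r p))

    -- Started with the values 1, 0, 0, the recursion sums over the tilings of the cells r, ..., r +
    -- m - 1. A tile across the cut covers at most two cells beyond it, whence r ≤ 2; the recursion
    -- reaches back three steps, whence the base cases m = 0, 1, 2.
    path-tilings : ∀ r → r ≤ 2 → ∀ m → m ℕ.+ r ≤ n → path r m ≡ I (tiles (m ℕ.+ r)) (from r)
    path-tilings 0 _ 0 _ = refl
    path-tilings 1 _ 0 _ = refl
    path-tilings 2 _ 0 _ = sym (+-identityˡ 1#)
    path-tilings 0 _ 1 _ = path-1 0
    path-tilings 1 _ 1 _ = trans (path-1 1) (sym (+-identityˡ 1#))
    path-tilings 2 _ 1 _ = trans (path-1 2) (solve 0 (:1 := :0 :+ (:0 :+ (:0 :+ :1))) refl)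
    path-tilings 0 _ 2 p = trans (path-2 0 p) (solve 1 (λ s → :1 :+ s := s :* :1 :+ :1) refl (ω (small 0)))
    path-tilings 1 _ 2 p = trans (path-2 1 p)
      (solve 1 (λ s → :1 :+ s := :0 :+ (s :* (:0 :+ :1) :+ (:0 :+ :1))) refl (ω (small 1)))
    path-tilings 2 _ 2 p = trans (path-2 2 p)
      (solve 1 (λ s → :1 :+ s := :0 :+ (s :* (:0 :+ (:0 :+ (:0 :+ :1))) :+ (:0 :+ (:0 :+ (:0 :+ :1))))) refl (ω (small 2)))
    path-tilings (suc (suc (suc r))) (s≤s (s≤s ())) _ _
    path-tilings r r≤2 (suc (suc (suc m))) p = begin
      path r (3 ℕ.+ m)
        ≡⟨ path-recursion r m ⟩
      path r (2 ℕ.+ m) + A (2 ℕ.+ (m ℕ.+ r)) * path r (1 ℕ.+ m) + B (2 ℕ.+ (m ℕ.+ r)) * path r m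
        ≡⟨ cong₂ (λ a b → path r (2 ℕ.+ m) + a * path r (1 ℕ.+ m) + b * path r m) (A-small (1 ℕ.+ (m ℕ.+ r)) p) (B-big (m ℕ.+ r) p) ⟩
      path r (2 ℕ.+ m) + ω (small (1 ℕ.+ (m ℕ.+ r))) * path r (1 ℕ.+ m) + ω (big (m ℕ.+ r)) * path r m
        ≡⟨ cong₂ (λ s t → s + ω (small (1 ℕ.+ (m ℕ.+ r))) * t + ω (big (m ℕ.+ r)) * path r m)
             (path-tilings r r≤2 (suc (suc m)) (ℕₚ.<⇒≤ p)) (path-tilings r r≤2 (suc m) (ℕₚ.<⇒≤ (ℕₚ.<⇒≤ p))) ⟩
      I (tiles (2 ℕ.+ (m ℕ.+ r))) (from r) + ω (small (1 ℕ.+ (m ℕ.+ r))) * I (tiles (1 ℕ.+ (m ℕ.+ r))) (from r) + ω (big (m ℕ.+ r)) * path r m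
        ≡⟨ cong (λ t → I (tiles (2 ℕ.+ (m ℕ.+ r))) (from r) + ω (small (1 ℕ.+ (m ℕ.+ r))) * I (tiles (1 ℕ.+ (m ℕ.+ r))) (from r) + ω (big (m ℕ.+ r)) * t)
             (path-tilings r r≤2 m (ℕₚ.<⇒≤ (ℕₚ.<⇒≤ (ℕₚ.<⇒≤ p)))) ⟩
      _ ≡⟨ tiles-recursion (m ℕ.+ r) (from r) p (≤⇒≤ᵇ-true (ℕₚ.m≤n+m r m)) (≤⇒≤ᵇ-true (ℕₚ.m≤n⇒m≤1+n (ℕₚ.m≤n+m r m))) ⟨
      I (tiles (3 ℕ.+ (m ℕ.+ r))) (from r) ∎
      where open ≡-Reasoning

    private
      -- The tiles across the cut between the cells n - 1 and 0. Any two of them overlap, so at most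
      -- one is used.
      w₁ w₂ w₃ : Factor
      w₁ = small (4 ℕ.+ N)
      w₂ = big (4 ℕ.+ N)
      w₃ = big (3 ℕ.+ N)

      suc-last : sucₙ n (4 ℕ.+ N) ≡ 0
      suc-last rewrite ≡ᵇ-refl N = refl

      suc-3+N : sucₙ n (3 ℕ.+ N) ≡ 4 ℕ.+ N
      suc-3+N = sucₙ-< {n} {3 ℕ.+ N} ℕₚ.≤-refl

      suc₁ : ∀ {i} → 2 ℕ.+ i ≤ n → sucₙ n i ≡ suc i
      suc₁ = sucₙ-<

      first-cell : ∀ j → not (j ≡ᵇ 0) ≡ (1 ≤ᵇ j)
      first-cell zero = refl
      first-cell (suc j) = refl

      first-two-cells : ∀ j → not ((j ≡ᵇ 0) ∨ (j ≡ᵇ 1)) ≡ (2 ≤ᵇ j)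
      first-two-cells zero = refl
      first-two-cells (suc zero) = refl
      first-two-cells (suc (suc j)) = refl

    -- Every tile across the cut covers the cell n - 1; `w₃` covers n - 2 too, which calls for
    -- `wrap₃-end′`.
    wrap₁-end : ∀ g → end g ≡ n → consO n w₁ g ≡ true
    wrap₁-end (big .(2 ℕ.+ N)) refl
      rewrite suc-last | suc₁ {2 ℕ.+ N} (ℕₚ.n≤1+n _) | suc-3+N | ≡ᵇ-refl N = ∨-true₃ (2 ℕ.+ N ≡ᵇ N) (1 ℕ.+ N ≡ᵇ N)
    wrap₁-end (small .(3 ℕ.+ N)) refl
      rewrite suc-last | suc-3+N | ≡ᵇ-refl N = Boolₚ.∨-zeroʳ (N ≡ᵇ 1 ℕ.+ N)

    wrap₂-end : ∀ g → end g ≡ n → consO n w₂ g ≡ true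
    wrap₂-end (big .(2 ℕ.+ N)) refl
      rewrite suc-last | suc₁ {2 ℕ.+ N} (ℕₚ.n≤1+n _) | suc-3+N | ≡ᵇ-refl N = ∨-true₃ (N ≡ᵇ 2 ℕ.+ N) (1 ℕ.+ N ≡ᵇ N)
    wrap₂-end (small .(3 ℕ.+ N)) refl rewrite suc-3+N | ≡ᵇ-refl N = refl

    wrap₃-end : ∀ g → end g ≡ n → consO n w₃ g ≡ true
    wrap₃-end (big .(2 ℕ.+ N)) refl
      rewrite suc-3+N | suc-last | suc₁ {2 ℕ.+ N} (ℕₚ.n≤1+n _) | ≡ᵇ-refl N = ∨-true₃ (N ≡ᵇ 1 ℕ.+ N) (N ≡ᵇ 2 ℕ.+ N)
    wrap₃-end (small .(3 ℕ.+ N)) refl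
      rewrite suc-3+N | ≡ᵇ-refl N = Boolₚ.∨-zeroʳ _

    wrap₃-end′ : ∀ g → end g ≡ 4 ℕ.+ N → consO n w₃ g ≡ true
    wrap₃-end′ (big .(1 ℕ.+ N)) refl
      rewrite suc-3+N | suc-last | suc₁ {1 ℕ.+ N} (ℕₚ.m≤n+m _ 2) | suc₁ {2 ℕ.+ N} (ℕₚ.n≤1+n _) | ≡ᵇ-refl N =
        ∨-true₄ (N ≡ᵇ 2 ℕ.+ N) (N ≡ᵇ 3 ℕ.+ N) (1 ℕ.+ N ≡ᵇ N)
    wrap₃-end′ (small .(2 ℕ.+ N)) refl rewrite suc₁ {2 ℕ.+ N} (ℕₚ.n≤1+n _) | ≡ᵇ-refl N = refl

    -- Beyond the cut `w₁` and `w₃` cover the cell 0, and `w₂` covers the cells 0 and 1.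
    wrap₁-start : ∀ g → end g ≤ 4 ℕ.+ N → not (consO n w₁ g) ≡ from 1 g
    wrap₁-start (big j) p
      rewrite suc-last | suc₁ {j} (ℕₚ.m≤n⇒m≤1+n (ℕₚ.<⇒≤ p)) | suc₁ {1 ℕ.+ j} (ℕₚ.m≤n⇒m≤1+n p)
            | >⇒≡ᵇ-false {4 ℕ.+ N} {j} (ℕₚ.<⇒≤ (ℕₚ.<⇒≤ p)) | >⇒≡ᵇ-false {4 ℕ.+ N} {1 ℕ.+ j} (ℕₚ.<⇒≤ p)
            | >⇒≡ᵇ-false {4 ℕ.+ N} {2 ℕ.+ j} p | Boolₚ.∨-identityʳ (j ≡ᵇ 0) = first-cell j
    wrap₁-start (small j) p
      rewrite suc-last | suc₁ {j} (ℕₚ.m≤n⇒m≤1+n p) | <⇒≡ᵇ-false {j} {4 ℕ.+ N} (ℕₚ.<⇒≤ p)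
            | >⇒≡ᵇ-false {4 ℕ.+ N} {1 ℕ.+ j} p | Boolₚ.∨-identityʳ (j ≡ᵇ 0) = first-cell j

    wrap₂-start : ∀ g → end g ≤ 4 ℕ.+ N → not (consO n w₂ g) ≡ from 2 g
    wrap₂-start (big j) p
      rewrite suc-last | suc₁ {j} (ℕₚ.m≤n⇒m≤1+n (ℕₚ.<⇒≤ p)) | suc₁ {1 ℕ.+ j} (ℕₚ.m≤n⇒m≤1+n p)
            | <⇒≡ᵇ-false {j} {4 ℕ.+ N} (ℕₚ.<⇒≤ (ℕₚ.<⇒≤ p)) | >⇒≡ᵇ-false {4 ℕ.+ N} {1 ℕ.+ j} (ℕₚ.<⇒≤ p)
            | >⇒≡ᵇ-false {4 ℕ.+ N} {2 ℕ.+ j} p | Boolₚ.∨-identityʳ (j ≡ᵇ 1) = first-two-cells j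
    wrap₂-start (small j) p
      rewrite suc-last | suc₁ {j} (ℕₚ.m≤n⇒m≤1+n p) | <⇒≡ᵇ-false {j} {4 ℕ.+ N} (ℕₚ.<⇒≤ p)
            | >⇒≡ᵇ-false {4 ℕ.+ N} {1 ℕ.+ j} p = first-two-cells j

    wrap₃-start : ∀ g → end g ≤ 3 ℕ.+ N → not (consO n w₃ g) ≡ from 1 g
    wrap₃-start (big j) p
      rewrite suc-3+N | suc-last | suc₁ {j} (ℕₚ.m≤n⇒m≤1+n (ℕₚ.m≤n⇒m≤1+n (ℕₚ.<⇒≤ p))) | suc₁ {1 ℕ.+ j} (ℕₚ.m≤n⇒m≤1+n (ℕₚ.m≤n⇒m≤1+n p))
            | <⇒≡ᵇ-false {j} {3 ℕ.+ N} (ℕₚ.<⇒≤ (ℕₚ.<⇒≤ p)) | <⇒≡ᵇ-false {j} {4 ℕ.+ N} (ℕₚ.m≤n⇒m≤1+n (ℕₚ.<⇒≤ (ℕₚ.<⇒≤ p)))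
            | >⇒≡ᵇ-false {3 ℕ.+ N} {1 ℕ.+ j} (ℕₚ.<⇒≤ p) | >⇒≡ᵇ-false {3 ℕ.+ N} {2 ℕ.+ j} p | Boolₚ.∨-identityʳ (j ≡ᵇ 0) = first-cell j
    wrap₃-start (small j) p
      rewrite suc-3+N | suc-last | suc₁ {j} (ℕₚ.m≤n⇒m≤1+n (ℕₚ.m≤n⇒m≤1+n p)) | <⇒≡ᵇ-false {j} {3 ℕ.+ N} (ℕₚ.<⇒≤ p)
            | <⇒≡ᵇ-false {j} {4 ℕ.+ N} (ℕₚ.m≤n⇒m≤1+n (ℕₚ.<⇒≤ p)) | >⇒≡ᵇ-false {3 ℕ.+ N} {1 ℕ.+ j} p = first-cell j

    wrap₁₂ : consO n w₁ w₂ ≡ true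
    wrap₁₂ rewrite ≡ᵇ-refl N = refl

    wrap₁₃ : consO n w₁ w₃ ≡ true
    wrap₁₃ rewrite suc-last | suc-3+N | ≡ᵇ-refl N = Boolₚ.∨-zeroʳ _

    wrap₂₃ : consO n w₂ w₃ ≡ true
    wrap₂₃ rewrite suc-last | suc-3+N | ≡ᵇ-refl N = Boolₚ.∨-zeroʳ _

    -- Sorted by the tile across the cut, if there is one: removing it opens the cycle to a path of
    -- n - 2 or n - 3 cells.
    cyclic-tilings : I (w₁ ∷ w₂ ∷ w₃ ∷ tiles n) (λ _ → true) ≡
      path 0 n + A 0 * path 1 (3 ℕ.+ N) + B 1 * path 2 (2 ℕ.+ N) + B 0 * path 1 (2 ℕ.+ N)
    cyclic-tilings = begin
      I (w₁ ∷ w₂ ∷ w₃ ∷ tiles n) (λ _ → true)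
        ≡⟨ cong₂ _+_ (cong₂ _*_ (sym A-wrap) through-w₁) (cong₂ _+_ (cong₂ _*_ (sym B-wrap₁) through-w₂)
             (cong₂ _+_ (cong₂ _*_ (sym B-wrap₀) through-w₃) uncut)) ⟩
      A 0 * path 1 (3 ℕ.+ N) + (B 1 * path 2 (2 ℕ.+ N) + (B 0 * path 1 (2 ℕ.+ N) + path 0 n))
        ≡⟨ solve 4 (λ s t u v → s :+ (t :+ (u :+ v)) := v :+ s :+ t :+ u) refl
             (A 0 * path 1 (3 ℕ.+ N)) (B 1 * path 2 (2 ℕ.+ N)) (B 0 * path 1 (2 ℕ.+ N)) (path 0 n) ⟩
      path 0 n + A 0 * path 1 (3 ℕ.+ N) + B 1 * path 2 (2 ℕ.+ N) + B 0 * path 1 (2 ℕ.+ N) ∎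
      where
      open ≡-Reasoning
      avoids : Factor → Factor → Bool
      avoids w g = not (consO n w g)
      paths : ∀ r m k → m ℕ.+ r ≡ k → r ≤ 2 → k ≤ n → I (tiles k) (from r) ≡ path r m
      paths r m .(m ℕ.+ r) refl r≤2 p = sym (path-tilings r r≤2 m p)
      through-w₁ : I (w₂ ∷ w₃ ∷ tiles n) (avoids w₁) ≡ path 1 (3 ℕ.+ N)
      through-w₁ = begin
        I (w₂ ∷ w₃ ∷ tiles n) (avoids w₁) ≡⟨ skip {consO n} {ω} w₂ (w₃ ∷ tiles n) (avoids w₁) (cong not wrap₁₂) ⟩
        I (w₃ ∷ tiles n) (avoids w₁)      ≡⟨ skip {consO n} {ω} w₃ (tiles n) (avoids w₁) (cong not wrap₁₃) ⟩
        I (tiles n) (avoids w₁)           ≡⟨ truncate (4 ℕ.+ N) (avoids w₁) (λ g e → cong not (wrap₁-end g e)) ⟩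
        I (tiles (4 ℕ.+ N)) (avoids w₁)   ≡⟨ tiles-cong (4 ℕ.+ N) wrap₁-start ⟩
        I (tiles (4 ℕ.+ N)) (from 1)                     ≡⟨ paths 1 (3 ℕ.+ N) (4 ℕ.+ N) (ℕₚ.+-comm (3 ℕ.+ N) 1) (s≤s z≤n) (ℕₚ.n≤1+n _) ⟩
        path 1 (3 ℕ.+ N)                                 ∎
      through-w₂ : I (w₃ ∷ tiles n) (avoids w₂) ≡ path 2 (2 ℕ.+ N)
      through-w₂ = begin
        I (w₃ ∷ tiles n) (avoids w₂)      ≡⟨ skip {consO n} {ω} w₃ (tiles n) (avoids w₂) (cong not wrap₂₃) ⟩
        I (tiles n) (avoids w₂)           ≡⟨ truncate (4 ℕ.+ N) (avoids w₂) (λ g e → cong not (wrap₂-end g e)) ⟩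
        I (tiles (4 ℕ.+ N)) (avoids w₂)   ≡⟨ tiles-cong (4 ℕ.+ N) wrap₂-start ⟩
        I (tiles (4 ℕ.+ N)) (from 2)                     ≡⟨ paths 2 (2 ℕ.+ N) (4 ℕ.+ N) (ℕₚ.+-comm (2 ℕ.+ N) 2) ℕₚ.≤-refl (ℕₚ.n≤1+n _) ⟩
        path 2 (2 ℕ.+ N)                                 ∎
      through-w₃ : I (tiles n) (avoids w₃) ≡ path 1 (2 ℕ.+ N)
      through-w₃ = begin
        I (tiles n) (avoids w₃)           ≡⟨ truncate (4 ℕ.+ N) (avoids w₃) (λ g e → cong not (wrap₃-end g e)) ⟩
        I (tiles (4 ℕ.+ N)) (avoids w₃)   ≡⟨ truncate (3 ℕ.+ N) (avoids w₃) (λ g e → cong not (wrap₃-end′ g e)) ⟩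
        I (tiles (3 ℕ.+ N)) (avoids w₃)   ≡⟨ tiles-cong (3 ℕ.+ N) wrap₃-start ⟩
        I (tiles (3 ℕ.+ N)) (from 1)                     ≡⟨ paths 1 (2 ℕ.+ N) (3 ℕ.+ N) (ℕₚ.+-comm (2 ℕ.+ N) 1) (s≤s z≤n) (ℕₚ.m≤n+m _ 2) ⟩
        path 1 (2 ℕ.+ N)                                 ∎
      uncut : I (tiles n) (λ _ → true) ≡ path 0 n
      uncut = paths 0 n n (ℕₚ.+-identityʳ n) z≤n ℕₚ.≤-refl

    -- The lower state entries are delayed values, so the second and third diagonal entries are
    -- first entries one and two steps earlier. One step takes e₃ to B r • e₁ and e₂ to A r • e₁
    -- plus e₃, which leaves only paths started at e₁.
    trace-expansion : trace A B n ≡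
      path 0 n + A 0 * path 1 (3 ℕ.+ N) + B 1 * path 2 (2 ℕ.+ N) + B 0 * path 1 (2 ℕ.+ N)
    trace-expansion = begin
      path 0 n + π₂ (run A B 0 n e₂) + π₃ (run A B 0 n e₃)
        ≡⟨ cong₂ (λ s t → path 0 n + s + t) second third ⟩
      path 0 n + (A 0 * path 1 (3 ℕ.+ N) + B 1 * path 2 (2 ℕ.+ N)) + B 0 * path 1 (2 ℕ.+ N)
        ≡⟨ cong (_+ B 0 * path 1 (2 ℕ.+ N)) (sym (+-assoc (path 0 n) _ _)) ⟩
      _ ∎
      where
      open ≡-Reasoning
      from-state : ∀ r m s → π₁ (run A B r m s) ≡
        π₁ s * path r m + (π₂ s * π₁ (run A B r m e₂) + π₃ s * π₁ (run A B r m e₃))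
      from-state r m s = cong π₁ (linear-combination (run-linear A B r m) s)
      e₃-start : ∀ r m → π₁ (run A B r (suc m) e₃) ≡ B r * path (suc r) m
      e₃-start r m = trans (from-state (suc r) m (step A B r e₃))
        (solve 5 (λ a b p q t → (:0 :+ a :* :0 :+ b :* :1) :* p :+ (:0 :* q :+ :0 :* t) := b :* p) refl
          (A r) (B r) (path (suc r) m) (π₁ (run A B (suc r) m e₂)) (π₁ (run A B (suc r) m e₃)))
      e₂-start : ∀ r m → π₁ (run A B r (suc m) e₂) ≡ A r * path (suc r) m + π₁ (run A B (suc r) m e₃)
      e₂-start r m = trans (from-state (suc r) m (step A B r e₂))
        (solve 5 (λ a b p q t → (:0 :+ a :* :1 :+ b :* :0) :* p :+ (:0 :* q :+ :1 :* t) := a :* p :+ t) refl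
          (A r) (B r) (path (suc r) m) (π₁ (run A B (suc r) m e₂)) (π₁ (run A B (suc r) m e₃)))
      second : π₂ (run A B 0 n e₂) ≡ A 0 * path 1 (3 ℕ.+ N) + B 1 * path 2 (2 ℕ.+ N)
      second = begin
        π₂ (run A B 0 n e₂)                                         ≡⟨ cong π₂ (run-snoc A B 0 (4 ℕ.+ N) e₂) ⟩
        π₁ (run A B 0 (4 ℕ.+ N) e₂)                                 ≡⟨ e₂-start 0 (3 ℕ.+ N) ⟩
        A 0 * path 1 (3 ℕ.+ N) + π₁ (run A B 1 (3 ℕ.+ N) e₃)        ≡⟨ cong (A 0 * path 1 (3 ℕ.+ N) +_) (e₃-start 1 (2 ℕ.+ N)) ⟩
        _                                                           ∎
      third : π₃ (run A B 0 n e₃) ≡ B 0 * path 1 (2 ℕ.+ N)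
      third = begin
        π₃ (run A B 0 n e₃)            ≡⟨ cong π₃ (run-snoc A B 0 (4 ℕ.+ N) e₃) ⟩
        π₂ (run A B 0 (4 ℕ.+ N) e₃)    ≡⟨ cong π₂ (run-snoc A B 0 (3 ℕ.+ N) e₃) ⟩
        π₁ (run A B 0 (3 ℕ.+ N) e₃)    ≡⟨ e₃-start 0 (2 ℕ.+ N) ⟩
        B 0 * path 1 (2 ℕ.+ N)         ∎

    factors-↭ : factors n ↭ w₁ ∷ w₂ ∷ w₃ ∷ tiles n
    factors-↭ = ↭-trans (Permₚ.++⁺ (Permₚ.map⁺ big (upTo-↭ n)) (Permₚ.map⁺ small (upTo-↭ n)))
      (↭-trans (Permₚ.shift (small (4 ℕ.+ N)) (map big (downFrom n)) (map small (downFrom (4 ℕ.+ N))))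
        (prep _ (prep _ (prep _ (↭-sym (tiles-↭ (3 ℕ.+ N)))))))
      where
      upTo-↭ : ∀ m → upTo m ↭ downFrom m
      upTo-↭ m = subst (upTo m ↭_) (Listₚ.reverse-upTo m) (↭-sym (Permₚ.↭-reverse (upTo m)))
      tiles-↭ : ∀ m → tiles (2 ℕ.+ m) ↭ map big (downFrom m) ++ map small (downFrom (suc m))
      tiles-↭ zero = ↭-refl
      tiles-↭ (suc m) = prep (big m) (↭-trans (prep (small (suc m)) (tiles-↭ m))
        (↭-sym (Permₚ.shift (small (suc m)) (map big (downFrom m)) (map small (downFrom (suc m))))))

    indep-trace : I (factors n) (λ _ → true) ≡ trace A B n
    indep-trace = trans (indep-↭ (consO-symmetric n) factors-↭ (λ _ → true)) (trans cyclic-tilings (sym trace-expansion))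

-- Cancelling a linear factor from a polynomial identity.

module LinearFactor (R : RealField) where
  open RealFieldProperties R
  open ℤ-Solver using (solve; _:=_; _:+_; _:*_)

  module _ (a b : Carrier) where
    private
      -- Coefficients of (a + b z) p(z) + b r, where r is the coefficient preceding those of p.
      multiply : ℕ → (ℕ → Carrier) → Carrier → ℕ → Carrier
      multiply zero    f r zero    = b * r
      multiply zero    f r (suc k) = 0#
      multiply (suc m) f r zero    = a * f 0 + b * r
      multiply (suc m) f r (suc k) = multiply m (f ∘ suc) (f 0) k

      evalPoly-multiply : ∀ m f r z → evalPoly (suc m) (multiply m f r) z ≡ (a + z * b) * evalPoly m f z + b * r
      evalPoly-multiply zero f r z = solve 4 (λ a b r z → b :* r :+ z :* :0 := (a :+ z :* b) :* :0 :+ b :* r) refl a b r z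
      evalPoly-multiply (suc m) f r z = trans
        (cong (λ t → a * f 0 + b * r + z * t) (evalPoly-multiply m (f ∘ suc) (f 0) z))
        (solve 6 (λ a b r z f₀ p → a :* f₀ :+ b :* r :+ z :* ((a :+ z :* b) :* p :+ b :* f₀)
                                := (a :+ z :* b) :* (f₀ :+ z :* p) :+ b :* r) refl
          a b r z (f 0) (evalPoly m (f ∘ suc) z))

      -- Division from the lowest coefficient upwards: once r = 0, the next coefficient equation
      -- reads a * f 0 = 0.
      multiply-injective : ¬ a ≡ 0# → ∀ m f r → r ≡ 0# → (∀ k → k < suc m → multiply m f r k ≡ 0#) →
        ∀ k → k < m → f k ≡ 0#
      multiply-injective a≢0 (suc m) f r r≡0 vanish = λ where
          zero _ → f₀≡0
          (suc k) (s≤s k<m) → multiply-injective a≢0 m (f ∘ suc) (f 0) f₀≡0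
            (λ j j<m → vanish (suc j) (s≤s j<m)) k k<m
        where
        f₀≡0 : f 0 ≡ 0#
        f₀≡0 = *-cancelˡ-0 a≢0 (trans
          (trans (sym (+-identityʳ _)) (cong (a * f 0 +_) (sym (trans (cong (b *_) r≡0) (zeroʳ b)))))
          (vanish 0 (s≤s z≤n)))

    linear-factor-cancel : ¬ a ≡ 0# → ∀ m f → (∀ z → (a + z * b) * evalPoly m f z ≡ 0#) → ∀ k → k < m → f k ≡ 0#
    linear-factor-cancel a≢0 m f vanish = multiply-injective a≢0 m f 0# refl
      (evalPoly-injective (suc m) (multiply m f 0#) (λ z _ → trans (evalPoly-multiply m f 0# z)
        (trans (cong₂ _+_ (vanish z) (zeroʳ b)) (+-identityʳ 0#))))

-- Both families of invariants as traces, and their equality.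

module Inscribed (R : RealField) where
  open RealFieldProperties R
  open ℤ-Solver using (solve; _:=_; _:+_; _:*_; :-_; _:-_)
  open Geometry R
  open CrossRatioCoordinates R
  open TransferMatrices R
  open IndependencePolynomial R
  open CyclicTilings R
  open LinearFactor R

  module _ {n : ℕ} where
    sucₙ-last : ∀ {i} → suc i ≡ n → sucₙ n i ≡ 0
    sucₙ-last {i} refl rewrite ≡ᵇ-refl i = refl

    sucₙ-bounded : ∀ {i} → i < n → sucₙ n i < n
    sucₙ-bounded {i} i<n with ℕₚ.m≤n⇒m<n∨m≡n i<n
    ... | inj₁ p rewrite sucₙ-< p = p
    ... | inj₂ p rewrite sucₙ-last p = ℕₚ.≤-<-trans z≤n i<n

    sucₙ-injective : ∀ {i j} → i < n → j < n → (sucₙ n i ≡ᵇ sucₙ n j) ≡ (i ≡ᵇ j)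
    sucₙ-injective {i} {j} i<n j<n with ℕₚ.m≤n⇒m<n∨m≡n i<n | ℕₚ.m≤n⇒m<n∨m≡n j<n
    ... | inj₁ p | inj₁ q rewrite sucₙ-< p | sucₙ-< q = refl
    ... | inj₁ p | inj₂ q rewrite sucₙ-< p | sucₙ-last q = sym (<⇒≡ᵇ-false (s≤s⁻¹ (subst (suc i <_) (sym q) p)))
    ... | inj₂ p | inj₁ q rewrite sucₙ-last p | sucₙ-< q = sym (>⇒≡ᵇ-false (s≤s⁻¹ (subst (suc j <_) (sym p) q)))
    ... | inj₂ p | inj₂ q rewrite sucₙ-last p | sucₙ-last q with trans p (sym q)
    ...   | refl = sym (≡ᵇ-refl i)

    predₙ-sucₙ : ∀ {i} → i < n → predₙ n (sucₙ n i) ≡ i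
    predₙ-sucₙ {i} i<n with ℕₚ.m≤n⇒m<n∨m≡n i<n
    ... | inj₁ p rewrite sucₙ-< p = refl
    ... | inj₂ refl rewrite ≡ᵇ-refl i = refl

  -- When y_i is given the cells i, i+1 and Y_{i+1} the cells i, i+1, i+2, consecutive
  -- monomials are again overlapping tiles.
  rotate : ℕ → Factor → Factor
  rotate n (big i)   = big (sucₙ n i)
  rotate n (small i) = small i

  consE-symmetric : ∀ n f g → consE n f g ≡ consE n g f
  consE-symmetric n (big i)   (big j)   = consO-symmetric n (big i) (big j)
  consE-symmetric n (big i)   (small j) = refl
  consE-symmetric n (small i) (big j)   = refl
  consE-symmetric n (small i) (small j) = consO-symmetric n (small i) (small j)

  consE-rotate : ∀ n {f g} → start f < n → start g < n → consE n (rotate n f) (rotate n g) ≡ consO n f g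
  consE-rotate n {big i} {big j} p q
    rewrite sucₙ-injective q p | sucₙ-injective q (sucₙ-bounded p) | sucₙ-injective q (sucₙ-bounded (sucₙ-bounded p))
          | sucₙ-injective p (sucₙ-bounded q) | sucₙ-injective p (sucₙ-bounded (sucₙ-bounded q)) = refl
  consE-rotate n {big i} {small j} p q
    rewrite sucₙ-injective p (sucₙ-bounded q) | sucₙ-injective p q | ≡ᵇ-comm i j = refl
  consE-rotate n {small j} {big i} q p
    rewrite sucₙ-injective p (sucₙ-bounded q) | sucₙ-injective p q | ≡ᵇ-comm i j = refl
  consE-rotate n {small i} {small j} p q = refl

  factors-bounded : ∀ n → All (λ f → start f < n) (factors n)
  factors-bounded n = Allₚ.++⁺ (Allₚ.map⁺ (Allₚ.all-upTo n)) (Allₚ.map⁺ (Allₚ.all-upTo n))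

  factors-rotate : ∀ m → factors (suc m) ↭ map (rotate (suc m)) (factors (suc m))
  factors-rotate m = subst (factors n ↭_) (sym map-rotate) (Permₚ.++⁺ʳ (map small (upTo n)) (Permₚ.map⁺ big upTo-rotate))
    where
    open ≡-Reasoning
    n = suc m
    map-rotate : map (rotate n) (factors n) ≡ map big (map (sucₙ n) (upTo n)) ++ map small (upTo n)
    map-rotate = trans (Listₚ.map-++ (rotate n) (map big (upTo n)) (map small (upTo n)))
      (cong₂ _++_ (trans (sym (Listₚ.map-∘ (upTo n))) (Listₚ.map-∘ (upTo n))) (sym (Listₚ.map-∘ (upTo n))))
    successors : ∀ l → All (_< m) l → map (sucₙ n) l ≡ map suc l
    successors [] [] = refl
    successors (i ∷ l) (p ∷ ps) = cong₂ _∷_ (sucₙ-< (s≤s p)) (successors l ps)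
    rotated : map (sucₙ n) (upTo n) ≡ applyUpTo suc m ∷ʳ 0
    rotated = begin
      map (sucₙ n) (upTo n)                   ≡⟨ cong (map (sucₙ n)) (Listₚ.upTo-∷ʳ m) ⟨
      map (sucₙ n) (upTo m ∷ʳ m)              ≡⟨ Listₚ.map-++ (sucₙ n) (upTo m) (m ∷ []) ⟩
      map (sucₙ n) (upTo m) ∷ʳ sucₙ n m       ≡⟨ cong₂ _∷ʳ_ (trans (successors (upTo m) (Allₚ.all-upTo m)) (Listₚ.map-upTo suc m)) (sucₙ-last {n} refl) ⟩
      applyUpTo suc m ∷ʳ 0                    ∎
    upTo-rotate : upTo n ↭ map (sucₙ n) (upTo n)
    upTo-rotate = subst (upTo n ↭_) (sym rotated) (Permₚ.∷↭∷ʳ 0 (applyUpTo suc m))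

  -- Rotating the big factors permutes the list and turns the conflicts of E into those of O, so one
  -- trace formula serves both families.
  indep-rotate : ∀ m ω → indep (consE (suc m)) ω (factors (suc m)) (λ _ → true)
    ≡ indep (consO (suc m)) (ω ∘ rotate (suc m)) (factors (suc m)) (λ _ → true)
  indep-rotate m ω = begin
    indep (consE n) ω (factors n) (λ _ → true)
      ≡⟨ indep-↭ (consE-symmetric n) (factors-rotate m) (λ _ → true) ⟩
    indep (consE n) ω (map (rotate n) (factors n)) (λ _ → true)
      ≡⟨ indep-map (consE n) ω (rotate n) (factors n) (λ _ → true) ⟩
    indep (λ f g → consE n (rotate n f) (rotate n g)) (ω ∘ rotate n) (factors n) (λ _ → true)
      ≡⟨ indep-cong (λ f → start f < n) (λ {f} {g} → consE-rotate n {f} {g}) (λ _ → refl) (λ _ → refl) (factors-bounded n) ⟩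
    indep (consO n) (ω ∘ rotate n) (factors n) (λ _ → true) ∎
    where
    open ≡-Reasoning
    n = suc m

  productUpTo : (ℕ → Carrier) → ℕ → Carrier
  productUpTo f m = prodR (applyUpTo f m)

  productUpTo-cong : ∀ {f g} → (∀ j → f j ≡ g j) → ∀ m → productUpTo f m ≡ productUpTo g m
  productUpTo-cong f≡g zero = refl
  productUpTo-cong f≡g (suc m) = cong₂ _*_ (f≡g 0) (productUpTo-cong (f≡g ∘ suc) m)

  productUpTo-* : ∀ f g m → productUpTo (λ j → f j * g j) m ≡ productUpTo f m * productUpTo g m
  productUpTo-* f g zero = sym (*-identityˡ 1#)
  productUpTo-* f g (suc m) = trans (cong (f 0 * g 0 *_) (productUpTo-* (f ∘ suc) (g ∘ suc) m))
    (solve 4 (λ a b s t → a :* b :* (s :* t) := a :* s :* (b :* t)) refl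
      (f 0) (g 0) (productUpTo (f ∘ suc) m) (productUpTo (g ∘ suc) m))

  productUpTo-≢0 : ∀ {f} → (∀ j → ¬ f j ≡ 0#) → ∀ m → ¬ productUpTo f m ≡ 0#
  productUpTo-≢0 f≢0 zero = RealField.0≢1 R ∘ sym
  productUpTo-≢0 f≢0 (suc m) = *-≢0 (f≢0 0) (productUpTo-≢0 (f≢0 ∘ suc) m)

  productUpTo-shift : ∀ {f} m → ¬ f 0 ≡ 0# → f m ≡ f 0 → productUpTo (f ∘ suc) m ≡ productUpTo f m
  productUpTo-shift {f} m f0≢0 fm≡f0 = *-cancelˡ f0≢0 (trans (ends f m) (trans (cong (productUpTo f m *_) fm≡f0) (*-comm _ _)))
    where
    ends : ∀ f m → f 0 * productUpTo (f ∘ suc) m ≡ productUpTo f m * f m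
    ends f zero = *-comm _ _
    ends f (suc m) = trans (cong (f 0 *_) (ends (f ∘ suc) m)) (sym (*-assoc _ _ _))

  evalPoly-− : ∀ m f g z → evalPoly m (λ k → f k − g k) z ≡ evalPoly m f z − evalPoly m g z
  evalPoly-− zero f g z = sym (-‿inverseʳ 0#)
  evalPoly-− (suc m) f g z = trans (cong (λ t → f 0 − g 0 + z * t) (evalPoly-− m (f ∘ suc) (g ∘ suc) z))
    (solve 5 (λ a b z s t → a :- b :+ z :* (s :- t) := a :+ z :* s :- (b :+ z :* t)) refl
      (f 0) (g 0) z (evalPoly m (f ∘ suc) z) (evalPoly m (g ∘ suc) z))

  -- A product over a full period does not change under a shift. Hence the X-relations and the
  -- Y-relations, multiplied over a period, have the same right side and the same product of the 1 -
  -- c.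
  products-agree : ∀ n {X Y} → Coordinates n X Y → productUpTo (λ j → X (2 ℕ.+ j)) n ≡ productUpTo (λ j → Y (2 ℕ.+ j)) n
  products-agree n {X} {Y} coordinates = *-cancelˡ (productUpTo-≢0 (λ j → 1-c≢0 (1 ℕ.+ j)) n) (begin
    D * productUpTo (λ j → X (2 ℕ.+ j)) n
      ≡⟨ *-comm _ _ ⟩
    productUpTo (λ j → X (2 ℕ.+ j)) n * D
      ≡⟨ cong (productUpTo (λ j → X (2 ℕ.+ j)) n *_) (productUpTo-shift n (1-c≢0 1) (cong (1# −_) (c-periodic 2))) ⟨
    productUpTo (λ j → X (2 ℕ.+ j)) n * productUpTo (λ j → 1# − c (3 ℕ.+ j)) n
      ≡⟨ productUpTo-* _ _ n ⟨
    productUpTo (λ j → X (2 ℕ.+ j) * (1# − c (3 ℕ.+ j))) n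
      ≡⟨ productUpTo-cong (λ j → X-relation (2 ℕ.+ j)) n ⟩
    productUpTo (λ j → c (2 ℕ.+ j)) n
      ≡⟨ productUpTo-shift n (c≢0 2) (c-periodic 2) ⟨
    productUpTo (λ j → c (3 ℕ.+ j)) n
      ≡⟨ productUpTo-cong (λ j → Y-relation (2 ℕ.+ j)) n ⟨
    productUpTo (λ j → Y (2 ℕ.+ j) * (1# − c (2 ℕ.+ j))) n
      ≡⟨ productUpTo-* _ _ n ⟩
    productUpTo (λ j → Y (2 ℕ.+ j)) n * D
      ≡⟨ *-comm _ _ ⟩
    D * productUpTo (λ j → Y (2 ℕ.+ j)) n ∎)
    where
    open ≡-Reasoning
    open Coordinates coordinates
    D = productUpTo (λ j → 1# − c (2 ℕ.+ j)) n
    1-c≢0 : ∀ j → ¬ 1# − c (suc j) ≡ 0#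
    1-c≢0 j = *-≢0ʳ λ p → c≢0 j (trans (sym (X-relation j)) p)

  module _ (N : ℕ) where
    private
      n = 5 ℕ.+ N

    module _ (x y : ℤ → Carrier) where
      X Y : ℕ → Carrier
      X j = x (ℤ.+ j ℤ.- ℤ.+ 2)
      Y j = y (ℤ.+ j ℤ.- ℤ.+ 2)

      private
        unshift : ∀ (w : ℤ → Carrier) j → w (ℤ.+ (2 ℕ.+ j) ℤ.- ℤ.+ 2) ≡ w (ℤ.+ j)
        unshift w j = cong w (trans (ℤₚ.[1+m]⊖[1+n]≡m⊖n (1 ℕ.+ j) 1) (ℤₚ.[1+m]⊖[1+n]≡m⊖n j 0))

      module _ (X-periodic : ∀ j → X (j ℕ.+ n) ≡ X j) (Y-periodic : ∀ j → Y (j ℕ.+ n) ≡ Y j)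
               (coordinates : Coordinates n X Y) where
        open Coordinates coordinates

        private
          -- X 0 and X 1 have the true indices -2 and -1; the polynomials use the residues n - 2 and
          -- n - 1 instead.
          wrap : ∀ (w : ℤ → Carrier) → (∀ j → w (ℤ.+ (j ℕ.+ n) ℤ.- ℤ.+ 2) ≡ w (ℤ.+ j ℤ.- ℤ.+ 2)) →
                 ∀ j k → j ℕ.+ n ≡ 2 ℕ.+ k → w (ℤ.+ j ℤ.- ℤ.+ 2) ≡ w (ℤ.+ k)
          wrap w periodic j k p = trans (sym (periodic j)) (trans (cong (λ i → w (ℤ.+ i ℤ.- ℤ.+ 2)) p) (unshift w k))

          X₀ = wrap x X-periodic 0 (3 ℕ.+ N) refl
          X₁ = wrap x X-periodic 1 (4 ℕ.+ N) refl
          Y₀ = wrap y Y-periodic 0 (3 ℕ.+ N) refl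
          Y₁ = wrap y Y-periodic 1 (4 ℕ.+ N) refl

          last : sucₙ n (4 ℕ.+ N) ≡ 0
          last = sucₙ-last {n} refl

          second-to-last : sucₙ n (3 ℕ.+ N) ≡ 4 ℕ.+ N
          second-to-last = sucₙ-< {n} {3 ℕ.+ N} ℕₚ.≤-refl

        module _ (z : Carrier) where
          open Intertwining coordinates z

          O-trace : indep (consO n) (λ f → z * signed (valO n x y) f) (factors n) (λ _ → true) ≡ trace A B n
          O-trace = indep-trace N _ A B
            (λ j _ → cong (z *_) (unshift x j))
            (λ j p → cong₂ (λ s t → z * - (s * t)) (cong₂ _*_ (unshift x j) (unshift y j))
              (trans (unshift x (suc j)) (cong (at x) (sym (sucₙ-< (ℕₚ.<⇒≤ p))))))
            (cong (z *_) X₁)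
            (cong₂ (λ s t → z * - (s * t)) (cong₂ _*_ X₀ Y₀) (trans X₁ (cong (at x) (sym second-to-last))))
            (cong₂ (λ s t → z * - (s * t)) (cong₂ _*_ X₁ Y₁) (trans (unshift x 0) (cong (at x) (sym last))))

          E-trace : indep (consE n) (λ f → z * signed (valE n x y) f) (factors n) (λ _ → true) ≡ trace A′ B′ n
          E-trace = trans (indep-rotate (4 ℕ.+ N) _) (indep-trace N _ A′ B′
            (λ j _ → cong (z *_) (unshift y j))
            (λ j p → big-weight j (ℕₚ.≤-trans (ℕₚ.m≤n+m _ 2) p) (unshift y j)
              (trans (unshift x (suc j)) (cong (at x) (sym (sucₙ-< (ℕₚ.<⇒≤ p)))))
              (trans (unshift y (suc j)) (cong (at y) (sym (sucₙ-< (ℕₚ.<⇒≤ p))))))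
            (cong (z *_) Y₁)
            (big-weight (3 ℕ.+ N) (ℕₚ.n≤1+n _) Y₀ (trans X₁ (cong (at x) (sym second-to-last))) (trans Y₁ (cong (at y) (sym second-to-last))))
            (big-weight (4 ℕ.+ N) ℕₚ.≤-refl Y₁ (trans (unshift x 0) (cong (at x) (sym last))) (trans (unshift y 0) (cong (at y) (sym last)))))
            where
            -- The tile `big j` carries Y of index j + 1, so its first factor y has the index j in
            -- the form `predₙ n (sucₙ n j)`.
            big-weight : ∀ j {s t u} → j < n → s ≡ at y j → t ≡ at x (sucₙ n j) → u ≡ at y (sucₙ n j) →
              z * - (s * t * u) ≡ z * - valE n x y (big (sucₙ n j))
            big-weight j j<n p q r = cong₂ (λ s t → z * - (s * t))
              (cong₂ _*_ (trans p (cong (at y) (sym (predₙ-sucₙ j<n)))) q) r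

        difference : ℕ → Carrier
        difference k = Opoly n k x y − Epoly n k x y

        private
          m = suc (length (factors n))

        difference-vanishes : ∀ z → (c 0 * c 1 + z * Intertwining.gauge-slope coordinates z) * evalPoly m difference z ≡ 0#
        difference-vanishes z = begin
          D * evalPoly m difference z
            ≡⟨ cong (D *_) (evalPoly-− m (λ k → Opoly n k x y) (λ k → Epoly n k x y) z) ⟩
          D * (evalPoly m (λ k → Opoly n k x y) z − evalPoly m (λ k → Epoly n k x y) z)
            ≡⟨ cong₂ (λ s t → D * (s − t)) (trans (generating-function consO valO n x y z) (O-trace z)) (trans (generating-function consE valE n x y z) (E-trace z)) ⟩
          D * (trace A B n − trace A′ B′ n)
            ≡⟨ solve 3 (λ d s t → d :* (s :- t) := d :* s :- d :* t) refl D (trace A B n) (trace A′ B′ n) ⟩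
          D * trace A B n − D * trace A′ B′ n
            ≡⟨ cong (_− D * trace A′ B′ n) (subst (λ d → d * trace A B n ≡ d * trace A′ B′ n) gauge-determinant (traces-agree X-periodic Y-periodic)) ⟩
          D * trace A′ B′ n − D * trace A′ B′ n
            ≡⟨ -‿inverseʳ _ ⟩
          0# ∎
          where
          open ≡-Reasoning
          open Intertwining coordinates z
          D = c 0 * c 1 + z * gauge-slope

        O≡E : ∀ k → k ≤ ⌊ n /2⌋ → Opoly n k x y ≡ Epoly n k x y
        -- `gauge-slope` is independent of z, so the argument 0 stands for any value.
        O≡E k k≤n/2 = +-cancel-≡ (linear-factor-cancel (c 0 * c 1) (Intertwining.gauge-slope coordinates 0#)
          (*-≢0 (c≢0 0) (c≢0 1)) m difference difference-vanishes k
          (s≤s (ℕₚ.≤-trans k≤n/2 (ℕₚ.≤-trans (ℕₚ.⌊n/2⌋≤n n) n≤length))))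
          where
          n≤length : n ≤ length (factors n)
          n≤length = subst (n ≤_) (sym (Listₚ.length-++ (map big (upTo n))))
            (ℕₚ.≤-trans (ℕₚ.≤-reflexive (sym (trans (Listₚ.length-map big (upTo n)) (Listₚ.length-upTo n)))) (ℕₚ.m≤m+n _ _))

        Oprod≡Eprod : Oprod n x y ≡ Eprod n x y
        Oprod≡Eprod = trans (sym (product-at x)) (trans (products-agree n coordinates) (product-at y))
          where
          product-at : ∀ w → productUpTo (λ j → w (ℤ.+ (2 ℕ.+ j) ℤ.- ℤ.+ 2)) n ≡ prodR (map (at w) (upTo n))
          product-at w = trans (productUpTo-cong {λ j → w (ℤ.+ (2 ℕ.+ j) ℤ.- ℤ.+ 2)} {at w} (unshift w) n)
            (cong prodR (sym (Listₚ.map-upTo (at w) n)))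

theorem1p1 : (R : RealField) → let open RealField R using (Carrier) in let open Geometry R in
    (n : ℕ) → 5 ≤ n →
    (v : ℤ → V3) → TwistedPolygon n v →
    (C : NondegConic) → (∀ i → OnConic C (v i)) →
    (x y : ℤ → Carrier) →
    (∀ i → IsCornerX v i (x i)) → (∀ i → IsCornerY v i (y i)) →
    ((k : ℕ) → 1 ≤ k → k ≤ ⌊ n /2⌋ → Opoly n k x y ≡ Epoly n k x y)
    × (Oprod n x y ≡ Eprod n x y)
theorem1p1 R n (s≤s (s≤s (s≤s (s≤s (s≤s (z≤n {N})))))) v polygon C on-conic x y corner-x corner-y =
    -- Coordinates exist only up to double negation, so the negated equation is refuted and
    -- stability is applied.
    (λ k _ k≤n/2 → ≡-stable λ O≢E → inscribed-coordinates λ coordinates →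
      O≢E (O≡E N x y X-periodic Y-periodic coordinates k k≤n/2))
  , ≡-stable λ O≢E → inscribed-coordinates λ coordinates →
      O≢E (Oprod≡Eprod N x y X-periodic Y-periodic coordinates)
  where
  open RealFieldProperties R using (≡-stable)
  open CrossRatioCoordinates.InscribedPolygon R n v polygon C on-conic x y corner-x corner-y
  open Inscribed R using (O≡E; Oprod≡Eprod)
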